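{- Let $\ell\ge r\ge2$ be integers, $Q$ be an $r$-graph, and $F$ be a graph with $\chi(F)=\ell+1$. If $K_{\ell+1}$ is $\partial_{r-2}Q$-edge-stable with respect to $\mathfrak{K}_\ell^2$, then $H_F^r$ is $Q$-edge-stable with respect to $\mathfrak{K}_\ell^r$. Moreover, if $\partial_{r-2}Q$ is $K_{\ell+1}$-Turán-stable, then $Q$ is $H_F^r$-Turán-stable.
   Context: An $r$-graph is a set of $r$-subsets of a finite vertex set. $\mathrm{inj}(Q,\mathcal{H})$ counts injective maps $V(Q)\to V(\mathcal{H})$ sending edges to edges; $\mathrm{inj}(n,Q,\mathcal{F})=\max\{\mathrm{inj}(Q,\mathcal{H}):v(\mathcal{H})=n,\ \mathcal{H}\ \mathcal{F}\text{ -free}\}$. $\partial_{r-2}Q$ is the graph of all pairs contained in some edge of $Q$ ($\partial_0Q=Q$ for $r=2$). $\mathfrak{K}_\ell^r$ is the family of $r$-graphs with a homomorphism to $K_\ell^r$. The expansion $H_F^r$ adds $r-2$ new vertices to each edge of $F$, these sets pairwise disjoint ($H_F^2=F$). $T^r(n,\ell)$ is the balanced complete $\ell$-partite $r$-graph on $[n]$ ($T(n,\ell)=T^2(n,\ell)$). For an $r$-graph $Q$ and family $\mathcal{F}$, $\mathcal{F}$ is $Q$-edge-stable w.r.t. $\mathfrak{K}_\ell^r$ if for every $\varepsilon>0$ there exist $\delta>0,N_0$ such that every $\mathcal{F}$-free $r$-graph $\mathcal{H}$ on $n\ge N_0$ vertices with $\mathrm{inj}(Q,\mathcal{H})\ge(1-\delta)\mathrm{inj}(n,Q,\mathcal{F})$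 lies in $\mathfrak{K}_\ell^r$ after removing at most $\varepsilon n^r$ edges. $Q$ is $H_F^r$-Turán-stable (with $\ell=\chi(F)-1$) if for every $\varepsilon>0$ there exist $\delta>0,N_0$ such that every $H_F^r$-free $r$-graph $\mathcal{H}$ on $n\ge N_0$ vertices with $\mathrm{inj}(Q,\mathcal{H})\ge(1-\delta)\mathrm{inj}(n,Q,H_F^r)$ can be made into a copy of $T^r(n,\ell)$ by deleting and adding at most $\varepsilon n^r$ edges; in particular ($r=2$, $F=K_{\ell+1}$) a graph $Q'$ is $K_{\ell+1}$-Turán-stable if the same holds for $K_{\ell+1}$-free graphs and $T(n,\ell)$. -}

module Defs where

open import Data.Bool using (Bool; true; false; _∧_; _∨_; not; if_then_else_)
import Data.Bool as B
open import Data.Nat using (ℕ; zero; suc; _+_; _∸_; _^_; _%_)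
import Data.Nat as N
open import Data.Fin using (Fin; zero; suc; toℕ; splitAt; remQuot)
import Data.Fin as F
open import Data.Fin.Subset using (Subset; inside; outside; ∣_∣; ⁅_⁆; _∪_)
open import Data.Vec using (Vec; []; _∷_; tabulate; lookup)
open import Data.List using (List; length)
import Data.List as L
open import Data.Sum using (_⊎_; inj₁; inj₂)
open import Data.Product using (Σ; _×_; proj₁)
open import Data.Integer using (+_)
open import Data.Rational using (ℚ; 0ℚ; 1ℚ; _/_; _-_; _*_) renaming (_≤_ to _≤ℚ_; _<_ to _<ℚ_)
open import Relation.Nullary using (¬_)
open import Relation.Nullary.Decidable using (⌊_⌋)
open import Relation.Binary.PropositionalEquality using (_≡_; _≢_)
open import Function.Definitions using (Injective)

countFin : ∀ {k} → (Fin k → Bool) → ℕ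
countFin {zero} P = 0
countFin {suc k} P = (if P zero then 1 else 0) + countFin (λ i → P (suc i))

sumFin : ∀ {k} → (Fin k → ℕ) → ℕ
sumFin {zero} f = 0
sumFin {suc k} f = f zero + sumFin (λ i → f (suc i))

allFin : ∀ {k} → (Fin k → Bool) → Bool
allFin {zero} P = true
allFin {suc k} P = P zero ∧ allFin (λ i → P (suc i))

anyFin : ∀ {k} → (Fin k → Bool) → Bool
anyFin {zero} P = false
anyFin {suc k} P = P zero ∨ anyFin (λ i → P (suc i))

countSub : ∀ {n} → (Subset n → Bool) → ℕ
countSub {zero} P = if P [] then 1 else 0
countSub {suc n} P = countSub (λ s → P (inside ∷ s)) + countSub (λ s → P (outside ∷ s))

allSub : ∀ {n} → (Subset n → Bool) → Bool
allSub {zero} P = P []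
allSub {suc n} P = allSub (λ s → P (inside ∷ s)) ∧ allSub (λ s → P (outside ∷ s))

anySub : ∀ {n} → (Subset n → Bool) → Bool
anySub {zero} P = P []
anySub {suc n} P = anySub (λ s → P (inside ∷ s)) ∨ anySub (λ s → P (outside ∷ s))

allSubsets : ∀ n → List (Subset n)
allSubsets zero = [] L.∷ L.[]
allSubsets (suc n) = L.map (inside ∷_) (allSubsets n) L.++ L.map (outside ∷_) (allSubsets n)

cons : ∀ {m n} → Fin n → (Fin m → Fin n) → Fin (suc m) → Fin n
cons j g zero = j
cons j g (suc i) = g i

countFun : ∀ {m n} → ((Fin m → Fin n) → Bool) → ℕ
countFun {zero} P = if P (λ ()) then 1 else 0
countFun {suc m} P = sumFin (λ j → countFun (λ g → P (cons j g)))

-- r-graphs on vertex set Fin n.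
-- An r-graph is given by its (decidable) edge indicator on subsets; only
-- the values on r-subsets are meaningful (all notions below use isEdge r).

RGraph : ℕ → Set
RGraph n = Subset n → Bool

isSize : ∀ {n} → ℕ → Subset n → Bool
isSize r s = ⌊ ∣ s ∣ N.≟ r ⌋

isEdge : ∀ {n} → ℕ → RGraph n → Subset n → Bool
isEdge r H s = isSize r s ∧ H s

subsetB : ∀ {n} → Subset n → Subset n → Bool
subsetB s t = allFin (λ i → not (lookup s i) ∨ lookup t i)

eqSubB : ∀ {n} → Subset n → Subset n → Bool
eqSubB s t = allFin (λ i → ⌊ lookup s i B.≟ lookup t i ⌋)

image : ∀ {m n} → (Fin m → Fin n) → Subset m → Subset n
image f s = tabulate (λ j → anyFin (λ i → lookup s i ∧ ⌊ f i F.≟ j ⌋))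

injB : ∀ {m n} → (Fin m → Fin n) → Bool
injB f = allFin (λ i → allFin (λ i' → not ⌊ f i F.≟ f i' ⌋ ∨ ⌊ i F.≟ i' ⌋))

presB : ∀ {m n} → ℕ → RGraph m → RGraph n → (Fin m → Fin n) → Bool
presB r Q H f = allSub (λ e → not (isEdge r Q e) ∨ isEdge r H (image f e))

inj : ∀ {m n} → ℕ → RGraph m → RGraph n → ℕ
inj r Q H = countFun (λ f → injB f ∧ presB r Q H f)

Contains : ∀ {p n} → ℕ → RGraph p → RGraph n → Set
Contains r F H = Σ _ (λ f → (injB f ∧ presB r F H f) ≡ true)

Free : ∀ {p n} → ℕ → RGraph p → RGraph n → Set
Free r F H = ¬ Contains r F H

numEdges : ∀ {n} → ℕ → RGraph n → ℕ
numEdges r H = countSub (isEdge r H)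

IsInjMax : ∀ {q p} → ℕ → (n : ℕ) → RGraph q → RGraph p → ℕ → Set
IsInjMax r n Q F m =
  Σ (RGraph n) (λ H → Free r F H × inj r Q H ≡ m)
  × ((H : RGraph n) → Free r F H → inj r Q H N.≤ m)

-- membership in 𝔎_ℓ^r : homomorphism into K_ℓ^r
InK : ∀ {n} → ℕ → ℕ → RGraph n → Set
InK r ℓ H = Σ (Fin _ → Fin ℓ) (λ φ → ∀ s → isEdge r H s ≡ true →
  ∀ i j → lookup s i ≡ true → lookup s j ≡ true → i ≢ j → φ i ≢ φ j)

SubGraph : ∀ {n} → ℕ → RGraph n → RGraph n → Set
SubGraph r H' H = ∀ s → isEdge r H' s ≡ true → isEdge r H s ≡ true

numRemoved : ∀ {n} → ℕ → RGraph n → RGraph n → ℕ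
numRemoved r H H' = countSub (λ s → isEdge r H s ∧ not (H' s))

part : ℕ → ℕ → ℕ
part zero i = 0
part (suc k) i = i % suc k

turan : ℕ → (n : ℕ) → ℕ → RGraph n
turan r n ℓ s = allFin (λ i → allFin (λ j →
  not (lookup s i ∧ lookup s j ∧ not ⌊ i F.≟ j ⌋)
  ∨ not ⌊ part ℓ (toℕ i) N.≟ part ℓ (toℕ j) ⌋))

complete : (k : ℕ) → RGraph k
complete k s = true

shadow : ∀ {q} → ℕ → RGraph q → RGraph q
shadow r Q s = anySub (λ e → isEdge r Q e ∧ subsetB s e)

edgeList : ∀ {p} → RGraph p → List (Subset p)
edgeList {p} F = L.filter (λ s → Data.Bool.T? (isEdge 2 F s)) (allSubsets p)
  where import Data.Bool

expSize : ∀ {p} → ℕ → RGraph p → ℕ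
expSize {p} r F = p + length (edgeList F) N.* (r ∸ 2)

expEdge : ∀ {p} → (r : ℕ) → (F : RGraph p) → Fin (length (edgeList F)) → Subset (expSize r F)
expEdge {p} r F k = tabulate (λ v → g (splitAt p v))
  where
  g : Fin p ⊎ Fin (length (edgeList F) N.* (r ∸ 2)) → Bool
  g (inj₁ a) = lookup (L.lookup (edgeList F) k) a
  g (inj₂ w) = ⌊ proj₁ (remQuot (r ∸ 2) w) F.≟ k ⌋

expansion : ∀ {p} → (r : ℕ) → (F : RGraph p) → RGraph (expSize r F)
expansion r F s = anyFin (λ k → eqSubB s (expEdge r F k))

Colorable : ∀ {p} → RGraph p → ℕ → Set
Colorable {p} F k = Σ (Fin p → Fin k) (λ c → ∀ i j → i ≢ j →
  F (⁅ i ⁆ ∪ ⁅ j ⁆) ≡ true → c i ≢ c j)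

ChromaticNumber : ∀ {p} → RGraph p → ℕ → Set
ChromaticNumber F k = Colorable F k × ¬ Colorable F (k ∸ 1)

ℕtoℚ : ℕ → ℚ
ℕtoℚ m = + m / 1

EdgeStable : ∀ {q p} → ℕ → ℕ → RGraph q → RGraph p → Set
EdgeStable r ℓ Q F =
  (ε : ℚ) → 0ℚ <ℚ ε → Σ ℚ (λ δ → 0ℚ <ℚ δ × Σ ℕ (λ N₀ →
    (n : ℕ) → N₀ N.≤ n → (H : RGraph n) → Free r F H →
    ((m : ℕ) → IsInjMax r n Q F m → (1ℚ - δ) * ℕtoℚ m ≤ℚ ℕtoℚ (inj r Q H)) →
    Σ (RGraph n) (λ H' → SubGraph r H' H
      × ℕtoℚ (numRemoved r H H') ≤ℚ ε * ℕtoℚ (n ^ r)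
      × InK r ℓ H')))

-- Q is F-Turán-stable (with parameter ℓ): H is within εn^r edge edits of a
-- copy σ(T^r(n,ℓ)) of the Turán r-graph, σ a permutation of the vertices
TuranStable : ∀ {q p} → ℕ → ℕ → RGraph q → RGraph p → Set
TuranStable r ℓ Q F =
  (ε : ℚ) → 0ℚ <ℚ ε → Σ ℚ (λ δ → 0ℚ <ℚ δ × Σ ℕ (λ N₀ →
    (n : ℕ) → N₀ N.≤ n → (H : RGraph n) → Free r F H →
    ((m : ℕ) → IsInjMax r n Q F m → (1ℚ - δ) * ℕtoℚ m ≤ℚ ℕtoℚ (inj r Q H)) →
    Σ (Fin n → Fin n) (λ σ → Injective _≡_ _≡_ σ
      × ℕtoℚ (countSub (λ s → isSize r s ∧ (isEdge r H (image σ s) B.xor turan r n ℓ s)))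
          ≤ℚ ε * ℕtoℚ (n ^ r))))

{-# OPTIONS --safe #-}
-- No removal lemma is needed.  Let A be the graph of pairs of large codegree in H.  Every copy of F in A
-- extends greedily to an expansion in H, so A is F-free and, by Erdős, has few copies of K_{ℓ+1}; all but
-- few embeddings of Q into H are homomorphisms of R = ∂Q into A.  Suppose A is far from ℓ-colourable.  Then a
-- positive proportion of its k-tuples span an uncolourable graph, with k bounded (test colourability by
-- branching on vertices that shrink many colour lists).  Sample m vertices of A: usually the sample is
-- K_{ℓ+1}-free, and by stability at the fixed size m it has at most M copies of R (M the extremal number
-- for m vertices), while a sample within a factor 1 - δ of M is nearly ℓ-colourable, so has few uncolourable
-- k-tuples.  Averaging, A has noticeably fewer copies of R than the blown-up M-extremal graph; but the latter
-- is nearly ℓ-partite by stability, and ℓ-partite r-graphs contain no expansion of F, so H is not near-extremal.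
-- For the Turán part, A restricted to the pairs bichromatic for the colouring just found is K_{ℓ+1}-free and
-- near-extremal, hence close to a Turán graph, and each edge of the Turán r-graph missing from H destroys a
-- positive proportion of the embeddings of Q.
-- Throughout ε and δ are 1/E and 1/D, so that all estimates are inequalities between natural numbers;
-- maxima exist only up to double negation, which is harmless because every goal is decidable.
module Submission where

open import Defs
open import Data.Nat using (ℕ; zero; suc; _+_; _*_; _^_; _≤_; _<_; z≤n; s≤s; NonZero)
import Data.Nat as ℕ
open import Data.Nat.Properties
open import Data.Nat.Tactic.RingSolver using (solve-∀)
open import Data.Fin using (Fin; zero; suc; toℕ)
import Data.Fin as Fin
import Data.Fin.Properties as Finₚ
open import Data.List.Properties using (length-map)
open import Data.List using (List; []; _∷_; _++_; length; map; concatMap)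
import Data.List as List
open import Data.Product using (Σ; ∃; _×_; _,_; proj₁; proj₂)
open import Data.Sum using (_⊎_; inj₁; inj₂; [_,_]′)
open import Data.Empty using (⊥; ⊥-elim)
open import Data.Unit using (⊤; tt)
open import Data.Bool using (Bool; true; false; if_then_else_; not)
import Data.Bool as Bool
open import Relation.Nullary using (¬_; Dec; yes; no; does)
open import Relation.Nullary.Decidable using (_×-dec_; _→-dec_; _⊎-dec_; ¬?; decidable-stable; ⌊_⌋; toWitness)
open import Relation.Binary.PropositionalEquality using (_≡_; _≢_; refl; sym; trans; cong; cong₂; subst; module ≡-Reasoning)
open import Function using (_∘_; id)
open import Function.Definitions using (Injective)
open import Data.Fin.Subset using (Subset; ∣_∣; ⁅_⁆; _∪_)
open import Data.Vec using ([]; _∷_; lookup; tabulate)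
import Data.Vec.Properties as Vecₚ
import Data.Fin.Subset.Properties as Subsetₚ
import Data.Fin.Permutation as Perm
open Perm using (Permutation′; _⟨$⟩ʳ_; _⟨$⟩ˡ_)
import Data.Fin.Permutation.Components as PC
import Data.Integer as ℤ
import Data.Integer.Properties as ℤₚ
import Data.Rational as ℚ
import Data.Rational.Properties as ℚₚ
import Data.Rational.Unnormalised as ℚᵘ
import Data.Rational.Unnormalised.Properties as ℚᵘₚ
open ℚ using (ℚ; 0ℚ; 1ℚ)
import Data.Bool.Properties as Boolₚ
open import Data.List.Membership.Propositional using (_∈_)
open import Data.List.Membership.Propositional.Properties using (∈-filter⁺; ∈-filter⁻; ∈-lookup; ∈-map⁺; ∈-++⁺ˡ; ∈-++⁺ʳ)
open import Data.List.Relation.Unary.Any using (here; index)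
open import Data.List.Relation.Unary.Any.Properties using (lookup-index)
open import Function.Bundles using (Equivalence)
import Data.Nat.DivMod as DivMod

-- The hypothesis applies only to `K (suc ℓ)`-free graphs, whereas the graph of heavy pairs merely
-- has few cliques. Samples of a fixed size are usually clique-free because the clique density can
-- be pushed below any constant, even one that depends on the sample size. This dictates the order
-- of the constants: the test length `k` and the density `1/b` come from the target precision; then
-- `D` from stability with a precision depending on `b` and `k`; then a second application of
-- stability, whose error must stay below the sampling deficit `1/(4bD)`; then the sample size `s`;
-- and last the clique density `1/Γ`. None of them depends on `n`. All errors arise as multiples of
-- `n ^ q`, so they are harmless only if the extremal numbers have that order of magnitude, that is,
-- if the shadow of `Q` is ℓ-colourable. This is not assumed; it is extracted from stability in
-- `stable⇒colourable`. In the same way the Turán part extracts an edge of `Q` from its hypothesis.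

variable
  A B : Set
  k m n : ℕ

-- Finite sums and counting by indicators

∑ : List A → (A → ℕ) → ℕ
∑ [] f = 0
∑ (x ∷ xs) f = f x + ∑ xs f

𝟙 : {P : Set} → Dec P → ℕ
𝟙 (yes _) = 1
𝟙 (no _) = 0

# : {P : A → Set} → List A → ((x : A) → Dec (P x)) → ℕ
# xs P? = ∑ xs (λ x → 𝟙 (P? x))

𝟙-yes : {P : Set} (d : Dec P) → P → 𝟙 d ≡ 1
𝟙-yes (yes _) _ = refl
𝟙-yes (no ¬p) p = ⊥-elim (¬p p)

𝟙-no : {P : Set} (d : Dec P) → ¬ P → 𝟙 d ≡ 0
𝟙-no (yes p) ¬p = ⊥-elim (¬p p)
𝟙-no (no _) _ = refl

𝟙-mono : {P Q : Set} (p : Dec P) (q : Dec Q) → (P → Q) → 𝟙 p ≤ 𝟙 q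
𝟙-mono (no _) q h = z≤n
𝟙-mono (yes p) q h = ≤-reflexive (sym (𝟙-yes q (h p)))

𝟙-cong : {P Q : Set} (p : Dec P) (q : Dec Q) → (P → Q) → (Q → P) → 𝟙 p ≡ 𝟙 q
𝟙-cong p q f g = ≤-antisym (𝟙-mono p q f) (𝟙-mono q p g)

𝟙≤1 : {P : Set} (p : Dec P) → 𝟙 p ≤ 1
𝟙≤1 (yes _) = ≤-refl
𝟙≤1 (no _) = z≤n

𝟙-⊎ : {P Q R : Set} (p : Dec P) (q : Dec Q) (r : Dec R) → (P → Q ⊎ R) → 𝟙 p ≤ 𝟙 q + 𝟙 r
𝟙-⊎ (no _) q r h = z≤n
𝟙-⊎ (yes p) q r h with h p
... | inj₁ x rewrite 𝟙-yes q x = s≤s z≤n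
... | inj₂ y rewrite 𝟙-yes r y = m≤n+m 1 (𝟙 q)

𝟙-× : {P Q R : Set} (p : Dec P) (q : Dec Q) (r : Dec R) → (Q → R → P) → (P → Q × R) → 𝟙 p ≡ 𝟙 q * 𝟙 r
𝟙-× p (no ¬q) r f g = 𝟙-no p (λ x → ¬q (proj₁ (g x)))
𝟙-× p (yes q) r f g = trans (𝟙-cong p r (λ x → proj₂ (g x)) (f q)) (sym (+-identityʳ _))

𝟙-*-cong : {P : Set} (d : Dec P) {a b : ℕ} → (P → a ≡ b) → 𝟙 d * a ≡ 𝟙 d * b
𝟙-*-cong (yes p) h = cong (1 *_) (h p)
𝟙-*-cong (no _) h = refl

∑-mono : (xs : List A) {f g : A → ℕ} → (∀ x → f x ≤ g x) → ∑ xs f ≤ ∑ xs g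
∑-mono [] h = z≤n
∑-mono (x ∷ xs) h = +-mono-≤ (h x) (∑-mono xs h)

∑-cong : (xs : List A) {f g : A → ℕ} → (∀ x → f x ≡ g x) → ∑ xs f ≡ ∑ xs g
∑-cong [] h = refl
∑-cong (x ∷ xs) h = cong₂ _+_ (h x) (∑-cong xs h)

∑-+ : (xs : List A) (f g : A → ℕ) → ∑ xs (λ x → f x + g x) ≡ ∑ xs f + ∑ xs g
∑-+ [] f g = refl
∑-+ (x ∷ xs) f g rewrite ∑-+ xs f g = lem (f x) (g x) (∑ xs f) (∑ xs g)
  where
  lem : ∀ a b c d → (a + b) + (c + d) ≡ (a + c) + (b + d)
  lem = solve-∀

∑-*ˡ : (xs : List A) (c : ℕ) (f : A → ℕ) → ∑ xs (λ x → c * f x) ≡ c * ∑ xs f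
∑-*ˡ [] c f = sym (*-zeroʳ c)
∑-*ˡ (x ∷ xs) c f rewrite ∑-*ˡ xs c f = sym (*-distribˡ-+ c (f x) (∑ xs f))

∑-*ʳ : (xs : List A) (c : ℕ) (f : A → ℕ) → ∑ xs (λ x → f x * c) ≡ ∑ xs f * c
∑-*ʳ xs c f = trans (∑-cong xs (λ x → *-comm (f x) c)) (trans (∑-*ˡ xs c f) (*-comm c _))

∑-const : (xs : List A) (c : ℕ) → ∑ xs (λ _ → c) ≡ length xs * c
∑-const [] c = refl
∑-const (x ∷ xs) c = cong (c +_) (∑-const xs c)

∑-zero : (xs : List A) → ∑ xs (λ _ → 0) ≡ 0
∑-zero xs = trans (∑-const xs 0) (*-zeroʳ (length xs))

∑-swap : (xs : List A) (ys : List B) (f : A → B → ℕ) →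
  ∑ xs (λ x → ∑ ys (f x)) ≡ ∑ ys (λ y → ∑ xs (λ x → f x y))
∑-swap [] ys f = sym (∑-zero ys)
∑-swap (x ∷ xs) ys f rewrite ∑-swap xs ys f = sym (∑-+ ys (f x) (λ y → ∑ xs (λ z → f z y)))

∑-++ : (xs ys : List A) (f : A → ℕ) → ∑ (xs ++ ys) f ≡ ∑ xs f + ∑ ys f
∑-++ [] ys f = refl
∑-++ (x ∷ xs) ys f rewrite ∑-++ xs ys f = sym (+-assoc (f x) _ _)

∑-map : (g : A → B) (xs : List A) (f : B → ℕ) → ∑ (map g xs) f ≡ ∑ xs (f ∘ g)
∑-map g [] f = refl
∑-map g (x ∷ xs) f = cong (f (g x) +_) (∑-map g xs f)

∑-concatMap : (g : A → List B) (xs : List A) (f : B → ℕ) →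
  ∑ (concatMap g xs) f ≡ ∑ xs (λ x → ∑ (g x) f)
∑-concatMap g [] f = refl
∑-concatMap g (x ∷ xs) f = trans (∑-++ (g x) (concatMap g xs) f) (cong (∑ (g x) f +_) (∑-concatMap g xs f))

#-mono : {P Q : A → Set} (xs : List A) (P? : ∀ x → Dec (P x)) (Q? : ∀ x → Dec (Q x)) →
  (∀ x → P x → Q x) → # xs P? ≤ # xs Q?
#-mono xs P? Q? h = ∑-mono xs (λ x → 𝟙-mono (P? x) (Q? x) (h x))

#-⊎ : {P Q R : A → Set} (xs : List A) (P? : ∀ x → Dec (P x)) (Q? : ∀ x → Dec (Q x)) (R? : ∀ x → Dec (R x)) →
  (∀ x → P x → Q x ⊎ R x) → # xs P? ≤ # xs Q? + # xs R?
#-⊎ xs P? Q? R? h = ≤-trans (∑-mono xs (λ x → 𝟙-⊎ (P? x) (Q? x) (R? x) (h x))) (≤-reflexive (∑-+ xs _ _))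

#≤length : {P : A → Set} (xs : List A) (P? : ∀ x → Dec (P x)) → # xs P? ≤ length xs
#≤length xs P? = ≤-trans (∑-mono xs (λ x → 𝟙≤1 (P? x))) (≤-reflexive (trans (∑-const xs 1) (*-identityʳ _)))

fins : ∀ n → List (Fin n)
fins zero = []
fins (suc n) = zero ∷ map suc (fins n)

length-fins : ∀ n → length (fins n) ≡ n
length-fins zero = refl
length-fins (suc n) = cong suc (trans (length-map suc (fins n)) (length-fins n))

∑-fins-suc : ∀ n (f : Fin (suc n) → ℕ) → ∑ (fins (suc n)) f ≡ f zero + ∑ (fins n) (f ∘ suc)
∑-fins-suc n f = cong (f zero +_) (∑-map suc (fins n) f)

∑-fins-const : ∀ n c → ∑ (fins n) (λ _ → c) ≡ n * c
∑-fins-const n c = trans (∑-const (fins n) c) (cong (_* c) (length-fins n))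

∑-fins-≥ : ∀ {n} (i : Fin n) (f : Fin n → ℕ) → f i ≤ ∑ (fins n) f
∑-fins-≥ {suc n} zero f = ≤-trans (m≤m+n _ _) (≤-reflexive (sym (∑-fins-suc n f)))
∑-fins-≥ {suc n} (suc i) f =
  ≤-trans (∑-fins-≥ i (f ∘ suc)) (≤-trans (m≤n+m _ (f zero)) (≤-reflexive (sym (∑-fins-suc n f))))

∑-fins-unique : ∀ {n} {P : Fin n → Set} (P? : ∀ i → Dec (P i)) (i : Fin n) → P i → (∀ j → P j → j ≡ i) →
  # (fins n) P? ≡ 1
∑-fins-unique {n} P? i p u = ≤-antisym (upper n P? (λ a b x y → trans (u a x) (sym (u b y))))
  (≤-trans (≤-reflexive (sym (𝟙-yes (P? i) p))) (∑-fins-≥ i (λ j → 𝟙 (P? j))))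
  where
  upper : ∀ n {P : Fin n → Set} (P? : ∀ i → Dec (P i)) → (∀ a b → P a → P b → a ≡ b) → # (fins n) P? ≤ 1
  upper zero P? u = z≤n
  upper (suc n) P? u rewrite ∑-fins-suc n (λ i → 𝟙 (P? i)) with P? zero
  ... | no _ = upper n (P? ∘ suc) (λ a b x y → Finₚ.suc-injective (u (suc a) (suc b) x y))
  ... | yes p₀ = s≤s (≤-trans (∑-mono (fins n) (λ i → ≤-reflexive (𝟙-no (P? (suc i)) (λ x → Finₚ.0≢1+n (u zero (suc i) p₀ x)))))
                   (≤-reflexive (∑-zero (fins n))))

#-fins≤1 : ∀ {n} {P : Fin n → Set} (P? : ∀ i → Dec (P i)) → (∀ a b → P a → P b → a ≡ b) → # (fins n) P? ≤ 1
#-fins≤1 {n} P? u with Finₚ.any? P?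
... | yes (i , p) = ≤-reflexive (∑-fins-unique P? i p (λ j q → u j i q p))
... | no ¬p = ≤-trans (∑-mono (fins n) (λ i → ≤-reflexive (𝟙-no (P? i) (λ x → ¬p (i , x))))) (≤-trans (≤-reflexive (∑-zero (fins n))) z≤n)

#-⋃ : {P : A → Set} (xs : List A) (P? : ∀ x → Dec (P x)) {k : ℕ} {Q : Fin k → A → Set} (Q? : ∀ i x → Dec (Q i x)) →
  (∀ x → P x → ∃ λ i → Q i x) → # xs P? ≤ ∑ (fins k) (λ i → # xs (Q? i))
#-⋃ xs P? {k} Q? h = ≤-trans (∑-mono xs point) (≤-reflexive (∑-swap xs (fins k) _))
  where
  point : ∀ x → 𝟙 (P? x) ≤ ∑ (fins k) (λ i → 𝟙 (Q? i x))
  point x with P? x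
  ... | no _ = z≤n
  ... | yes p with h x p
  ...   | i , q = ≤-trans (≤-reflexive (sym (𝟙-yes (Q? i x) q))) (∑-fins-≥ i _)

-- Sums over all maps between finite sets

infix 4 _≗_
_≗_ : {A : Set} → (A → B) → (A → B) → Set
f ≗ g = ∀ x → f x ≡ g x

funs : ∀ m n → List (Fin m → Fin n)
funs zero n = (λ ()) ∷ []
funs (suc m) n = concatMap (λ j → map (cons j) (funs m n)) (fins n)

∑-funs-suc : ∀ m n (φ : (Fin (suc m) → Fin n) → ℕ) →
  ∑ (funs (suc m) n) φ ≡ ∑ (fins n) (λ j → ∑ (funs m n) (λ g → φ (cons j g)))
∑-funs-suc m n φ = trans (∑-concatMap _ (fins n) φ) (∑-cong (fins n) (λ j → ∑-map (cons j) (funs m n) φ))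

∏ : ∀ k → (Fin k → ℕ) → ℕ
∏ zero f = 1
∏ (suc k) f = f zero * ∏ k (f ∘ suc)

∏-cong : ∀ k {f g : Fin k → ℕ} → (∀ i → f i ≡ g i) → ∏ k f ≡ ∏ k g
∏-cong zero h = refl
∏-cong (suc k) h = cong₂ _*_ (h zero) (∏-cong k (h ∘ suc))

∏-mono : ∀ k {f g : Fin k → ℕ} → (∀ i → f i ≤ g i) → ∏ k f ≤ ∏ k g
∏-mono zero h = ≤-refl
∏-mono (suc k) h = *-mono-≤ (h zero) (∏-mono k (h ∘ suc))

∏-const : ∀ k c → ∏ k (λ _ → c) ≡ c ^ k
∏-const zero c = refl
∏-const (suc k) c = cong (c *_) (∏-const k c)

∏-* : ∀ k (f g : Fin k → ℕ) → ∏ k (λ i → f i * g i) ≡ ∏ k f * ∏ k g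
∏-* zero f g = refl
∏-* (suc k) f g rewrite ∏-* k (f ∘ suc) (g ∘ suc) = lem (f zero) (g zero) (∏ k (f ∘ suc)) (∏ k (g ∘ suc))
  where
  lem : ∀ a b c d → (a * b) * (c * d) ≡ (a * c) * (b * d)
  lem = solve-∀

∏-^ : ∀ k c (h : Fin k → ℕ) → ∏ k (λ i → c ^ h i) ≡ c ^ ∑ (fins k) h
∏-^ zero c h = refl
∏-^ (suc k) c h rewrite ∑-fins-suc k h | ∏-^ k c (h ∘ suc) = sym (^-distribˡ-+-* c (h zero) _)

-- Distributivity: a weight that factors over the coordinates is summed coordinate by coordinate.
-- Counts of maps with independent conditions on their values go through this.
∑-∏ : ∀ m n (w : Fin m → Fin n → ℕ) →
  ∑ (funs m n) (λ f → ∏ m (λ v → w v (f v))) ≡ ∏ m (λ v → ∑ (fins n) (w v))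
∑-∏ zero n w = refl
∑-∏ (suc m) n w = begin
  ∑ (funs (suc m) n) (λ f → w zero (f zero) * ∏ m (λ v → w (suc v) (f (suc v))))
    ≡⟨ ∑-funs-suc m n _ ⟩
  ∑ (fins n) (λ j → ∑ (funs m n) (λ g → w zero j * ∏ m (λ v → w (suc v) (g v))))
    ≡⟨ ∑-cong (fins n) (λ j → trans (∑-*ˡ (funs m n) (w zero j) _) (cong (w zero j *_) (∑-∏ m n (w ∘ suc)))) ⟩
  ∑ (fins n) (λ j → w zero j * ∏ m (λ v → ∑ (fins n) (w (suc v))))
    ≡⟨ ∑-*ʳ (fins n) _ (w zero) ⟩
  ∑ (fins n) (w zero) * ∏ m (λ v → ∑ (fins n) (w (suc v))) ∎
  where open ≡-Reasoning

𝟙-∀ : ∀ {k} {P : Fin k → Set} {R : Set} (P? : ∀ i → Dec (P i)) (r : Dec R) → ((∀ i → P i) → R) → (R → ∀ i → P i) →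
  𝟙 r ≡ ∏ k (λ i → 𝟙 (P? i))
𝟙-∀ {zero} P? r f g = 𝟙-yes r (f (λ ()))
𝟙-∀ {suc k} P? r f g = trans (𝟙-× r (P? zero) (Finₚ.all? (P? ∘ suc))
    (λ p q → f (λ { zero → p ; (suc i) → q i })) (λ x → g x zero , λ i → g x (suc i)))
  (cong (𝟙 (P? zero) *_) (𝟙-∀ (P? ∘ suc) (Finₚ.all? (P? ∘ suc)) id id))

length-funs : ∀ m n → length (funs m n) ≡ n ^ m
length-funs m n = begin
  length (funs m n) ≡⟨ sym (*-identityʳ _) ⟩
  length (funs m n) * 1 ≡⟨ sym (∑-const (funs m n) 1) ⟩
  ∑ (funs m n) (λ _ → 1) ≡⟨ ∑-cong (funs m n) (λ _ → sym (trans (∏-const m 1) (^-zeroˡ m))) ⟩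
  ∑ (funs m n) (λ f → ∏ m (λ _ → 1)) ≡⟨ ∑-∏ m n (λ _ _ → 1) ⟩
  ∏ m (λ v → ∑ (fins n) (λ _ → 1)) ≡⟨ ∏-cong m (λ _ → trans (∑-fins-const n 1) (*-identityʳ n)) ⟩
  ∏ m (λ _ → n) ≡⟨ ∏-const m n ⟩
  n ^ m ∎
  where open ≡-Reasoning

∑-funs-const : ∀ m n c → ∑ (funs m n) (λ _ → c) ≡ n ^ m * c
∑-funs-const m n c = trans (∑-const (funs m n) c) (cong (_* c) (length-funs m n))

_≗?_ : (f g : Fin m → Fin n) → Dec (f ≗ g)
f ≗? g = Finₚ.all? (λ i → f i Fin.≟ g i)

-- Functions are compared only pointwise, extensionality not being postulated. A quantity must
-- respect `_≗_` before its sum over `funs` can be related to its value at a given function.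
Ext : ((Fin m → Fin n) → A) → Set
Ext φ = ∀ {f g} → f ≗ g → φ f ≡ φ g

Resp : ((Fin m → Fin n) → Set) → Set
Resp P = ∀ {f g} → f ≗ g → P f → P g

𝟙-ext : {P : (Fin m → Fin n) → Set} (P? : ∀ f → Dec (P f)) → Resp P → Ext (λ f → 𝟙 (P? f))
𝟙-ext P? resp {f} {g} e = 𝟙-cong (P? f) (P? g) (resp e) (resp (λ x → sym (e x)))

∑-δ : ∀ m n (φ : (Fin m → Fin n) → ℕ) → Ext φ → ∀ f → ∑ (funs m n) (λ g → 𝟙 (g ≗? f) * φ g) ≡ φ f
∑-δ m n φ ext f = begin
  ∑ (funs m n) (λ g → 𝟙 (g ≗? f) * φ g) ≡⟨ ∑-cong (funs m n) point ⟩
  ∑ (funs m n) (λ g → 𝟙 (g ≗? f) * φ f) ≡⟨ ∑-*ʳ (funs m n) (φ f) _ ⟩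
  ∑ (funs m n) (λ g → 𝟙 (g ≗? f)) * φ f ≡⟨ cong (_* φ f) (∑-cong (funs m n) (λ g → 𝟙-∀ (λ i → g i Fin.≟ f i) (g ≗? f) id id)) ⟩
  ∑ (funs m n) (λ g → ∏ m (λ i → 𝟙 (g i Fin.≟ f i))) * φ f ≡⟨ cong (_* φ f) (∑-∏ m n (λ i y → 𝟙 (y Fin.≟ f i))) ⟩
  ∏ m (λ i → # (fins n) (λ y → y Fin.≟ f i)) * φ f
    ≡⟨ cong (_* φ f) (trans (∏-cong m (λ i → ∑-fins-unique (λ y → y Fin.≟ f i) (f i) refl (λ _ → id))) (trans (∏-const m 1) (^-zeroˡ m))) ⟩
  1 * φ f ≡⟨ *-identityˡ (φ f) ⟩
  φ f ∎
  where
  open ≡-Reasoning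
  point : ∀ g → 𝟙 (g ≗? f) * φ g ≡ 𝟙 (g ≗? f) * φ f
  point g = 𝟙-*-cong (g ≗? f) ext

∑-funs-≥ : ∀ {m n} (φ : (Fin m → Fin n) → ℕ) → Ext φ → ∀ f → φ f ≤ ∑ (funs m n) φ
∑-funs-≥ {m} {n} φ ext f = ≤-trans (≤-reflexive (sym (∑-δ m n φ ext f))) (∑-mono (funs m n) point)
  where
  point : ∀ g → 𝟙 (g ≗? f) * φ g ≤ φ g
  point g = ≤-trans (*-monoˡ-≤ (φ g) (𝟙≤1 (g ≗? f))) (≤-reflexive (*-identityˡ (φ g)))

∑-witness : (xs : List A) {P : A → Set} (P? : ∀ x → Dec (P x)) → 1 ≤ # xs P? → ∃ P
∑-witness (x ∷ xs) P? h with P? x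
... | yes p = x , p
... | no _ = ∑-witness xs P? h

-- The search is by counting. A function satisfying `P` occurs in `funs m n` only up to `_≗_`, hence
-- the condition `Resp P`.
anyFun? : {P : (Fin m → Fin n) → Set} → (∀ f → Dec (P f)) → Resp P → Dec (∃ P)
anyFun? {m} {n} P? resp with 1 ≤? # (funs m n) P?
... | yes h = yes (∑-witness (funs m n) P? h)
... | no h = no (λ { (f , p) → h (≤-trans (≤-reflexive (sym (𝟙-yes (P? f) p))) (∑-funs-≥ _ (𝟙-ext P? resp) f)) })

-- The law of S ∘ f for a uniformly random S and an injective f is uniform.
marginal : ∀ {a b} n (f : Fin a → Fin b) → Injective _≡_ _≡_ f → (φ : (Fin a → Fin n) → ℕ) → Ext φ →
  ∑ (funs b n) (λ S → φ (S ∘ f)) * n ^ a ≡ n ^ b * ∑ (funs a n) φ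
marginal {a} {b} n f f-inj φ ext = begin
  ∑ (funs b n) (λ S → φ (S ∘ f)) * n ^ a
    ≡⟨ cong (_* n ^ a) (∑-cong (funs b n) (λ S → sym (∑-δ a n φ ext (S ∘ f)))) ⟩
  ∑ (funs b n) (λ S → ∑ (funs a n) (λ x → 𝟙 (x ≗? (S ∘ f)) * φ x)) * n ^ a
    ≡⟨ cong (_* n ^ a) (∑-swap (funs b n) (funs a n) _) ⟩
  ∑ (funs a n) (λ x → ∑ (funs b n) (λ S → 𝟙 (x ≗? (S ∘ f)) * φ x)) * n ^ a
    ≡⟨ sym (∑-*ʳ (funs a n) (n ^ a) _) ⟩
  ∑ (funs a n) (λ x → ∑ (funs b n) (λ S → 𝟙 (x ≗? (S ∘ f)) * φ x) * n ^ a)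
    ≡⟨ ∑-cong (funs a n) (λ x → trans (cong (_* n ^ a) (∑-*ʳ (funs b n) (φ x) (λ S → 𝟙 (x ≗? (S ∘ f))))) (trans (swap* (# (funs b n) (λ S → x ≗? (S ∘ f))) (φ x) (n ^ a)) (cong (_* φ x) (fibre x)))) ⟩
  ∑ (funs a n) (λ x → n ^ b * φ x)
    ≡⟨ ∑-*ˡ (funs a n) (n ^ b) φ ⟩
  n ^ b * ∑ (funs a n) φ ∎
  where
  open ≡-Reasoning
  swap* : ∀ x y z → (x * y) * z ≡ (x * z) * y
  swap* = solve-∀
  fits? : ∀ (x : Fin a → Fin n) v y → Dec (∀ i → f i ≡ v → x i ≡ y)
  fits? x v y = Finₚ.all? (λ i → (f i Fin.≟ v) →-dec (x i Fin.≟ y))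
  hits : Fin b → ℕ
  hits v = # (fins a) (λ i → f i Fin.≟ v)
  -- A value prescribed by `x` leaves one choice, a free one leaves `n`; the power `n ^ hits v`
  -- evens this out, and its exponents add up to `a`.
  coord : ∀ x v → # (fins n) (fits? x v) * n ^ hits v ≡ n
  coord x v with Finₚ.any? (λ i → f i Fin.≟ v)
  ... | yes (i , refl) = begin
        # (fins n) (fits? x v) * n ^ hits v ≡⟨ cong₂ (λ s t → s * n ^ t)
           (∑-fins-unique (fits? x v) (x i) (λ j e → cong x (f-inj e)) (λ y h → sym (h i refl)))
           (∑-fins-unique (λ j → f j Fin.≟ v) i refl (λ j e → f-inj e)) ⟩
        1 * (n * 1) ≡⟨ trans (*-identityˡ _) (*-identityʳ n) ⟩
        n ∎
  ... | no ¬h = begin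
        # (fins n) (fits? x v) * n ^ hits v ≡⟨ cong₂ (λ s t → s * n ^ t)
           (trans (∑-cong (fins n) (λ y → 𝟙-yes (fits? x v y) (λ i e → ⊥-elim (¬h (i , e))))) (∑-fins-const n 1))
           (trans (∑-cong (fins a) (λ i → 𝟙-no (f i Fin.≟ v) (λ e → ¬h (i , e)))) (∑-zero (fins a))) ⟩
        (n * 1) * 1 ≡⟨ trans (*-identityʳ _) (*-identityʳ n) ⟩
        n ∎
  total : ∑ (fins b) hits ≡ a
  total = begin
    ∑ (fins b) hits ≡⟨ ∑-swap (fins b) (fins a) _ ⟩
    ∑ (fins a) (λ i → # (fins b) (λ v → f i Fin.≟ v)) ≡⟨ ∑-cong (fins a) (λ i → ∑-fins-unique (λ v → f i Fin.≟ v) (f i) refl (λ _ → sym)) ⟩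
    ∑ (fins a) (λ _ → 1) ≡⟨ trans (∑-fins-const a 1) (*-identityʳ a) ⟩
    a ∎
  fibre : ∀ x → # (funs b n) (λ S → x ≗? (S ∘ f)) * n ^ a ≡ n ^ b
  fibre x = begin
    # (funs b n) (λ S → x ≗? (S ∘ f)) * n ^ a
      ≡⟨ cong₂ _*_ (∑-cong (funs b n) (λ S → 𝟙-∀ (λ v → fits? x v (S v)) (x ≗? (S ∘ f)) (λ h i → h (f i) i refl) (λ { e v i refl → e i })))
           (trans (cong (n ^_) (sym total)) (sym (∏-^ b n hits))) ⟩
    ∑ (funs b n) (λ S → ∏ b (λ v → 𝟙 (fits? x v (S v)))) * ∏ b (λ v → n ^ hits v)
      ≡⟨ cong (_* ∏ b (λ v → n ^ hits v)) (∑-∏ b n (λ v y → 𝟙 (fits? x v y))) ⟩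
    ∏ b (λ v → # (fins n) (fits? x v)) * ∏ b (λ v → n ^ hits v)
      ≡⟨ sym (∏-* b _ _) ⟩
    ∏ b (λ v → # (fins n) (fits? x v) * n ^ hits v)
      ≡⟨ trans (∏-cong b (coord x)) (∏-const b n) ⟩
    n ^ b ∎

#-marginal : ∀ {a b} n (f : Fin a → Fin b) → Injective _≡_ _≡_ f → {P : (Fin a → Fin n) → Set} (P? : ∀ x → Dec (P x)) → Resp P →
  # (funs b n) (λ S → P? (S ∘ f)) * n ^ a ≡ n ^ b * # (funs a n) P?
#-marginal n f f-inj P? resp = marginal n f f-inj (λ x → 𝟙 (P? x)) (𝟙-ext P? resp)

-- Graphs, homomorphism counts and colourings

record Graph (n : ℕ) : Set₁ where
  field
    Adj : Fin n → Fin n → Set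
    adj? : ∀ u v → Dec (Adj u v)
    symm : ∀ {u v} → Adj u v → Adj v u
    irr : ∀ {u v} → Adj u v → u ≢ v
open Graph

-- One construction in three roles: the graph on a sample drawn with repetition, a blow-up of `G`,
-- and, for `G` complete, a complete multipartite graph with parts the fibres of `f`.
pull : Graph n → (Fin m → Fin n) → Graph m
pull G f .Adj u v = Adj G (f u) (f v)
pull G f .adj? u v = adj? G (f u) (f v)
pull G f .symm = symm G
pull G f .irr a e = irr G a (cong f e)

K : ∀ k → Graph k
K k .Adj u v = u ≢ v
K k .adj? u v = ¬? (u Fin.≟ v)
K k .symm ne e = ne (sym e)
K k .irr ne = ne

Hom : Graph m → Graph n → (Fin m → Fin n) → Set
Hom R G f = ∀ u v → Adj R u v → Adj G (f u) (f v)

Hom? : (R : Graph m) (G : Graph n) (f : Fin m → Fin n) → Dec (Hom R G f)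
Hom? R G f = Finₚ.all? (λ u → Finₚ.all? (λ v → adj? R u v →-dec adj? G (f u) (f v)))

Hom-resp : (R : Graph m) (G : Graph n) → Resp (Hom R G)
Hom-resp R G e h u v a rewrite sym (e u) | sym (e v) = h u v a

Inj : (Fin m → Fin n) → Set
Inj f = ∀ i j → f i ≡ f j → i ≡ j

inj? : (f : Fin m → Fin n) → Dec (Inj f)
inj? f = Finₚ.all? (λ i → Finₚ.all? (λ j → (f i Fin.≟ f j) →-dec (i Fin.≟ j)))

Inj-resp : Resp (Inj {m} {n})
Inj-resp e h i j p = h i j (trans (e i) (trans p (sym (e j))))

Inj⇒ : {f : Fin m → Fin n} → Inj f → Injective _≡_ _≡_ f
Inj⇒ h = h _ _

InjHom : Graph m → Graph n → (Fin m → Fin n) → Set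
InjHom R G f = Inj f × Hom R G f

InjHom? : (R : Graph m) (G : Graph n) (f : Fin m → Fin n) → Dec (InjHom R G f)
InjHom? R G f = inj? f ×-dec Hom? R G f

InjHom-resp : (R : Graph m) (G : Graph n) → Resp (InjHom R G)
InjHom-resp R G e (i , h) = Inj-resp e i , Hom-resp R G e h

hom : Graph m → Graph n → ℕ
hom {m} {n} R G = # (funs m n) (Hom? R G)

injHom : Graph m → Graph n → ℕ
injHom {m} {n} R G = # (funs m n) (InjHom? R G)

falling : ℕ → ℕ → ℕ
falling m n = # (funs m n) inj?

Colouring : Graph n → (ℓ : ℕ) → (Fin n → Fin ℓ) → Set
Colouring G ℓ φ = Hom G (K ℓ) φ

pairs : (P : Fin n → Fin n → Set) → (∀ u v → Dec (P u v)) → ℕ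
pairs {n} P P? = ∑ (fins n) (λ u → # (fins n) (P? u))

mono? : (G : Graph n) {ℓ : ℕ} (φ : Fin n → Fin ℓ) → ∀ u v → Dec (Adj G u v × φ u ≡ φ v)
mono? G φ u v = adj? G u v ×-dec (φ u Fin.≟ φ v)

mono : Graph n → ∀ {ℓ} → (Fin n → Fin ℓ) → ℕ
mono G φ = pairs _ (mono? G φ)

NearColourable : ℕ → ℕ → Graph n → Set
NearColourable {n} E ℓ G = ∃ λ (φ : Fin n → Fin ℓ) → E * mono G φ ≤ n * n

mono-ext : (G : Graph n) {ℓ : ℕ} → Ext (mono G {ℓ})
mono-ext {n} G {ℓ} {f} {g} e = ∑-cong (fins n) (λ u → ∑-cong (fins n) (λ v →
  𝟙-cong (mono? G f u v) (mono? G g u v)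
    (λ { (a , b) → a , trans (sym (e u)) (trans b (e v)) }) (λ { (a , b) → a , trans (e u) (trans b (sym (e v))) })))

nearColourable? : ∀ E ℓ (G : Graph n) → Dec (NearColourable E ℓ G)
nearColourable? {n} E ℓ G = anyFun? (λ φ → E * mono G φ ≤? n * n)
  (λ e h → ≤-trans (≤-reflexive (cong (E *_) (sym (mono-ext G e)))) h)

-- Union bounds over pairs of coordinates

pairFun : Fin m → Fin m → Fin 2 → Fin m
pairFun u v zero = u
pairFun u v (suc _) = v

pairFun-inj : {u v : Fin m} → u ≢ v → Injective _≡_ _≡_ (pairFun u v)
pairFun-inj ne {zero} {zero} e = refl
pairFun-inj ne {zero} {suc zero} e = ⊥-elim (ne e)
pairFun-inj ne {suc zero} {zero} e = ⊥-elim (ne (sym e))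
pairFun-inj ne {suc zero} {suc zero} e = refl

pairCount : ∀ {n} {u v : Fin m} → u ≢ v → (P : Fin n → Fin n → Set) (P? : ∀ x y → Dec (P x y)) →
  # (funs m n) (λ f → P? (f u) (f v)) * (n * n) ≡ n ^ m * pairs P P?
pairCount {m} {n} {u} {v} ne P P? = begin
  # (funs m n) (λ f → P? (f u) (f v)) * (n * n)
    ≡⟨ cong (λ z → # (funs m n) (λ f → P? (f u) (f v)) * (n * z)) (sym (*-identityʳ n)) ⟩
  # (funs m n) (λ f → P? (f u) (f v)) * n ^ 2
    ≡⟨ #-marginal n (pairFun u v) (pairFun-inj ne) (λ x → P? (x zero) (x (suc zero)))
         (λ {f} {g} e p → subst (P (g zero)) (e (suc zero)) (subst (λ z → P z (f (suc zero))) (e zero) p)) ⟩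
  n ^ m * # (funs 2 n) (λ x → P? (x zero) (x (suc zero)))
    ≡⟨ cong (n ^ m *_) (trans (∑-funs-suc 1 n _) (∑-cong (fins n) (λ x → trans (∑-funs-suc 0 n _)
         (∑-cong (fins n) (λ y → +-identityʳ _))))) ⟩
  n ^ m * pairs P P? ∎
  where open ≡-Reasoning

pairUnion : ∀ {q c} E (xs : List A) {X : A → Set} (X? : ∀ x → Dec (X x)) {Y : Fin q → Fin q → A → Set}
  (Y? : ∀ u v x → Dec (Y u v x)) → (∀ x → X x → ∃ λ u → ∃ λ v → Y u v x) →
  (∀ u v → E * # xs (Y? u v) ≤ c) → E * # xs X? ≤ q * (q * c)
pairUnion {q = q} {c} E xs X? Y? cover small = begin
  E * # xs X? ≤⟨ *-monoʳ-≤ E (#-⋃ xs X? (λ u x → Finₚ.any? (λ v → Y? u v x)) cover) ⟩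
  E * ∑ (fins q) (λ u → # xs (λ x → Finₚ.any? (λ v → Y? u v x)))
    ≤⟨ *-monoʳ-≤ E (∑-mono (fins q) (λ u → #-⋃ xs (λ x → Finₚ.any? (λ v → Y? u v x)) (Y? u) (λ _ → id))) ⟩
  E * ∑ (fins q) (λ u → ∑ (fins q) (λ v → # xs (Y? u v)))
    ≡⟨ trans (sym (∑-*ˡ (fins q) E _)) (∑-cong (fins q) (λ u → sym (∑-*ˡ (fins q) E _))) ⟩
  ∑ (fins q) (λ u → ∑ (fins q) (λ v → E * # xs (Y? u v)))
    ≤⟨ ∑-mono (fins q) (λ u → ∑-mono (fins q) (small u)) ⟩
  ∑ (fins q) (λ u → ∑ (fins q) (λ v → c))
    ≡⟨ trans (∑-cong (fins q) (λ _ → ∑-fins-const q c)) (∑-fins-const q (q * c)) ⟩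
  q * (q * c) ∎
  where open ≤-Reasoning

-- For distinct coordinates the pair `(f u , f v)` is uniformly distributed, so it satisfies `P`
-- with probability at most `c / E`; the union bound over pairs of coordinates costs `q * q`.
-- Non-injective maps and maps using a monochromatic edge are both counted this way.
pairLoss : ∀ {q n} .{{_ : NonZero n}} E c {P : Fin n → Fin n → Set} (P? : ∀ x y → Dec (P x y)) → E * pairs P P? ≤ c * (n * n) →
  {X : (Fin q → Fin n) → Set} (X? : ∀ f → Dec (X f)) → (∀ f → X f → ∃ λ u → ∃ λ v → u ≢ v × P (f u) (f v)) →
  E * # (funs q n) X? ≤ q * (q * (c * n ^ q))
pairLoss {q} {n} E c {P} P? few X? cover =
  pairUnion E (funs q n) X? {Y = λ u v f → u ≢ v × P (f u) (f v)} (λ u v f → ¬? (u Fin.≟ v) ×-dec P? (f u) (f v)) cover small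
  where
  instance n² = m*n≢0 n n
  open ≤-Reasoning
  re1 : ∀ E s t → E * s * t ≡ E * (s * t)
  re1 = solve-∀
  re2 : ∀ E s t → E * (s * t) ≡ s * (E * t)
  re2 = solve-∀
  re3 : ∀ s t u → s * (t * u) ≡ t * s * u
  re3 = solve-∀
  small : ∀ u v → E * # (funs q n) (λ f → ¬? (u Fin.≟ v) ×-dec P? (f u) (f v)) ≤ c * n ^ q
  small u v with u Fin.≟ v
  ... | yes _ = ≤-trans (≤-reflexive (trans (cong (E *_) (∑-zero (funs q n))) (*-zeroʳ E))) z≤n
  ... | no ne = ≤-trans (*-monoʳ-≤ E (#-mono (funs q n) _ (λ f → P? (f u) (f v)) (λ _ → proj₂))) (*-cancelʳ-≤ _ _ (n * n) (begin
    E * # (funs q n) (λ f → P? (f u) (f v)) * (n * n) ≡⟨ re1 E (# (funs q n) (λ f → P? (f u) (f v))) (n * n) ⟩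
    E * (# (funs q n) (λ f → P? (f u) (f v)) * (n * n)) ≡⟨ cong (E *_) (pairCount ne P P?) ⟩
    E * (n ^ q * pairs P P?) ≡⟨ re2 E (n ^ q) (pairs P P?) ⟩
    n ^ q * (E * pairs P P?) ≤⟨ *-monoʳ-≤ (n ^ q) few ⟩
    n ^ q * (c * (n * n)) ≡⟨ re3 (n ^ q) c (n * n) ⟩
    c * n ^ q * (n * n) ∎))

notInj⇒ : (f : Fin m → Fin n) → ¬ Inj f → ∃ λ u → ∃ λ v → u ≢ v × f u ≡ f v
notInj⇒ f ¬i with Finₚ.¬∀⟶∃¬ _ _ (λ i → Finₚ.all? (λ j → (f i Fin.≟ f j) →-dec (i Fin.≟ j))) ¬i
... | u , ¬h with Finₚ.¬∀⟶∃¬ _ _ (λ j → (f u Fin.≟ f j) →-dec (u Fin.≟ j)) ¬h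
... | v , ¬e with f u Fin.≟ f v | u Fin.≟ v
... | _ | yes eq = ⊥-elim (¬e (λ _ → eq))
... | yes p | no ne = u , v , ne , p
... | no ¬p | no _ = ⊥-elim (¬e (λ p → ⊥-elim (¬p p)))

-- Here `P` is equality, which holds for `n` of the `n * n` pairs.
fewNotInj : ∀ {q n} .{{_ : NonZero n}} E → E ≤ n → E * # (funs q n) (λ f → ¬? (inj? f)) ≤ q * (q * n ^ q)
fewNotInj {q} {n} E E≤n = subst (λ z → E * # (funs q n) (λ f → ¬? (inj? f)) ≤ q * (q * z)) (+-identityʳ (n ^ q))
  (pairLoss {q} E 1 (Fin._≟_ {n}) small (λ f → ¬? (inj? f)) notInj⇒)
  where
  open ≤-Reasoning
  small : E * pairs _≡_ (Fin._≟_ {n}) ≤ 1 * (n * n)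
  small = begin
    E * pairs _≡_ (Fin._≟_ {n}) ≡⟨ cong (E *_) (trans (∑-cong (fins n) (λ u → ∑-fins-unique (u Fin.≟_) u refl (λ _ → sym))) (trans (∑-fins-const n 1) (*-identityʳ n))) ⟩
    E * n ≤⟨ *-monoˡ-≤ n E≤n ⟩
    n * n ≡⟨ sym (+-identityʳ _) ⟩
    1 * (n * n) ∎

injPart : ∀ {q n} .{{_ : NonZero n}} E → E ≤ n → {P : (Fin q → Fin n) → Set} (P? : ∀ f → Dec (P f)) →
  E * # (funs q n) P? ≤ E * # (funs q n) (λ f → inj? f ×-dec P? f) + q * (q * n ^ q)
injPart {q} {n} E E≤n P? = begin
  E * # (funs q n) P? ≤⟨ *-monoʳ-≤ E (#-⊎ (funs q n) P? (λ f → inj? f ×-dec P? f) (λ f → ¬? (inj? f)) split) ⟩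
  E * (# (funs q n) (λ f → inj? f ×-dec P? f) + # (funs q n) (λ f → ¬? (inj? f))) ≡⟨ *-distribˡ-+ E _ _ ⟩
  E * # (funs q n) (λ f → inj? f ×-dec P? f) + E * # (funs q n) (λ f → ¬? (inj? f)) ≤⟨ +-monoʳ-≤ _ (fewNotInj {q} E E≤n) ⟩
  E * # (funs q n) (λ f → inj? f ×-dec P? f) + q * (q * n ^ q) ∎
  where
  open ≤-Reasoning
  split : ∀ f → _ → _ ⊎ _
  split f p with inj? f
  ... | yes i = inj₁ (i , p)
  ... | no ¬i = inj₂ ¬i

fallingBound : ∀ {q n} .{{_ : NonZero n}} E → E ≤ n → E * n ^ q ≤ E * falling q n + q * (q * n ^ q)
fallingBound {q} {n} E E≤n = begin
  E * n ^ q ≡⟨ cong (E *_) (sym (trans (∑-funs-const q n 1) (*-identityʳ _))) ⟩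
  E * ∑ (funs q n) (λ _ → 1) ≤⟨ injPart {q} E E≤n {P = λ _ → ⊤} (λ _ → yes tt) ⟩
  E * # (funs q n) (λ f → inj? f ×-dec yes tt) + q * (q * n ^ q)
    ≤⟨ +-monoˡ-≤ _ (*-monoʳ-≤ E (#-mono (funs q n) _ inj? (λ _ → proj₁))) ⟩
  E * falling q n + q * (q * n ^ q) ∎
  where open ≤-Reasoning

falling≤ : ∀ q n → falling q n ≤ n ^ q
falling≤ q n = ≤-trans (#≤length (funs q n) inj?) (≤-reflexive (length-funs q n))

hom≤ : (R : Graph m) (G : Graph n) → hom R G ≤ n ^ m
hom≤ {m} {n} R G = ≤-trans (#≤length (funs m n) (Hom? R G)) (≤-reflexive (length-funs m n))

injHom≤ : (R : Graph m) (G : Graph n) → injHom R G ≤ n ^ m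
injHom≤ {m} {n} R G = ≤-trans (#≤length (funs m n) (InjHom? R G)) (≤-reflexive (length-funs m n))

-- Testing ℓ-colourability on tuples of bounded length

∑-split : ∀ a b n (φ : (Fin a → Fin n) → ℕ) (ψ : (Fin b → Fin n) → ℕ) → Ext φ →
  ∑ (funs (a + b) n) (λ T → φ (λ i → T (i Fin.↑ˡ b)) * ψ (λ i → T (a Fin.↑ʳ i))) ≡ ∑ (funs a n) φ * ∑ (funs b n) ψ
∑-split zero b n φ ψ ext = begin
  ∑ (funs b n) (λ T → φ (λ i → T (i Fin.↑ˡ b)) * ψ T) ≡⟨ ∑-cong (funs b n) (λ T → cong (_* ψ T) (ext (λ ()))) ⟩
  ∑ (funs b n) (λ T → φ o * ψ T) ≡⟨ ∑-*ˡ (funs b n) (φ o) ψ ⟩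
  φ o * ∑ (funs b n) ψ ≡⟨ cong (_* ∑ (funs b n) ψ) (trans (ext (λ ())) (sym (+-identityʳ _))) ⟩
  ∑ (funs zero n) φ * ∑ (funs b n) ψ ∎
  where
  open ≡-Reasoning
  o : Fin 0 → Fin n
  o ()
∑-split (suc a) b n φ ψ ext = begin
  ∑ (funs (suc a + b) n) (λ T → φ (λ i → T (i Fin.↑ˡ b)) * ψ (λ i → T (suc a Fin.↑ʳ i)))
    ≡⟨ ∑-funs-suc (a + b) n _ ⟩
  ∑ (fins n) (λ j → ∑ (funs (a + b) n) (λ g → φ (λ i → cons j g (i Fin.↑ˡ b)) * ψ (λ i → g (a Fin.↑ʳ i))))
    ≡⟨ ∑-cong (fins n) (λ j → trans
         (∑-cong (funs (a + b) n) (λ g → cong (_* ψ (λ i → g (a Fin.↑ʳ i))) (ext (λ { zero → refl ; (suc i) → refl }))))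
         (∑-split a b n (λ g → φ (cons j g)) ψ (λ e → ext (λ { zero → refl ; (suc i) → e i })))) ⟩
  ∑ (fins n) (λ j → ∑ (funs a n) (λ g → φ (cons j g)) * ∑ (funs b n) ψ)
    ≡⟨ trans (∑-*ʳ (fins n) _ _) (cong (_* ∑ (funs b n) ψ) (sym (∑-funs-suc a n φ))) ⟩
  ∑ (funs (suc a) n) φ * ∑ (funs b n) ψ ∎
  where open ≡-Reasoning

-- `Fin.combine` cuts a tuple of length `ℓ * k` into `ℓ` independent blocks, so that the
-- probabilities of events on different blocks multiply.
∑-blocks : ∀ ℓ k n (ψ : Fin ℓ → (Fin k → Fin n) → ℕ) → (∀ c → Ext (ψ c)) →
  ∑ (funs (ℓ * k) n) (λ T → ∏ ℓ (λ c → ψ c (λ i → T (Fin.combine c i)))) ≡ ∏ ℓ (λ c → ∑ (funs k n) (ψ c))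
∑-blocks zero k n ψ ext = refl
∑-blocks (suc ℓ) k n ψ ext = trans
  (∑-split k (ℓ * k) n (ψ zero) (λ T → ∏ ℓ (λ c → ψ (suc c) (λ i → T (Fin.combine c i)))) (ext zero))
  (cong (∑ (funs k n) (ψ zero) *_) (∑-blocks ℓ k n (ψ ∘ suc) (ext ∘ suc)))

-- `L` gives every vertex of `G` a list of permitted colours. List colouring rather than plain
-- colouring is what survives the induction: colouring one vertex only shortens the lists of its
-- neighbours.
Obstructed : Graph n → (ℓ : ℕ) → (Fin n → Fin ℓ → Set) → (Fin k → Fin n) → Set
Obstructed {k = k} G ℓ L T = ¬ ∃ λ (φ : Fin k → Fin ℓ) → (∀ i → L (T i) (φ i)) × Colouring (pull G T) ℓ φ

obstructed? : (G : Graph n) (ℓ : ℕ) {L : Fin n → Fin ℓ → Set} (L? : ∀ u c → Dec (L u c)) (T : Fin k → Fin n) →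
  Dec (Obstructed G ℓ L T)
obstructed? G ℓ {L} L? T = ¬? (anyFun? (λ φ → Finₚ.all? (λ i → L? (T i) (φ i)) ×-dec Hom? (pull G T) (K ℓ) φ)
  (λ { e (h , c) → (λ i → subst (L (T i)) (e i) (h i)) , Hom-resp (pull G T) (K ℓ) e c }))

obstructed-resp : (G : Graph n) (ℓ : ℕ) (L : Fin n → Fin ℓ → Set) → Resp (Obstructed {k = k} G ℓ L)
obstructed-resp G ℓ L {f} {g} e o (φ , h , c) = o (φ , (λ i → subst (λ z → L z (φ i)) (sym (e i)) (h i)) ,
  λ u v a → c u v (subst (λ z → Adj G z (g v)) (e u) (subst (Adj G (f u)) (e v) a)))

#obstructed : ∀ k (G : Graph n) (ℓ : ℕ) {L : Fin n → Fin ℓ → Set} → (∀ u c → Dec (L u c)) → ℕ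
#obstructed {n} k G ℓ L? = # (funs k n) (obstructed? G ℓ L?)

potential : ∀ {ℓ} {L : Fin n → Fin ℓ → Set} → (∀ u c → Dec (L u c)) → ℕ
potential {n} {ℓ} L? = ∑ (fins n) (λ u → # (fins ℓ) (L? u))

𝟙-disjoint : {P Q R : Set} (p : Dec P) (q : Dec Q) (r : Dec R) → (P → R) → (Q → R) → (P → Q → ⊥) → 𝟙 p + 𝟙 q ≤ 𝟙 r
𝟙-disjoint (no _) q r f g h = 𝟙-mono q r g
𝟙-disjoint (yes p) q r f g h rewrite 𝟙-no q (h p) = ≤-reflexive (sym (𝟙-yes r (f p)))

#-guard : ∀ c {m} {P : Set} {Q : A → Set} (xs : List A) (p : Dec P) (Q? : ∀ x → Dec (Q x)) →
  (P → c * # xs Q? ≤ m) → c * # xs (λ x → p ×-dec Q? x) ≤ m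
#-guard c xs (no _) Q? h = ≤-trans (≤-reflexive (trans (cong (c *_) (∑-zero xs)) (*-zeroʳ c))) z≤n
#-guard c xs (yes p) Q? h = ≤-trans (*-monoʳ-≤ c (#-mono xs (λ x → yes p ×-dec Q? x) Q? (λ _ → proj₂))) (h p)

-- A test of depth `suc d` is one vertex followed by a test of depth `d` for each of its `ℓ`
-- colours, in disjoint blocks. Accordingly the reciprocal density in `testDensity` has a factor
-- `3 * E` for the vertex and one factor for each block.
testSize : ℕ → ℕ → ℕ
testSize ℓ zero = 0
testSize ℓ (suc d) = suc (ℓ * testSize ℓ d)

testDensity : ℕ → ℕ → ℕ → ℕ
testDensity E ℓ zero = 1
testDensity E ℓ (suc d) = 3 * E * testDensity E ℓ d ^ ℓ

testDensity≢0 : ∀ E ℓ d .{{_ : NonZero E}} → NonZero (testDensity E ℓ d)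
testDensity≢0 E ℓ zero = _
testDensity≢0 E ℓ (suc d) = m*n≢0 (3 * E) _ {{m*n≢0 3 E}} {{m^n≢0 _ ℓ {{testDensity≢0 E ℓ d}}}}

module _ {n ℓ : ℕ} (E : ℕ) .{{_ : NonZero E}} .{{_ : NonZero n}} (G : Graph n) (c₀ : Fin ℓ) (far : ¬ NearColourable E ℓ G) where

  -- The lists that remain once `x` has received the colour `c`.
  forbid : (L : Fin n → Fin ℓ → Set) → Fin n → Fin ℓ → Fin n → Fin ℓ → Set
  forbid L x c u c' = L u c' × ¬ (c' ≡ c × Adj G x u)

  forbid? : {L : Fin n → Fin ℓ → Set} → (∀ u c → Dec (L u c)) → ∀ x c u c' → Dec (forbid L x c u c')
  forbid? L? x c u c' = L? u c' ×-dec ¬? ((c' Fin.≟ c) ×-dec adj? G x u)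

  affected? : {L : Fin n → Fin ℓ → Set} → (∀ u c → Dec (L u c)) → ∀ x c u → Dec (Adj G x u × L u c)
  affected? L? x c u = adj? G x u ×-dec L? u c

  -- Whichever permitted colour `x` takes, at least `n / (3 * E)` lists shrink. A vertex with an
  -- empty list qualifies vacuously, being itself an obstruction.
  Restricting : {L : Fin n → Fin ℓ → Set} → (∀ u c → Dec (L u c)) → Fin n → Set
  Restricting {L} L? x = ∀ c → L x c → n ≤ 3 * E * # (fins n) (affected? L? x c)

  restricting? : {L : Fin n → Fin ℓ → Set} (L? : ∀ u c → Dec (L u c)) → ∀ x → Dec (Restricting L? x)
  restricting? L? x = Finₚ.all? (λ c → L? x c →-dec (n ≤? 3 * E * # (fins n) (affected? L? x c)))

  potential-forbid : {L : Fin n → Fin ℓ → Set} (L? : ∀ u c → Dec (L u c)) → ∀ x c →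
    potential (forbid? L? x c) + # (fins n) (affected? L? x c) ≤ potential L?
  potential-forbid L? x c = ≤-trans (≤-reflexive (sym (∑-+ (fins n) _ _))) (∑-mono (fins n) (λ u → begin
    # (fins ℓ) (forbid? L? x c u) + 𝟙 (affected? L? x c u)
      ≤⟨ +-monoʳ-≤ _ (≤-trans (𝟙-mono (affected? L? x c u) (removed? u c) (λ h → refl , h)) (∑-fins-≥ c (λ c' → 𝟙 (removed? u c')))) ⟩
    # (fins ℓ) (forbid? L? x c u) + # (fins ℓ) (removed? u)
      ≡⟨ sym (∑-+ (fins ℓ) _ _) ⟩
    ∑ (fins ℓ) (λ c' → 𝟙 (forbid? L? x c u c') + 𝟙 (removed? u c'))
      ≤⟨ ∑-mono (fins ℓ) (λ c' → 𝟙-disjoint (forbid? L? x c u c') (removed? u c') (L? u c') proj₁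
           (λ { (refl , _ , h) → h }) (λ { (_ , h) (e , a , _) → h (e , a) })) ⟩
    # (fins ℓ) (L? u) ∎))
    where
    open ≤-Reasoning
    removed? : ∀ u c' → Dec (c' ≡ c × Adj G x u × _)
    removed? u c' = (c' Fin.≟ c) ×-dec affected? L? x c u

  -- If restricting vertices are rare, giving every other vertex a non-restricting colour makes few edges monochromatic.
  manyRestricting : {L : Fin n → Fin ℓ → Set} (L? : ∀ u c → Dec (L u c)) → n ≤ 3 * E * # (fins n) (restricting? L?)
  manyRestricting {L} L? with n ≤? 3 * E * # (fins n) (restricting? L?)
  ... | yes h = h
  ... | no few = ⊥-elim (far (φ , *-cancelˡ-≤ 3 (begin
    3 * (E * mono G φ) ≡⟨ sym (*-assoc 3 E (mono G φ)) ⟩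
    3 * E * mono G φ ≤⟨ *-monoʳ-≤ (3 * E) (∑-mono (fins n) (λ u → ≤-trans (∑-mono (fins n) (point u)) (≤-reflexive (trans (∑-+ (fins n) _ _) (cong (_+ τ u) (trans (∑-+ (fins n) _ _) (cong (_+ ρ) (∑-fins-const n _)))))))) ⟩
    3 * E * ∑ (fins n) (λ u → n * 𝟙 (R? u) + ρ + τ u) ≡⟨ cong (3 * E *_) (trans (∑-+ (fins n) _ τ) (cong (_+ ∑ (fins n) τ) (trans (∑-+ (fins n) _ _) (cong₂ _+_ (∑-*ˡ (fins n) n _) (∑-fins-const n ρ))))) ⟩
    3 * E * (n * ρ + n * ρ + ∑ (fins n) τ) ≡⟨ dist (3 * E) n ρ (∑ (fins n) τ) ⟩
    n * (3 * E * ρ) + n * (3 * E * ρ) + 3 * E * ∑ (fins n) τ ≤⟨ +-mono-≤ (+-mono-≤ (*-monoʳ-≤ n ρ≤) (*-monoʳ-≤ n ρ≤))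
         (≤-trans (≤-reflexive (sym (∑-*ˡ (fins n) (3 * E) τ))) (≤-trans (∑-mono (fins n) τ≤) (≤-reflexive (∑-fins-const n n)))) ⟩
    n * n + n * n + n * n ≡⟨ three (n * n) ⟩
    3 * (n * n) ∎)))
    where
    open ≤-Reasoning
    R? = restricting? L?
    ρ = # (fins n) R?
    ρ≤ : 3 * E * ρ ≤ n
    ρ≤ = <⇒≤ (≰⇒> few)
    dist : ∀ e n r t → e * (n * r + n * r + t) ≡ n * (e * r) + n * (e * r) + e * t
    dist = solve-∀
    three : ∀ s → s + s + s ≡ 3 * s
    three = solve-∀
    -- A non-restricting vertex has a permitted colour that shrinks few lists, and takes it.
    -- Restricting vertices get the default `c₀`, since all pairs meeting them are written off.
    choice : ∀ x → Σ (Fin ℓ) (λ c → ¬ Restricting L? x → 3 * E * # (fins n) (affected? L? x c) ≤ n × L x c)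
    choice x with restricting? L? x
    ... | yes r = c₀ , λ ¬r → ⊥-elim (¬r r)
    ... | no ¬r with Finₚ.¬∀⟶∃¬ _ _ (λ c → L? x c →-dec (n ≤? 3 * E * # (fins n) (affected? L? x c))) ¬r
    ... | c , h with L? x c
    ... | yes l = c , λ _ → <⇒≤ (≰⇒> (λ le → h (λ _ → le))) , l
    ... | no ¬l = ⊥-elim (h (λ l → ⊥-elim (¬l l)))
    φ : Fin n → Fin ℓ
    φ x = proj₁ (choice x)
    τ : Fin n → ℕ
    τ u = # (fins n) (λ v → ¬? (R? u) ×-dec affected? L? u (φ u) v)
    τ≤ : ∀ u → 3 * E * τ u ≤ n
    τ≤ u = #-guard (3 * E) (fins n) (¬? (R? u)) (affected? L? u (φ u)) (λ ¬r → proj₁ (proj₂ (choice u) ¬r))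
    -- Either `u` or `v` is restricting, or the colour of `v` lies in its own list, and then `v` is
    -- one of the few vertices affected by colouring `u`. Each of the three sources contributes at
    -- most `n * n / (3 * E)` pairs.
    point : ∀ u v → 𝟙 (mono? G φ u v) ≤ 𝟙 (R? u) + 𝟙 (R? v) + 𝟙 (¬? (R? u) ×-dec affected? L? u (φ u) v)
    point u v = ≤-trans (𝟙-⊎ (mono? G φ u v) (R? u ⊎-dec R? v) (¬? (R? u) ×-dec affected? L? u (φ u) v) split)
      (+-monoˡ-≤ _ (𝟙-⊎ (R? u ⊎-dec R? v) (R? u) (R? v) id))
      where
      split : Adj G u v × φ u ≡ φ v → (Restricting L? u ⊎ Restricting L? v) ⊎ (¬ Restricting L? u × Adj G u v × L v (φ u))
      split (a , e) = cases (R? u) (R? v)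
        where
        cases : Dec (Restricting L? u) → Dec (Restricting L? v) → _
        cases (yes r) _ = inj₁ (inj₁ r)
        cases (no _) (yes r) = inj₁ (inj₂ r)
        cases (no ¬r) (no ¬s) = inj₂ (¬r , a , subst (L v) (sym e) (proj₂ (proj₂ (choice v) ¬s)))

  -- A restricting vertex lowers `3 * E * potential` by at least `n` whichever permitted colour it
  -- takes, so the hypothesis passes from `suc d` to `d`. At depth 0 it is contradictory, so that
  -- case is absent. Blocks of different colours are independent and their densities multiply.
  manyObstructed : ∀ d {L : Fin n → Fin ℓ → Set} (L? : ∀ u c → Dec (L u c)) → 3 * E * potential L? < d * n →
    n ^ testSize ℓ d ≤ testDensity E ℓ d * #obstructed (testSize ℓ d) G ℓ L?
  manyObstructed (suc d) {L} L? small = begin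
    n * n ^ (ℓ * s) ≤⟨ *-monoˡ-≤ (n ^ (ℓ * s)) (manyRestricting L?) ⟩
    3 * E * # (fins n) R? * n ^ (ℓ * s) ≡⟨ *-assoc (3 * E) _ _ ⟩
    3 * E * (# (fins n) R? * n ^ (ℓ * s)) ≡⟨ cong (3 * E *_) (sym (∑-*ʳ (fins n) (n ^ (ℓ * s)) _)) ⟩
    3 * E * ∑ (fins n) (λ x → 𝟙 (R? x) * n ^ (ℓ * s)) ≤⟨ *-monoʳ-≤ (3 * E) (∑-mono (fins n) extend) ⟩
    3 * E * ∑ (fins n) (λ x → b ^ ℓ * ∑ (funs (ℓ * s) n) (λ T → 𝟙 (obstructed? G ℓ L? (cons x T))))
      ≡⟨ cong (3 * E *_) (trans (∑-*ˡ (fins n) (b ^ ℓ) _) (cong (b ^ ℓ *_) (sym (∑-funs-suc (ℓ * s) n _)))) ⟩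
    3 * E * (b ^ ℓ * #obstructed (suc (ℓ * s)) G ℓ L?) ≡⟨ sym (*-assoc (3 * E) (b ^ ℓ) _) ⟩
    3 * E * b ^ ℓ * #obstructed (suc (ℓ * s)) G ℓ L? ∎
    where
    open ≤-Reasoning
    s = testSize ℓ d
    b = testDensity E ℓ d
    instance b≢0 = testDensity≢0 E ℓ d
    R? = restricting? L?
    block? : ∀ x c (T : Fin s → Fin n) → Dec (L x c → Obstructed G ℓ (forbid L x c) T)
    block? x c T = L? x c →-dec obstructed? G ℓ (forbid? L? x c) T
    -- A colouring of the whole tuple gives `x` some colour, and the block reserved for that colour
    -- refutes it.
    combine-obstructed : ∀ x (T : Fin (ℓ * s) → Fin n) → (∀ c → L x c → Obstructed G ℓ (forbid L x c) (λ i → T (Fin.combine c i))) →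
      Obstructed G ℓ L (cons x T)
    combine-obstructed x T h (φ , l , p) = h (φ zero) (l zero) ((λ i → φ (suc (Fin.combine (φ zero) i))) ,
      (λ i → l (suc (Fin.combine (φ zero) i)) , λ { (e , a) → p zero (suc (Fin.combine (φ zero) i)) a (sym e) }) ,
      λ u v → p (suc (Fin.combine (φ zero) u)) (suc (Fin.combine (φ zero) v)))
    factor : ∀ x → Restricting L? x → ∀ c → n ^ s ≤ b * # (funs s n) (block? x c)
    factor x r c with L? x c
    -- A colour not permitted at `x` asks nothing of its block.
    ... | no ¬l = begin
      n ^ s ≤⟨ m≤n*m (n ^ s) b ⟩
      b * n ^ s ≡⟨ cong (b *_) (trans (sym (*-identityʳ (n ^ s))) (trans (sym (∑-funs-const s n 1)) (∑-cong (funs s n) (λ T → sym (𝟙-yes (no ¬l →-dec obstructed? G ℓ (forbid? L? x c) T) (λ l → ⊥-elim (¬l l))))))) ⟩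
      b * # (funs s n) (λ T → no ¬l →-dec obstructed? G ℓ (forbid? L? x c) T) ∎
    ... | yes l = ≤-trans (manyObstructed d (forbid? L? x c) (+-cancelʳ-< n _ _ (begin-strict
        3 * E * potential (forbid? L? x c) + n ≤⟨ +-monoʳ-≤ _ (r c l) ⟩
        3 * E * potential (forbid? L? x c) + 3 * E * # (fins n) (affected? L? x c) ≡⟨ sym (*-distribˡ-+ (3 * E) _ _) ⟩
        3 * E * (potential (forbid? L? x c) + # (fins n) (affected? L? x c)) ≤⟨ *-monoʳ-≤ (3 * E) (potential-forbid L? x c) ⟩
        3 * E * potential L? <⟨ small ⟩
        suc d * n ≡⟨ +-comm n (d * n) ⟩
        d * n + n ∎)))
      (*-monoʳ-≤ b (#-mono (funs s n) _ (λ T → yes l →-dec obstructed? G ℓ (forbid? L? x c) T) (λ T o _ → o)))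
    extend : ∀ x → 𝟙 (R? x) * n ^ (ℓ * s) ≤ b ^ ℓ * ∑ (funs (ℓ * s) n) (λ T → 𝟙 (obstructed? G ℓ L? (cons x T)))
    extend x with R? x
    ... | no _ = z≤n
    ... | yes r = begin
      n ^ (ℓ * s) + 0 ≡⟨ trans (+-identityʳ _) (trans (cong (n ^_) (*-comm ℓ s)) (sym (trans (∏-const ℓ (n ^ s)) (^-*-assoc n s ℓ)))) ⟩
      ∏ ℓ (λ _ → n ^ s) ≤⟨ ∏-mono ℓ (factor x r) ⟩
      ∏ ℓ (λ c → b * # (funs s n) (block? x c)) ≡⟨ trans (∏-* ℓ (λ _ → b) _) (cong (_* ∏ ℓ (λ c → # (funs s n) (block? x c))) (∏-const ℓ b)) ⟩
      b ^ ℓ * ∏ ℓ (λ c → # (funs s n) (block? x c))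
        ≡⟨ cong (b ^ ℓ *_) (sym (∑-blocks ℓ s n (λ c T → 𝟙 (block? x c T)) (λ c → 𝟙-ext (block? x c) (λ e o l → obstructed-resp G ℓ (forbid L x c) e (o l))))) ⟩
      b ^ ℓ * ∑ (funs (ℓ * s) n) (λ T → ∏ ℓ (λ c → 𝟙 (block? x c (λ i → T (Fin.combine c i)))))
        ≤⟨ *-monoʳ-≤ (b ^ ℓ) (∑-mono (funs (ℓ * s) n) (λ T → ≤-trans
             (≤-reflexive (sym (𝟙-∀ (λ c → block? x c (λ i → T (Fin.combine c i))) (Finₚ.all? (λ c → block? x c (λ i → T (Fin.combine c i)))) id id)))
             (𝟙-mono (Finₚ.all? (λ c → block? x c (λ i → T (Fin.combine c i)))) (obstructed? G ℓ L? (cons x T)) (combine-obstructed x T)))) ⟩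
      b ^ ℓ * ∑ (funs (ℓ * s) n) (λ T → 𝟙 (obstructed? G ℓ L? (cons x T))) ∎

colouring-resp : (G : Graph n) (ℓ : ℕ) → Resp (λ (T : Fin k → Fin n) → ¬ ∃ (Colouring (pull G T) ℓ))
colouring-resp G ℓ {f} {g} e o (φ , c) = o (φ ,
  λ u v a → c u v (subst (λ z → Adj G z (g v)) (e u) (subst (Adj G (f u)) (e v) a)))

uncolourable? : (G : Graph n) (ℓ : ℕ) → Dec (¬ ∃ (Colouring G ℓ))
uncolourable? G ℓ = ¬? (anyFun? (Hom? G (K ℓ)) (Hom-resp G (K ℓ)))

-- Colour the vertices one by one, each time branching on a vertex all of whose colours shrink many lists.
colourabilityTest : ∀ ℓ .{{_ : NonZero ℓ}} E .{{_ : NonZero E}} → ∃ λ k → ∃ λ b → NonZero b ×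
  (∀ {n} .{{_ : NonZero n}} (G : Graph n) → ¬ NearColourable E ℓ G →
    n ^ k ≤ b * # (funs k n) (λ T → uncolourable? (pull G T) ℓ))
colourabilityTest (suc ℓ) E = testSize (suc ℓ) d , testDensity E (suc ℓ) d , testDensity≢0 E (suc ℓ) d , λ {n} G far →
  ≤-trans (manyObstructed E G zero far d (λ _ _ → yes tt) (start n))
    (*-monoʳ-≤ (testDensity E (suc ℓ) d) (#-mono (funs (testSize (suc ℓ) d) n) (obstructed? G (suc ℓ) (λ _ _ → yes tt)) (λ T → uncolourable? (pull G T) (suc ℓ)) (λ { T o (φ , c) → o (φ , (λ _ → tt) , c) })))
  where
  -- Full lists have potential `n * suc ℓ`, and each level uses up `n` of `3 * E * potential`; the
  -- successor makes the inequality strict.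
  d = suc (3 * E * suc ℓ)
  start : ∀ n .{{_ : NonZero n}} → 3 * E * potential {n} {suc ℓ} (λ _ _ → yes tt) < d * n
  start n = begin-strict
    3 * E * potential {n} {suc ℓ} (λ _ _ → yes tt)
      ≡⟨ cong (3 * E *_) (trans (∑-cong (fins n) (λ _ → trans (∑-fins-const (suc ℓ) 1) (*-identityʳ _))) (∑-fins-const n (suc ℓ))) ⟩
    3 * E * (n * suc ℓ) ≡⟨ re (3 * E) n (suc ℓ) ⟩
    3 * E * suc ℓ * n <⟨ m<n+m (3 * E * suc ℓ * n) (ℕ.>-nonZero⁻¹ n) ⟩
    d * n ∎
    where
    open ≤-Reasoning
    re : ∀ a b c → a * (b * c) ≡ a * c * b
    re = solve-∀

-- Random samples of fixed size

-- A certificate of linear arithmetic: `a ≤ b` is a combination of known inequalities with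
-- nonnegative coefficients, `s` is the slack, and the equation is an identity for the ring solver.
certify : ∀ {a b x y} s → a ≤ b → x + b + s ≡ y + a → x ≤ y
certify {a} {b} {x} {y} s a≤b e = +-cancelʳ-≤ b x y (begin
  x + b ≤⟨ m≤m+n (x + b) s ⟩
  x + b + s ≡⟨ e ⟩
  y + a ≤⟨ +-monoʳ-≤ y a≤b ⟩
  y + b ∎)
  where open ≤-Reasoning

-- Linearity of expectation: for injective `f` the tuple `S ∘ f` is uniform. Only the positions in
-- the sample have to be distinct; `S` itself may repeat vertices, which keeps the identity exact.
sampleSum : ∀ a m n {P : (Fin a → Fin n) → Set} (P? : ∀ f → Dec (P f)) → Resp P →
  ∑ (funs m n) (λ S → # (funs a m) (λ f → inj? f ×-dec P? (S ∘ f))) * n ^ a ≡ falling a m * (n ^ m * # (funs a n) P?)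
sampleSum a m n {P} P? resp = begin
  ∑ (funs m n) (λ S → # (funs a m) (λ f → inj? f ×-dec P? (S ∘ f))) * n ^ a
    ≡⟨ cong (_* n ^ a) (∑-swap (funs m n) (funs a m) _) ⟩
  ∑ (funs a m) (λ f → # (funs m n) (λ S → inj? f ×-dec P? (S ∘ f))) * n ^ a
    ≡⟨ sym (∑-*ʳ (funs a m) (n ^ a) _) ⟩
  ∑ (funs a m) (λ f → # (funs m n) (λ S → inj? f ×-dec P? (S ∘ f)) * n ^ a)
    ≡⟨ ∑-cong (funs a m) (λ f → each f (inj? f)) ⟩
  ∑ (funs a m) (λ f → 𝟙 (inj? f) * (n ^ m * # (funs a n) P?))
    ≡⟨ ∑-*ʳ (funs a m) _ _ ⟩
  falling a m * (n ^ m * # (funs a n) P?) ∎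
  where
  open ≡-Reasoning
  each : ∀ f (d : Dec (Inj f)) → # (funs m n) (λ S → d ×-dec P? (S ∘ f)) * n ^ a ≡ 𝟙 d * (n ^ m * # (funs a n) P?)
  each f (no _) = cong (_* n ^ a) (∑-zero (funs m n))
  each f (yes i) = trans (cong (_* n ^ a) (∑-cong (funs m n) (λ S → 𝟙-cong (yes i ×-dec P? (S ∘ f)) (P? (S ∘ f)) proj₂ (i ,_))))
    (trans (#-marginal n f (Inj⇒ i) P? resp) (sym (+-identityʳ _)))

notHom⇒ : (R : Graph m) (G : Graph n) (f : Fin m → Fin n) → ¬ Hom R G f → ∃ λ u → ∃ λ v → Adj R u v × ¬ Adj G (f u) (f v)
notHom⇒ R G f ¬h with Finₚ.¬∀⟶∃¬ _ _ (λ u → Finₚ.all? (λ v → adj? R u v →-dec adj? G (f u) (f v))) ¬h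
... | u , ¬h₁ with Finₚ.¬∀⟶∃¬ _ _ (λ v → adj? R u v →-dec adj? G (f u) (f v)) ¬h₁
... | v , ¬h₂ with adj? R u v
... | yes a = u , v , a , λ b → ¬h₂ (λ _ → b)
... | no ¬a = ⊥-elim (¬h₂ (λ a → ⊥-elim (¬a a)))

notColouring⇒ : (G : Graph n) {ℓ : ℕ} (φ : Fin n → Fin ℓ) → ¬ Colouring G ℓ φ → ∃ λ u → ∃ λ v → Adj G u v × φ u ≡ φ v
notColouring⇒ G {ℓ} φ ¬c with notHom⇒ G (K ℓ) φ ¬c
... | u , v , a , ¬ne = u , v , a , decidable-stable (φ u Fin.≟ φ v) ¬ne

KFree : ℕ → Graph n → Set
KFree ℓ G = ¬ ∃ (Hom (K (suc ℓ)) G)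

clique? : ∀ ℓ (G : Graph n) → Dec (∃ (Hom (K (suc ℓ)) G))
clique? ℓ G = anyFun? (Hom? (K (suc ℓ)) G) (Hom-resp (K (suc ℓ)) G)

clique-inj : ∀ {k} {G : Graph n} (f : Fin k → Fin n) → Hom (K k) G f → Inj f
clique-inj {G = G} f h i j e = decidable-stable (i Fin.≟ j) (λ ne → irr G (h i j ne) e)

-- This lemma and the next two bound the same quantity `D * h * mk + M * Y` of one sample, `h`
-- counting copies of `R` and `Y` uncolourable tuples among `mk`. A sample with a clique gets the
-- trivial bound, charged to its `κ` cliques; a near-extremal one has small `Y`; any other one has a
-- deficit `M / D` in `h`, which pays for the trivial bound on `Y`.
sample-arith-clique : ∀ {E D h M Y mk mq} κ r → 1 ≤ κ → h ≤ mq → M ≤ mq → Y ≤ mk →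
  E * (D * h * mk + M * Y) ≤ r + E * ((D + 1) * (mq * mk)) * κ
sample-arith-clique {E} {D} {h} {M} {Y} {mk} {mq} κ r 1≤κ h≤ M≤ Y≤ = begin
  E * (D * h * mk + M * Y) ≤⟨ *-monoʳ-≤ E (+-mono-≤ (*-monoˡ-≤ mk (*-monoʳ-≤ D h≤)) (*-mono-≤ M≤ Y≤)) ⟩
  E * (D * mq * mk + mq * mk) ≡⟨ re E D mq mk ⟩
  E * ((D + 1) * (mq * mk)) * 1 ≤⟨ *-monoʳ-≤ (E * ((D + 1) * (mq * mk))) 1≤κ ⟩
  E * ((D + 1) * (mq * mk)) * κ ≤⟨ m≤n+m _ r ⟩
  r + E * ((D + 1) * (mq * mk)) * κ ∎
  where
  open ≤-Reasoning
  re : ∀ E D mq mk → E * (D * mq * mk + mq * mk) ≡ E * ((D + 1) * (mq * mk)) * 1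
  re = solve-∀

sample-arith-near : ∀ {E D h M Y mk} c r → h ≤ M → E * Y ≤ c * mk →
  E * (D * h * mk + M * Y) ≤ E * (D * (M * mk)) + c * (M * mk) + r
sample-arith-near {E} {D} {h} {M} {Y} {mk} c r h≤ Y≤ = begin
  E * (D * h * mk + M * Y) ≡⟨ re₁ E D h M Y mk ⟩
  E * (D * (h * mk)) + M * (E * Y) ≤⟨ +-mono-≤ (*-monoʳ-≤ E (*-monoʳ-≤ D (*-monoˡ-≤ mk h≤))) (*-monoʳ-≤ M Y≤) ⟩
  E * (D * (M * mk)) + M * (c * mk) ≡⟨ re₂ (E * (D * (M * mk))) M c mk ⟩
  E * (D * (M * mk)) + c * (M * mk) ≤⟨ m≤m+n _ r ⟩
  E * (D * (M * mk)) + c * (M * mk) + r ∎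
  where
  open ≤-Reasoning
  re₁ : ∀ E D h M Y mk → E * (D * h * mk + M * Y) ≡ E * (D * (h * mk)) + M * (E * Y)
  re₁ = solve-∀
  re₂ : ∀ x M c mk → x + M * (c * mk) ≡ x + c * (M * mk)
  re₂ = solve-∀

sample-arith-far : ∀ {E D h M Y mk} c r → D * h + M ≤ D * M → Y ≤ mk →
  E * (D * h * mk + M * Y) ≤ E * (D * (M * mk)) + c * (M * mk) + r
sample-arith-far {E} {D} {h} {M} {Y} {mk} c r lt Y≤ = begin
  E * (D * h * mk + M * Y) ≤⟨ *-monoʳ-≤ E (+-monoʳ-≤ (D * h * mk) (*-monoʳ-≤ M Y≤)) ⟩
  E * (D * h * mk + M * mk) ≡⟨ cong (E *_) (sym (*-distribʳ-+ mk (D * h) M)) ⟩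
  E * ((D * h + M) * mk) ≤⟨ *-monoʳ-≤ E (*-monoˡ-≤ mk lt) ⟩
  E * (D * M * mk) ≡⟨ cong (E *_) (*-assoc D M mk) ⟩
  E * (D * (M * mk)) ≤⟨ m≤m+n _ (c * (M * mk)) ⟩
  E * (D * (M * mk)) + c * (M * mk) ≤⟨ m≤m+n _ r ⟩
  E * (D * (M * mk)) + c * (M * mk) + r ∎
  where open ≤-Reasoning

-- The budget per sample, after division by `mk`: uncolourable tuples contribute at least
-- `M / (2b)`, while near-extremal samples allow for `M / (8b)` of this and cliques for `1 / (8b)`,
-- which is at most `M / (8b)`. The remaining `M / (4b)` must be a deficit of `D` times the average
-- of `h`.
sample-arith : ∀ {b c D M N mk mq nq fq Hs Ys Ks h} .{{_ : NonZero (b * c * mk)}} .{{_ : NonZero N}} → 1 ≤ M →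
  8 * b * c * (D * Hs * mk + M * Ys) ≤ N * (8 * b * c * (D * (M * mk)) + c * (M * mk)) + 8 * b * c * ((D + 1) * (mq * mk)) * Ks →
  Hs * nq ≡ fq * (N * h) → mk * N ≤ 2 * b * Ys → 8 * b * (D + 1) * mq * Ks ≤ N →
  4 * b * D * (fq * h) + M * nq ≤ 4 * b * D * (M * nq)
sample-arith {b} {c} {D} {M} {N} {mk} {mq} {nq} {fq} {Hs} {Ys} {Ks} {h} 1≤M sum eH many few =
  *-cancelˡ-≤ N (begin
    N * (4 * b * D * (fq * h) + M * nq) ≡⟨ re₄ N b D fq h M nq ⟩
    4 * b * D * (fq * (N * h)) + N * M * nq ≡⟨ cong (λ z → 4 * b * D * z + N * M * nq) (sym eH) ⟩
    4 * b * D * (Hs * nq) + N * M * nq ≡⟨ re₅ b D Hs nq N M ⟩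
    (4 * b * D * Hs + M * N) * nq ≤⟨ *-monoˡ-≤ nq step₂ ⟩
    4 * b * D * (M * N) * nq ≡⟨ re₆ b D M N nq ⟩
    N * (4 * b * D * (M * nq)) ∎)
  where
  open ≤-Reasoning
  re₄ : ∀ N b D fq h M nq → N * (4 * b * D * (fq * h) + M * nq) ≡ 4 * b * D * (fq * (N * h)) + N * M * nq
  re₄ = solve-∀
  re₅ : ∀ b D Hs nq N M → 4 * b * D * (Hs * nq) + N * M * nq ≡ (4 * b * D * Hs + M * N) * nq
  re₅ = solve-∀
  re₆ : ∀ b D M N nq → 4 * b * D * (M * N) * nq ≡ N * (4 * b * D * (M * nq))
  re₆ = solve-∀
  re₁ : ∀ b c D M N mk mq Hs Ys Ks →
    b * c * mk * (8 * b * D * Hs + 4 * (M * N)) +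
      (b * (N * (8 * b * c * (D * (M * mk)) + c * (M * mk)) + 8 * b * c * ((D + 1) * (mq * mk)) * Ks)
        + (4 * (b * c * M) * (2 * b * Ys) + b * c * mk * N)) + 0
    ≡ b * c * mk * (8 * b * D * (M * N) + M * N + N)
      + (b * (8 * b * c * (D * Hs * mk + M * Ys)) + (4 * (b * c * M) * (mk * N) + b * c * mk * (8 * b * (D + 1) * mq * Ks)))
  re₁ = solve-∀
  step₁ : 8 * b * D * Hs + 4 * (M * N) ≤ 8 * b * D * (M * N) + M * N + N
  step₁ = *-cancelˡ-≤ (b * c * mk) (certify 0
    (+-mono-≤ (*-monoʳ-≤ b sum) (+-mono-≤ (*-monoʳ-≤ (4 * (b * c * M)) many) (*-monoʳ-≤ (b * c * mk) few)))
    (re₁ b c D M N mk mq Hs Ys Ks))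
  re₂ : ∀ b D Hs M N → 2 * (4 * b * D * Hs + M * N) + (8 * b * D * (M * N) + M * N + N + M * N) + 0
    ≡ 2 * (4 * b * D * (M * N)) + (8 * b * D * Hs + 4 * (M * N) + 1 * N)
  re₂ = solve-∀
  step₂ : 4 * b * D * Hs + M * N ≤ 4 * b * D * (M * N)
  step₂ = *-cancelˡ-≤ 2 (certify 0 (+-mono-≤ step₁ (*-monoˡ-≤ N 1≤M)) (re₂ b D Hs M N))

sampling : ∀ {q k b m n ℓ D M} .{{_ : NonZero b}} .{{_ : NonZero m}} .{{_ : NonZero n}} (R : Graph q) →
  (∀ (J : Graph m) → KFree ℓ J → D * M ≤ D * injHom R J + M → NearColourable (8 * b * suc (k * k)) ℓ J) →
  (∀ (J : Graph m) → KFree ℓ J → injHom R J ≤ M) → 1 ≤ M → M ≤ m ^ q → m ^ k ≤ 2 * falling k m →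
  (G : Graph n) → n ^ k ≤ b * # (funs k n) (λ T → uncolourable? (pull G T) ℓ) →
  8 * b * (D + 1) * m ^ q * m ^ suc ℓ * hom (K (suc ℓ)) G ≤ n ^ suc ℓ →
  4 * b * D * (falling q m * hom R G) + M * n ^ q ≤ 4 * b * D * (M * n ^ q)
sampling {q} {k} {b} {m} {n} {ℓ} {D} {M} R near max 1≤M M≤ mostInj G manyBad fewCliques =
  sample-arith {b} {c} {D} {M} {n ^ m} {m ^ k} {m ^ q} {n ^ q} {falling q m} {∑ (funs m n) h} {∑ (funs m n) Y} {∑ (funs m n) κ}
    1≤M sum (sampleSum q m n (Hom? R G) (Hom-resp R G)) many few
  where
  open ≤-Reasoning
  -- The union bound over the pairs in a `k`-tuple costs `k * k`; the successor keeps the factor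
  -- positive.
  c = suc (k * k)
  instance
    mk≢0 = m^n≢0 m k
    N≢0 = m^n≢0 n m
    nk≢0 = m^n≢0 n k
    nl≢0 = m^n≢0 n (suc ℓ)
    ml≢0 = m^n≢0 m (suc ℓ)
    bc≢0 = m*n≢0 b c
    bcm≢0 = m*n≢0 (b * c) (m ^ k)
  bad? = λ (T : Fin k → Fin n) → uncolourable? (pull G T) ℓ
  h Y κ : (Fin m → Fin n) → ℕ
  h S = injHom R (pull G S)
  Y S = # (funs k m) (λ T → inj? T ×-dec bad? (S ∘ T))
  κ S = # (funs (suc ℓ) m) (λ f → inj? f ×-dec Hom? (K (suc ℓ)) G (S ∘ f))
  Y≤ : ∀ S → Y S ≤ m ^ k
  Y≤ S = ≤-trans (#≤length (funs k m) (λ T → inj? T ×-dec bad? (S ∘ T))) (≤-reflexive (length-funs k m))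
  E₀ = 8 * b * c
  each : ∀ S → E₀ * (D * h S * m ^ k + M * Y S) ≤ E₀ * (D * (M * m ^ k)) + c * (M * m ^ k) + E₀ * ((D + 1) * (m ^ q * m ^ k)) * κ S
  each S with clique? ℓ (pull G S)
  ... | yes (f , cl) = sample-arith-clique {E₀} {D} {h S} {M} {Y S} {m ^ k} (κ S) _
        (≤-trans (≤-reflexive (sym (𝟙-yes (inj? f ×-dec Hom? (K (suc ℓ)) G (S ∘ f)) (clique-inj {G = pull G S} f cl , cl))))
          (∑-funs-≥ _ (𝟙-ext (λ f → inj? f ×-dec Hom? (K (suc ℓ)) G (S ∘ f)) (InjHom-resp (K (suc ℓ)) (pull G S))) f))
        (injHom≤ R (pull G S)) M≤ (Y≤ S)
  ... | no free with D * M ≤? D * h S + M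
  ...   | no far = sample-arith-far {E₀} {D} {h S} {M} {Y S} {m ^ k} c _ (<⇒≤ (≰⇒> far)) (Y≤ S)
  ...   | yes ext with near (pull G S) free ext
  ...     | φ , few = sample-arith-near {E₀} {D} {h S} {M} {Y S} {m ^ k} c _ (max (pull G S) free) (begin
    E₀ * Y S ≤⟨ pairLoss {k} E₀ 1 (mono? (pull G S) φ) (≤-trans few (≤-reflexive (sym (*-identityˡ (m * m)))))
                  (λ T → inj? T ×-dec bad? (S ∘ T)) cover ⟩
    k * (k * (1 * m ^ k)) ≡⟨ trans (cong (λ z → k * (k * z)) (*-identityˡ (m ^ k))) (sym (*-assoc k k (m ^ k))) ⟩
    k * k * m ^ k ≤⟨ m≤n+m _ (m ^ k) ⟩
    c * m ^ k ∎)
    where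
    cover : ∀ T → Inj T × ¬ ∃ (Colouring (pull G (S ∘ T)) ℓ) → ∃ λ u → ∃ λ v → u ≢ v × Adj G (S (T u)) (S (T v)) × φ (T u) ≡ φ (T v)
    cover T (i , unc) with notColouring⇒ (pull G (S ∘ T)) (φ ∘ T) (λ col → unc (φ ∘ T , col))
    ... | u , v , a , e = u , v , (λ { refl → irr G a refl }) , a , e
  sum : E₀ * (D * ∑ (funs m n) h * m ^ k + M * ∑ (funs m n) Y) ≤
    n ^ m * (E₀ * (D * (M * m ^ k)) + c * (M * m ^ k)) + E₀ * ((D + 1) * (m ^ q * m ^ k)) * ∑ (funs m n) κ
  sum = begin
    E₀ * (D * ∑ (funs m n) h * m ^ k + M * ∑ (funs m n) Y)
      ≡⟨ cong (E₀ *_) (sym (trans (∑-+ (funs m n) _ _) (cong₂ _+_ (trans (∑-*ʳ (funs m n) (m ^ k) _) (cong (_* m ^ k) (∑-*ˡ (funs m n) D h))) (∑-*ˡ (funs m n) M Y)))) ⟩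
    E₀ * ∑ (funs m n) (λ S → D * h S * m ^ k + M * Y S) ≡⟨ sym (∑-*ˡ (funs m n) E₀ _) ⟩
    ∑ (funs m n) (λ S → E₀ * (D * h S * m ^ k + M * Y S)) ≤⟨ ∑-mono (funs m n) each ⟩
    ∑ (funs m n) (λ S → E₀ * (D * (M * m ^ k)) + c * (M * m ^ k) + E₀ * ((D + 1) * (m ^ q * m ^ k)) * κ S)
      ≡⟨ trans (∑-+ (funs m n) _ _) (cong₂ _+_ (∑-funs-const m n _) (∑-*ˡ (funs m n) (E₀ * ((D + 1) * (m ^ q * m ^ k))) κ)) ⟩
    n ^ m * (E₀ * (D * (M * m ^ k)) + c * (M * m ^ k)) + E₀ * ((D + 1) * (m ^ q * m ^ k)) * ∑ (funs m n) κ ∎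
  many : m ^ k * n ^ m ≤ 2 * b * ∑ (funs m n) Y
  many = *-cancelʳ-≤ _ _ (n ^ k) (begin
    m ^ k * n ^ m * n ^ k ≤⟨ *-mono-≤ (*-monoˡ-≤ (n ^ m) mostInj) manyBad ⟩
    2 * falling k m * n ^ m * (b * # (funs k n) bad?) ≡⟨ re (falling k m) (n ^ m) b (# (funs k n) bad?) ⟩
    2 * b * (falling k m * (n ^ m * # (funs k n) bad?)) ≡⟨ cong (2 * b *_) (sym (sampleSum k m n bad? (colouring-resp G ℓ))) ⟩
    2 * b * (∑ (funs m n) Y * n ^ k) ≡⟨ sym (*-assoc (2 * b) _ _) ⟩
    2 * b * ∑ (funs m n) Y * n ^ k ∎)
    where
    re : ∀ f N b x → 2 * f * N * (b * x) ≡ 2 * b * (f * (N * x))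
    re = solve-∀
  few : 8 * b * (D + 1) * m ^ q * ∑ (funs m n) κ ≤ n ^ m
  few = *-cancelʳ-≤ _ _ (m ^ suc ℓ) (*-cancelʳ-≤ _ _ (n ^ suc ℓ) (begin
    γ * ∑ (funs m n) κ * m ^ suc ℓ * n ^ suc ℓ ≡⟨ re₁ γ (∑ (funs m n) κ) (m ^ suc ℓ) (n ^ suc ℓ) ⟩
    γ * m ^ suc ℓ * (∑ (funs m n) κ * n ^ suc ℓ) ≡⟨ cong (γ * m ^ suc ℓ *_) (sampleSum (suc ℓ) m n (Hom? (K (suc ℓ)) G) (Hom-resp (K (suc ℓ)) G)) ⟩
    γ * m ^ suc ℓ * (falling (suc ℓ) m * (n ^ m * hom (K (suc ℓ)) G)) ≡⟨ re₂ (γ * m ^ suc ℓ) (falling (suc ℓ) m) (n ^ m) (hom (K (suc ℓ)) G) ⟩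
    n ^ m * falling (suc ℓ) m * (γ * m ^ suc ℓ * hom (K (suc ℓ)) G) ≤⟨ *-mono-≤ (*-monoʳ-≤ (n ^ m) (falling≤ (suc ℓ) m)) fewCliques ⟩
    n ^ m * m ^ suc ℓ * n ^ suc ℓ ∎))
    where
    γ = 8 * b * (D + 1) * m ^ q
    re₁ : ∀ g s x y → g * s * x * y ≡ g * x * (s * y)
    re₁ = solve-∀
    re₂ : ∀ g f N x → g * (f * (N * x)) ≡ N * f * (g * x)
    re₂ = solve-∀

-- Complete multipartite patterns in dense relations

*-^ : ∀ t a b → (a * b) ^ t ≡ a ^ t * b ^ t
*-^ t a b = trans (sym (∏-const t (a * b))) (trans (∏-* t (λ _ → a) (λ _ → b)) (cong₂ _*_ (∏-const t a) (∏-const t b)))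

-- A substitute for convexity: values of `g` below `n / (2 * Γ)` make up at most half of the sum,
-- and each larger value has `g ^ t` at least `(n / (2 * Γ)) ^ t`.
powerSum : ∀ {A : Set} (xs : List A) (g : A → ℕ) {n} .{{_ : NonZero n}} Γ s t → length xs ≡ n ^ s →
  n ^ suc s ≤ Γ * ∑ xs g → (∀ x → g x ≤ n) → n ^ s * n ^ t ≤ (2 * Γ) ^ suc t * ∑ xs (λ x → g x ^ t)
powerSum xs g {n} Γ s t len dense g≤n = *-cancelˡ-≤ n (certify 0 (+-mono-≤ (*-monoʳ-≤ (2 * n ^ t) dense) sum)
    (re n (n ^ s) (n ^ t) Γ (∑ xs g) (C * ∑ xs (λ x → g x ^ t))))
  where
  open ≤-Reasoning
  C = (2 * Γ) ^ suc t
  re : ∀ n ns nt Γ sg w → n * (ns * nt) + (2 * nt * (Γ * sg) + (n * w + ns * (n * nt))) + 0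
    ≡ n * w + (2 * nt * (n * ns) + 2 * Γ * nt * sg)
  re = solve-∀
  re₁ : ∀ a g x → a * x * g ≡ g * (a * x)
  re₁ = solve-∀
  point : ∀ x → 2 * Γ * n ^ t * g x ≤ n * (C * g x ^ t) + n * n ^ t
  point x with n ≤? 2 * Γ * g x
  ... | yes big = ≤-trans (begin
      2 * Γ * n ^ t * g x ≡⟨ re₁ (2 * Γ) (g x) (n ^ t) ⟩
      g x * (2 * Γ * n ^ t) ≤⟨ *-mono-≤ (g≤n x) (*-monoʳ-≤ (2 * Γ) (^-monoˡ-≤ t big)) ⟩
      n * (2 * Γ * (2 * Γ * g x) ^ t) ≡⟨ cong (λ z → n * (2 * Γ * z)) (*-^ t (2 * Γ) (g x)) ⟩
      n * (2 * Γ * ((2 * Γ) ^ t * g x ^ t)) ≡⟨ cong (n *_) (sym (*-assoc (2 * Γ) _ _)) ⟩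
      n * (C * g x ^ t) ∎) (m≤m+n _ _)
  ... | no small = ≤-trans (begin
      2 * Γ * n ^ t * g x ≡⟨ re₂ (2 * Γ) (n ^ t) (g x) ⟩
      2 * Γ * g x * n ^ t ≤⟨ *-monoˡ-≤ (n ^ t) (<⇒≤ (≰⇒> small)) ⟩
      n * n ^ t ∎) (m≤n+m _ _)
    where
    re₂ : ∀ a x y → a * x * y ≡ a * y * x
    re₂ = solve-∀
  sum : 2 * Γ * n ^ t * ∑ xs g ≤ n * (C * ∑ xs (λ x → g x ^ t)) + n ^ s * (n * n ^ t)
  sum = begin
    2 * Γ * n ^ t * ∑ xs g ≡⟨ sym (∑-*ˡ xs (2 * Γ * n ^ t) g) ⟩
    ∑ xs (λ x → 2 * Γ * n ^ t * g x) ≤⟨ ∑-mono xs point ⟩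
    ∑ xs (λ x → n * (C * g x ^ t) + n * n ^ t) ≡⟨ ∑-+ xs _ _ ⟩
    ∑ xs (λ x → n * (C * g x ^ t)) + ∑ xs (λ _ → n * n ^ t)
      ≡⟨ cong₂ _+_ (trans (∑-*ˡ xs n _) (cong (n *_) (∑-*ˡ xs C _))) (trans (∑-const xs _) (cong (_* (n * n ^ t)) len)) ⟩
    n * (C * ∑ xs (λ x → g x ^ t)) + n ^ s * (n * n ^ t) ∎

cons-resp : ∀ {P : (Fin (suc m) → Fin n) → Set} → Resp P → ∀ {f g : Fin m → Fin n} x → f ≗ g → P (cons x f) → P (cons x g)
cons-resp resp x e = resp (λ { zero → refl ; (suc i) → e i })

-- Erdős' theorem on complete s-partite s-graphs; the parts are found one coordinate at a time.
denseRelation : ∀ s t Γ → ∃ λ N → ∀ n → N ≤ n → {P : (Fin s → Fin n) → Set} (P? : ∀ f → Dec (P f)) → Resp P →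
  n ^ s ≤ Γ * # (funs s n) P? →
  ∃ λ (b : Fin s → Fin t → Fin n) → (∀ i → Inj (b i)) × (∀ (χ : Fin s → Fin t) → P (λ i → b i (χ i)))
denseRelation zero t Γ = 0 , λ n _ {P} P? resp dense → (λ ()) , (λ ()) , λ χ →
  resp {f = proj₁ (found n P? dense)} (λ ()) (proj₂ (found n P? dense))
  where
  found : ∀ n {P : (Fin 0 → Fin n) → Set} (P? : ∀ f → Dec (P f)) → 1 ≤ Γ * # (funs 0 n) P? → ∃ P
  found n P? dense with 1 ≤? # (funs 0 n) P?
  ... | yes h = ∑-witness (funs 0 n) P? h
  ... | no h = ⊥-elim (<-irrefl refl (≤-trans dense (≤-reflexive (trans (cong (Γ *_) (n<1⇒n≡0 (≰⇒> h))) (*-zeroʳ Γ)))))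
denseRelation (suc s) t Γ = suc (2 * C * (t * t)) + proj₁ IH , λ { zero () ; n@(suc _) → step n }
  where
  C = (2 * Γ) ^ suc t
  IH = denseRelation s t (2 * C)
  step : ∀ n .{{_ : NonZero n}} → suc (2 * C * (t * t)) + proj₁ IH ≤ n → {P : (Fin (suc s) → Fin n) → Set} (P? : ∀ f → Dec (P f)) → Resp P →
    n ^ suc s ≤ Γ * # (funs (suc s) n) P? →
    ∃ λ (b : Fin (suc s) → Fin t → Fin n) → (∀ i → Inj (b i)) × (∀ (χ : Fin (suc s) → Fin t) → P (λ i → b i (χ i)))
  step n N≤n {P} P? resp dense = build (anyFun? (λ x → inj? x ×-dec (n ^ s ≤? 2 * C * h x)) good-resp)
    where
    open ≤-Reasoning
    instance
      nst≢0 = m*n≢0 (n ^ s) (n ^ t) {{m^n≢0 n s}} {{m^n≢0 n t}}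
    link? : ∀ (x : Fin t → Fin n) y → Dec (∀ a → P (cons (x a) y))
    link? x y = Finₚ.all? (λ a → P? (cons (x a) y))
    h : (Fin t → Fin n) → ℕ
    h x = # (funs s n) (link? x)
    g : (Fin s → Fin n) → ℕ
    g y = # (fins n) (λ x → P? (cons x y))
    h-ext : Ext h
    h-ext {x} {x'} e = ∑-cong (funs s n) (λ y → 𝟙-cong (link? x y) (link? x' y)
      (λ p a → subst (λ z → P (cons z y)) (e a) (p a)) (λ p a → subst (λ z → P (cons z y)) (sym (e a)) (p a)))
    good-resp : Resp (λ x → Inj x × n ^ s ≤ 2 * C * h x)
    good-resp {x} {x'} e (i , d) = Inj-resp e i , subst (λ z → n ^ s ≤ 2 * C * z) (h-ext {x} {x'} e) d
    build : Dec (∃ λ x → Inj x × n ^ s ≤ 2 * C * h x) → _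
    build (yes (x , i , d)) with proj₂ IH n (≤-trans (m≤n+m _ _) N≤n) (link? x) (λ e p a → cons-resp {P = P} resp (x a) e (p a)) d
    ... | b , inj , all = (λ { zero → x ; (suc j) → b j }) , (λ { zero → i ; (suc j) → inj j }) ,
      λ χ → resp (λ { zero → refl ; (suc j) → refl }) (all (λ j → χ (suc j)) (χ zero))
    -- Injective `x` account for at most half of the guaranteed sum of `h`, so the non-injective
    -- ones would form a fraction of at least `1 / (2 * C)` of all `t`-tuples. Their fraction is
    -- smaller, as `n` exceeds `2 * C * (t * t)`.
    build (no none) = ⊥-elim (<-irrefl refl (begin-strict
      suc E * (n ^ s * n ^ t) ≤⟨ *-monoʳ-≤ (suc E) few ⟩
      suc E * (n ^ s * (2 * C * ν)) ≡⟨ re₁ (suc E) (n ^ s) (2 * C) ν ⟩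
      n ^ s * (2 * C) * (suc E * ν) ≤⟨ *-monoʳ-≤ (n ^ s * (2 * C)) (fewNotInj {t} (suc E) (≤-trans (m≤m+n _ _) N≤n)) ⟩
      n ^ s * (2 * C) * (t * (t * n ^ t)) ≡⟨ re₂ (n ^ s) (2 * C) t (n ^ t) ⟩
      E * (n ^ s * n ^ t) <⟨ *-monoˡ-< (n ^ s * n ^ t) (n<1+n E) ⟩
      suc E * (n ^ s * n ^ t) ∎))
      where
      E = 2 * C * (t * t)
      ν = # (funs t n) (λ x → ¬? (inj? x))
      re₁ : ∀ e a c v → e * (a * (c * v)) ≡ a * c * (e * v)
      re₁ = solve-∀
      re₂ : ∀ a c t x → a * c * (t * (t * x)) ≡ c * (t * t) * (a * x)
      re₂ = solve-∀
      re₃ : ∀ a b w → a * b + (2 * w + b * a) + 0 ≡ 2 * w + 2 * (a * b)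
      re₃ = solve-∀
      point : ∀ x → 2 * C * h x ≤ n ^ s * (2 * C) * 𝟙 (¬? (inj? x)) + n ^ s
      point x with inj? x
      ... | yes i = ≤-trans (<⇒≤ (≰⇒> (λ d → none (x , i , d)))) (m≤n+m _ _)
      ... | no _ = ≤-trans (begin
        2 * C * h x ≤⟨ *-monoʳ-≤ (2 * C) (≤-trans (#≤length (funs s n) (link? x)) (≤-reflexive (length-funs s n))) ⟩
        2 * C * n ^ s ≡⟨ trans (*-comm (2 * C) (n ^ s)) (sym (*-identityʳ _)) ⟩
        n ^ s * (2 * C) * 1 ∎) (m≤m+n _ _)
      sumg : ∑ (funs s n) g ≡ # (funs (suc s) n) P?
      sumg = trans (∑-swap (funs s n) (fins n) _) (sym (∑-funs-suc s n _))
      -- `g y ^ t` counts the `t`-tuples each of whose entries completes `y`; the order of summation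
      -- is then exchanged.
      sumh : ∑ (funs s n) (λ y → g y ^ t) ≡ ∑ (funs t n) h
      sumh = trans (∑-cong (funs s n) (λ y → trans (sym (∏-const t (g y))) (trans (sym (∑-∏ t n (λ _ z → 𝟙 (P? (cons z y)))))
        (∑-cong (funs t n) (λ x → sym (𝟙-∀ (λ a → P? (cons (x a) y)) (link? x y) id id)))))) (∑-swap (funs s n) (funs t n) _)
      few : n ^ s * n ^ t ≤ n ^ s * (2 * C * ν)
      few = ≤-trans (certify 0 (+-mono-≤ (*-monoʳ-≤ 2 (powerSum (funs s n) g Γ s t (length-funs s n) (subst (λ z → n ^ suc s ≤ Γ * z) (sym sumg) dense)
                (λ y → ≤-trans (#≤length (fins n) (λ x → P? (cons x y))) (≤-reflexive (length-fins n))))) total)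
                (re₄ (n ^ s) (n ^ t) C (∑ (funs s n) (λ y → g y ^ t)) (n ^ s * (2 * C) * ν)))
              (≤-reflexive (*-assoc (n ^ s) (2 * C) ν))
        where
        re₄ : ∀ a b C w v → a * b + (2 * (C * w) + (v + b * a)) + 0 ≡ v + (2 * (a * b) + 2 * C * w)
        re₄ = solve-∀
        total : 2 * C * ∑ (funs s n) (λ y → g y ^ t) ≤ n ^ s * (2 * C) * ν + n ^ t * n ^ s
        total = begin
          2 * C * ∑ (funs s n) (λ y → g y ^ t) ≡⟨ cong (2 * C *_) sumh ⟩
          2 * C * ∑ (funs t n) h ≡⟨ sym (∑-*ˡ (funs t n) (2 * C) h) ⟩
          ∑ (funs t n) (λ x → 2 * C * h x) ≤⟨ ∑-mono (funs t n) point ⟩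
          ∑ (funs t n) (λ x → n ^ s * (2 * C) * 𝟙 (¬? (inj? x)) + n ^ s)
            ≡⟨ trans (∑-+ (funs t n) _ _) (cong₂ _+_ (∑-*ˡ (funs t n) (n ^ s * (2 * C)) _) (∑-funs-const t n (n ^ s))) ⟩
          n ^ s * (2 * C) * ν + n ^ t * n ^ s ∎

-- The relation is "spans a clique". Each part has a slot for every vertex of `J`, so `v` takes slot
-- `v` in the part of its colour. Vertices in different parts are adjacent in `G`, hence distinct.
manyCliques⇒contains : ∀ {p} s (J : Graph p) {c : Fin p → Fin s} → Colouring J s c → ∀ Γ → ∃ λ N → ∀ n → N ≤ n → (G : Graph n) →
  n ^ s ≤ Γ * hom (K s) G → ∃ (InjHom J G)
manyCliques⇒contains {p} s J {c} col Γ with denseRelation s p Γ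
... | N , dense = N , λ n N≤n G many → embed G (dense n N≤n (Hom? (K s) G) (Hom-resp (K s) G) many)
  where
  embed : ∀ {n} (G : Graph n) → (∃ λ (b : Fin s → Fin p → Fin n) → (∀ i → Inj (b i)) × (∀ χ → Hom (K s) G (λ i → b i (χ i)))) →
    ∃ (InjHom J G)
  embed {n} G (b , inj , all) = (λ v → b (c v) v) , injective , λ u v a → across u v (col u v a)
    where
    across : ∀ u v → c u ≢ c v → Adj G (b (c u) u) (b (c v) v)
    -- The transversal takes `u` in the part of `u` and slot `v` in every other part, so it passes
    -- through both vertices.
    across u v ne with all (λ i → if does (i Fin.≟ c u) then u else v) (c u) (c v) ne
    ... | a with c u Fin.≟ c u | c v Fin.≟ c u
    ... | yes _ | no _ = a
    ... | no ¬r | _ = ⊥-elim (¬r refl)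
    ... | yes _ | yes e = ⊥-elim (ne (sym e))
    injective : Inj (λ v → b (c v) v)
    injective u v e with c u Fin.≟ c v
    ... | yes same = inj (c v) u v (trans (cong (λ z → b z u) (sym same)) e)
    ... | no ne = ⊥-elim (irr G (across u v ne) e)

-- Extremal numbers, stability and losses under a near-colouring

Colourable : Graph n → ℕ → Set
Colourable G ℓ = ∃ (Colouring G ℓ)

partite : ∀ {ℓ} → (Fin n → Fin ℓ) → Graph n
partite φ = pull (K _) φ

partite-KFree : ∀ {ℓ} (φ : Fin n → Fin ℓ) → KFree ℓ (partite φ)
partite-KFree φ (f , h) = Finₚ.<⇒notInjective ≤-refl (Inj⇒ (clique-inj {G = K _} (φ ∘ f) h))

IsMax : ∀ {q} → ℕ → Graph q → ℕ → ℕ → Set₁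
IsMax ℓ R n M = (Σ (Graph n) λ G → KFree ℓ G × injHom R G ≡ M) × (∀ (G : Graph n) → KFree ℓ G → injHom R G ≤ M)

GraphStable : ∀ {q} → ℕ → Graph q → Set₁
GraphStable ℓ R = ∀ E .{{_ : NonZero E}} → ∃ λ D → NonZero D × ∃ λ N → ∀ n → N ≤ n → (G : Graph n) → KFree ℓ G →
  (∀ M → IsMax ℓ R n M → D * M ≤ D * injHom R G + M) → NearColourable E ℓ G

-- An attained value is maximal or can be improved, but which of the two holds is not decidable for
-- arbitrary `V`. The number of improvements is bounded by `fuel`.
boundedMax : ∀ {a} {V : ℕ → Set a} bound → (∀ w → V w → w ≤ bound) → ∀ fuel v → V v → bound ≤ v + fuel →
  ¬ ¬ (Σ ℕ λ M → V M × ∀ w → V w → w ≤ M)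
boundedMax bound ub zero v Vv le none = none (v , Vv , λ w Vw → ≤-trans (ub w Vw) (≤-trans le (≤-reflexive (+-identityʳ v))))
boundedMax {V = V} bound ub (suc fuel) v Vv le none = none (v , Vv , top)
  where
  top : ∀ w → V w → w ≤ v
  top w Vw with w ≤? v
  ... | yes w≤v = w≤v
  ... | no w≰v = ⊥-elim (boundedMax bound ub fuel w Vw (≤-trans le (≤-trans (≤-reflexive (+-suc v fuel)) (+-monoˡ-≤ fuel (≰⇒> w≰v)))) none)

isMax-exists : ∀ {q} ℓ (R : Graph q) n → 1 ≤ ℓ → ¬ ¬ (Σ ℕ (IsMax ℓ R n))
isMax-exists {q} (suc ℓ) R n (s≤s _) none =
  boundedMax {V = λ v → Σ (Graph n) λ G → KFree (suc ℓ) G × injHom R G ≡ v} (n ^ q)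
    (λ { w (G , _ , refl) → injHom≤ R G }) (n ^ q) _ (partite {n = n} {suc ℓ} (λ _ → zero) , partite-KFree {n = n} {suc ℓ} (λ _ → zero) , refl) (m≤n+m _ _)
    (λ { (M , attained , top) → none (M , attained , λ G free → top _ (G , free , refl)) })

-- `pull T W` is a random blow-up of `T`, and by `sampleSum` the mean number of injective copies of
-- `R` in it is `falling q n * hom R T / w ^ q`.
average : ∀ {q w n} .{{_ : NonZero w}} E c (R : Graph q) (T : Graph w) → (∀ (W : Fin n → Fin w) → E * injHom R (pull T W) ≤ c) →
  E * (falling q n * hom R T) ≤ w ^ q * c
average {q} {w} {n} E c R T bound = *-cancelˡ-≤ (w ^ n) (begin
  w ^ n * (E * (falling q n * hom R T)) ≡⟨ re₁ (w ^ n) E (falling q n) (hom R T) ⟩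
  E * (falling q n * (w ^ n * hom R T)) ≡⟨ cong (E *_) (sym (sampleSum q n w (Hom? R T) (Hom-resp R T))) ⟩
  E * (∑ (funs n w) (λ W → injHom R (pull T W)) * w ^ q) ≡⟨ sym (*-assoc E _ (w ^ q)) ⟩
  E * ∑ (funs n w) (λ W → injHom R (pull T W)) * w ^ q ≡⟨ cong (_* w ^ q) (sym (∑-*ˡ (funs n w) E _)) ⟩
  ∑ (funs n w) (λ W → E * injHom R (pull T W)) * w ^ q ≤⟨ *-monoˡ-≤ (w ^ q) (∑-mono (funs n w) bound) ⟩
  ∑ (funs n w) (λ _ → c) * w ^ q ≡⟨ cong (_* w ^ q) (∑-funs-const n w c) ⟩
  w ^ n * c * w ^ q ≡⟨ re₂ (w ^ n) c (w ^ q) ⟩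
  w ^ n * (w ^ q * c) ∎)
  where
  open ≤-Reasoning
  instance wn≢0 = m^n≢0 w n
  re₁ : ∀ x E f h → x * (E * (f * h)) ≡ E * (f * (x * h))
  re₁ = solve-∀
  re₂ : ∀ x c y → x * c * y ≡ x * (y * c)
  re₂ = solve-∀

monoLoss : ∀ {q n ℓ} .{{_ : NonZero n}} E (R : Graph q) (G : Graph n) (φ : Fin n → Fin ℓ) → E * mono G φ ≤ n * n →
  E * # (funs q n) (λ f → Hom? R G f ×-dec ¬? (Hom? R (partite φ) f)) ≤ q * (q * n ^ q)
monoLoss {q} {n} {ℓ} E R G φ near = ≤-trans
  (pairLoss {q} E 1 (mono? G φ) (≤-trans near (≤-reflexive (sym (*-identityˡ _)))) (λ f → Hom? R G f ×-dec ¬? (Hom? R (partite φ) f)) cover)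
  (≤-reflexive (cong (λ z → q * (q * z)) (*-identityˡ _)))
  where
  cover : ∀ f → Hom R G f × ¬ Hom R (partite φ) f → ∃ λ u → ∃ λ v → u ≢ v × Adj G (f u) (f v) × φ (f u) ≡ φ (f v)
  cover f (h , ¬c) with notColouring⇒ R (φ ∘ f) ¬c
  ... | u , v , a , e = u , v , irr R a , h u v a , e

colourLoss : ∀ {q n ℓ} .{{_ : NonZero n}} E (R : Graph q) (G : Graph n) (φ : Fin n → Fin ℓ) → E * mono G φ ≤ n * n →
  E * injHom R G ≤ E * injHom R (partite φ) + q * (q * n ^ q)
colourLoss {q} {n} {ℓ} E R G φ near = begin
  E * injHom R G ≤⟨ *-monoʳ-≤ E (#-⊎ (funs q n) (InjHom? R G) (InjHom? R (partite φ)) lost? split) ⟩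
  E * (injHom R (partite φ) + # (funs q n) lost?) ≡⟨ *-distribˡ-+ E _ _ ⟩
  E * injHom R (partite φ) + E * # (funs q n) lost? ≤⟨ +-monoʳ-≤ _ (monoLoss E R G φ near) ⟩
  E * injHom R (partite φ) + q * (q * n ^ q) ∎
  where
  open ≤-Reasoning
  lost? = λ (f : Fin q → Fin n) → Hom? R G f ×-dec ¬? (Hom? R (partite φ) f)
  split : ∀ f → InjHom R G f → InjHom R (partite φ) f ⊎ (Hom R G f × ¬ Hom R (partite φ) f)
  split f (i , h) with Hom? R (partite φ) f
  ... | yes c = inj₁ (i , c)
  ... | no ¬c = inj₂ (h , ¬c)

-- The union bound costs a factor `q * q`; precision better by `suc (q * q)` absorbs it, also when
-- `q = 0`.
rescale : ∀ Z q {a b y} → Z * suc (q * q) * a ≤ Z * suc (q * q) * b + q * (q * y) → Z * a ≤ Z * b + y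
rescale Z q {a} {b} {y} h = *-cancelˡ-≤ (suc (q * q)) (certify y h (re Z q a b y))
  where
  re : ∀ Z q a b y → (1 + q * q) * (Z * a) + (Z * (1 + q * q) * b + q * (q * y)) + y ≡ (1 + q * q) * (Z * b + y) + Z * (1 + q * q) * a
  re = solve-∀

mostInjective : ∀ q n .{{_ : NonZero n}} → 2 * suc (q * q) ≤ n → n ^ q ≤ 2 * falling q n
mostInjective q n big = +-cancelʳ-≤ (n ^ q) _ _ (≤-trans (≤-reflexive (re (n ^ q))) (rescale 2 q (fallingBound {q} (2 * suc (q * q)) big)))
  where
  re : ∀ x → x + x ≡ 2 * x
  re = solve-∀

-- Stability forces the counted graph to be ℓ-colourable

cone : Graph n → Graph (suc n)
cone G .Adj zero zero = ⊥
cone G .Adj zero (suc v) = ⊤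
cone G .Adj (suc u) zero = ⊤
cone G .Adj (suc u) (suc v) = Adj G u v
cone G .adj? zero zero = no id
cone G .adj? zero (suc v) = yes tt
cone G .adj? (suc u) zero = yes tt
cone G .adj? (suc u) (suc v) = adj? G u v
cone G .symm {zero} {zero} ()
cone G .symm {zero} {suc v} _ = tt
cone G .symm {suc u} {zero} _ = tt
cone G .symm {suc u} {suc v} a = symm G a
cone G .irr {zero} {zero} ()
cone G .irr {suc u} {suc v} a e = irr G a (Finₚ.suc-injective e)

-- A clique meets the apex at most once. Deleting that vertex, or any vertex if the apex is missed,
-- leaves a clique of `G`.
cone-KFree : ∀ ℓ (G : Graph n) → KFree ℓ G → KFree (suc ℓ) (cone G)
cone-KFree {n} ℓ G free (f , h) = go (Finₚ.any? (λ i → f i Fin.≟ zero))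
  where
  f-inj = clique-inj {G = cone G} f h
  below : ∀ i → (∀ j → f (Fin.punchIn i j) ≢ zero) → ⊥
  below i nz = free ((λ j → proj₁ (pre j)) , λ u v ne → subst id (cong₂ (Adj (cone G)) (proj₂ (pre u)) (proj₂ (pre v)))
      (h _ _ (λ e → ne (Finₚ.punchIn-injective i u v e))))
    where
    pos : ∀ (x : Fin (suc n)) → x ≢ zero → ∃ λ y → x ≡ suc y
    pos zero nz = ⊥-elim (nz refl)
    pos (suc y) _ = y , refl
    pre : ∀ j → ∃ λ y → f (Fin.punchIn i j) ≡ suc y
    pre j = pos _ (nz j)
  go : Dec (∃ λ i → f i ≡ zero) → ⊥
  go (yes (i , e)) = below i (λ j e' → Finₚ.punchInᵢ≢i i j (f-inj _ _ (trans e' (sym e))))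
  go (no none) = below zero (λ j e' → none (_ , e'))

cone-uncolourable : ∀ ℓ (G : Graph n) → ¬ Colourable G ℓ → ¬ Colourable (cone G) (suc ℓ)
cone-uncolourable ℓ G unc (φ , c) = unc ((λ v → Fin.punchOut (c zero (suc v) tt)) ,
  λ u v a e → c (suc u) (suc v) a (Finₚ.punchOut-injective (c zero (suc u) tt) (c zero (suc v) tt) e))

next : Fin 5 → Fin 5
next zero = suc zero
next (suc zero) = suc (suc zero)
next (suc (suc zero)) = suc (suc (suc zero))
next (suc (suc (suc zero))) = suc (suc (suc (suc zero)))
next (suc (suc (suc (suc zero)))) = zero

pentagon : Graph 5
pentagon .Adj u v = next u ≡ v ⊎ next v ≡ u
pentagon .adj? u v = (next u Fin.≟ v) ⊎-dec (next v Fin.≟ u)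
pentagon .symm = [ inj₂ , inj₁ ]′
pentagon .irr {u} (inj₁ e) refl = toWitness {a? = Finₚ.all? (λ u → ¬? (next u Fin.≟ u))} tt u e
pentagon .irr {u} (inj₂ e) refl = toWitness {a? = Finₚ.all? (λ u → ¬? (next u Fin.≟ u))} tt u e

pentagon-KFree : KFree 2 pentagon
pentagon-KFree (f , h) = toWitness {a? = Finₚ.all? (λ u → Finₚ.all? (λ v → Finₚ.all? (λ w →
    ¬? (adj? pentagon u v ×-dec (adj? pentagon v w ×-dec adj? pentagon u w)))))} tt
  (f zero) (f (suc zero)) (f (suc (suc zero))) (h _ _ (λ ()) , h _ _ (λ ()) , h _ _ (λ ()))

pentagon-uncolourable : ¬ Colourable pentagon 2
pentagon-uncolourable (φ , c) = c (suc (suc (suc (suc zero)))) zero (inj₁ refl)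
  (sym (trans (two (c zero (suc zero) (inj₁ refl)) (c (suc zero) (suc (suc zero)) (inj₁ refl)))
    (two (c (suc (suc zero)) (suc (suc (suc zero))) (inj₁ refl)) (c (suc (suc (suc zero))) (suc (suc (suc (suc zero)))) (inj₁ refl)))))
  where
  two : ∀ {a b d : Fin 2} → a ≢ b → b ≢ d → a ≡ d
  two {zero} {zero} ab _ = ⊥-elim (ab refl)
  two {zero} {suc zero} {zero} _ _ = refl
  two {zero} {suc zero} {suc zero} _ bd = ⊥-elim (bd refl)
  two {suc zero} {zero} {zero} _ bd = ⊥-elim (bd refl)
  two {suc zero} {zero} {suc zero} _ _ = refl
  two {suc zero} {suc zero} ab _ = ⊥-elim (ab refl)

-- Each cone raises the clique number and the chromatic number by one, starting from the pentagon at
-- `ℓ = 2`. For `ℓ = 1` there is no such graph.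
KFree-uncolourable : ∀ ℓ → 2 ≤ ℓ → ∃ λ w → NonZero w × Σ (Graph w) λ W → KFree ℓ W × ¬ Colourable W ℓ
KFree-uncolourable (suc (suc zero)) _ = 5 , _ , pentagon , pentagon-KFree , pentagon-uncolourable
KFree-uncolourable (suc (suc (suc ℓ))) _ with KFree-uncolourable (suc (suc ℓ)) (s≤s (s≤s z≤n))
... | w , _ , W , free , unc = suc w , _ , cone W , cone-KFree _ W free , cone-uncolourable _ W unc
KFree-uncolourable (suc zero) (s≤s ())

pull-KFree : ∀ ℓ (G : Graph n) (W : Fin m → Fin n) → KFree ℓ G → KFree ℓ (pull G W)
pull-KFree ℓ G W free (f , h) = free (W ∘ f , h)

-- Averaged over W, a blow-up of T contains a positive density of copies of T.
blowUpFar : ∀ {w n} .{{_ : NonZero w}} .{{_ : NonZero n}} (T : Graph w) → 2 * suc (w * w) ≤ n →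
  ¬ (∀ (W : Fin n → Fin w) → suc (2 * (w ^ w * (w * w))) * injHom T (pull T W) ≤ w * (w * n ^ w))
blowUpFar {w} {n} T big bound = <-irrefl refl (begin-strict
  suc e * n ^ w ≤⟨ *-monoʳ-≤ (suc e) (mostInjective w n big) ⟩
  suc e * (2 * falling w n) ≤⟨ *-monoʳ-≤ (suc e) (*-monoʳ-≤ 2 (≤-trans (≤-reflexive (sym (*-identityʳ (falling w n)))) (*-monoʳ-≤ (falling w n) one))) ⟩
  suc e * (2 * (falling w n * hom T T)) ≡⟨ re₁ (suc e) (falling w n * hom T T) ⟩
  2 * (suc e * (falling w n * hom T T)) ≤⟨ *-monoʳ-≤ 2 (average (suc e) _ T T bound) ⟩
  2 * (w ^ w * (w * (w * n ^ w))) ≡⟨ re₂ (w ^ w) w (n ^ w) ⟩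
  e * n ^ w <⟨ *-monoˡ-< (n ^ w) {{m^n≢0 n w}} (n<1+n e) ⟩
  suc e * n ^ w ∎)
  where
  open ≤-Reasoning
  e = 2 * (w ^ w * (w * w))
  re₁ : ∀ e x → e * (2 * x) ≡ 2 * (e * x)
  re₁ = solve-∀
  re₂ : ∀ x w y → 2 * (x * (w * (w * y))) ≡ 2 * (x * (w * w)) * y
  re₂ = solve-∀
  one : 1 ≤ hom T T
  one = ≤-trans (≤-reflexive (sym (𝟙-yes (Hom? T T id) (λ _ _ a → a)))) (∑-funs-≥ _ (𝟙-ext (Hom? T T) (Hom-resp T T)) id)

uncolourable-bound : ∀ {q n ℓ} .{{_ : NonZero n}} E (R : Graph q) → ¬ Colourable R ℓ → (G : Graph n) → NearColourable E ℓ G →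
  E * injHom R G ≤ q * (q * n ^ q)
uncolourable-bound {q} {n} E R unc G (φ , near) = ≤-trans (colourLoss E R G φ near)
  (≤-reflexive (cong (_+ q * (q * n ^ q)) (trans (cong (E *_) zeroHoms) (*-zeroʳ E))))
  where
  zeroHoms : injHom R (partite φ) ≡ 0
  zeroHoms = trans (∑-cong (funs q n) (λ f → 𝟙-no (InjHom? R (partite φ) f) (λ { (_ , h) → unc (φ ∘ f , h) }))) (∑-zero (funs q n))

-- Let `R` not be ℓ-colourable. If it has no `K (suc ℓ)`, its blow-ups compete for the maximum and
-- some have a positive density of copies of `R`, while an extremal graph is nearly ℓ-colourable and
-- has almost none. If it has one, the extremal number is 0 and every `K (suc ℓ)`-free graph is
-- near-extremal, among them the blow-ups of a graph from `KFree-uncolourable`, which are not all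
-- nearly ℓ-colourable.
stable⇒colourable : ∀ {q} ℓ → 2 ≤ ℓ → (R : Graph q) → GraphStable ℓ R → Colourable R ℓ
stable⇒colourable {zero} (suc ℓ) _ R stable = (λ _ → zero) , λ ()
stable⇒colourable {q@(suc _)} ℓ 2≤ℓ R stable = decidable-stable (anyFun? (Hom? R (K ℓ)) (Hom-resp R (K ℓ))) λ unc → contra unc (clique? ℓ R)
  where
  contra : ¬ Colourable R ℓ → Dec (∃ (Hom (K (suc ℓ)) R)) → ⊥
  contra unc (no free) with stable (suc (2 * (q ^ q * (q * q))))
  ... | D , D≢0 , N , near = isMax-exists ℓ R size (≤-trans (s≤s z≤n) 2≤ℓ) λ (M , (G , gfree , e) , top) →
      blowUpFar {n = size} {{_}} {{n≢0}} R (m≤n+m _ N) (λ W → ≤-trans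
        (*-monoʳ-≤ (suc (2 * (q ^ q * (q * q)))) (≤-trans (top (pull R W) (pull-KFree ℓ R W free)) (≤-reflexive (sym e))))
        (uncolourable-bound {{n≢0}} (suc (2 * (q ^ q * (q * q)))) R unc G (near size (m≤m+n N _) G gfree
          (λ { M' ((G' , free' , refl) , _) → ≤-trans (*-monoʳ-≤ D (≤-trans (top G' free') (≤-reflexive (sym e)))) (m≤m+n _ _) }))))
    where
    size = N + 2 * suc (q * q)
    n≢0 : NonZero size
    n≢0 = ℕ.>-nonZero (≤-trans (s≤s z≤n) (m≤n+m (2 * suc (q * q)) N))
  contra unc (yes (c , cl)) with KFree-uncolourable ℓ 2≤ℓ
  ... | w , w≢0 , W , free , Wunc with stable (suc (2 * (w ^ w * (w * w))))
  ... | D , D≢0 , N , near = blowUpFar {n = size} {{w≢0}} {{n≢0}} W (m≤n+m _ N) (λ Φ →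
      uncolourable-bound {{n≢0}} (suc (2 * (w ^ w * (w * w)))) W Wunc (pull W Φ)
        (near size (m≤m+n N _) (pull W Φ) (pull-KFree ℓ W Φ free)
          (λ { M ((G , gfree , refl) , _) → ≤-trans (≤-reflexive (trans (cong (D *_) (none G gfree)) (*-zeroʳ D))) z≤n })))
    where
    size = N + 2 * suc (w * w)
    n≢0 : NonZero size
    n≢0 = ℕ.>-nonZero (≤-trans (s≤s z≤n) (m≤n+m (2 * suc (w * w)) N))
    none : (G : Graph size) → KFree ℓ G → injHom R G ≡ 0
    none G gfree = trans (∑-cong (funs q size) (λ f → 𝟙-no (InjHom? R G f) (λ { (_ , h) → gfree (f ∘ c , λ u v ne → h _ _ (cl u v ne)) }))) (∑-zero (funs q size))

-- The graph-theoretic core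

isMax-unique : ∀ {q ℓ} {R : Graph q} {M M'} → IsMax ℓ R n M → IsMax ℓ R n M' → M ≡ M'
isMax-unique ((G , free , refl) , top) ((G' , free' , refl) , top') = ≤-antisym (top' G free) (top G' free')

weaken : ∀ {a b x y z} → a ≤ b → b * x ≤ b * y + z → a * x ≤ a * y + z
weaken {a} {b} {x} {y} {z} a≤b h with x ≤? y
... | yes x≤y = ≤-trans (*-monoʳ-≤ a x≤y) (m≤m+n _ z)
... | no x≰y with m≤n⇒∃[o]m+o≡n (<⇒≤ (≰⇒> x≰y))
... | d , refl = ≤-trans (≤-reflexive (*-distribˡ-+ a y d)) (+-monoʳ-≤ (a * y)
      (≤-trans (*-monoˡ-≤ d a≤b) (+-cancelˡ-≤ (b * y) _ _ (≤-trans (≤-reflexive (sym (*-distribˡ-+ b y d))) h))))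

-- M nᵠ ≈ M fₙ ≈ P fₙ ≤ mᵠ Mₓ ≈ mᵠ I ≈ mᵠ h ≈ fₘ h, each ≈ up to an error M nᵠ / Z.
chain : ∀ {Z Λ M nq fn fm mq P Mx I h} .{{_ : NonZero Λ}} →
  Z * nq ≤ Z * fn + nq → Z * M ≤ Z * P + M → fn ≤ nq → fn * P ≤ mq * Mx →
  Z * Λ * Mx ≤ Z * Λ * I + Mx → Mx ≤ nq → mq ≤ Λ * M → Z * Λ * I ≤ Z * Λ * h + nq → Z * mq ≤ Z * fm + M → h ≤ nq →
  Z * (M * nq) ≤ Z * (fm * h) + 5 * (M * nq)
chain {Z} {Λ} {M} {nq} {fn} {fm} {mq} {P} {Mx} {I} {h} e₁ e₃ fn≤ e₄ e₅ Mx≤ mq≤ e₆ e₂ h≤ = begin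
  Z * (M * nq) ≡⟨ re₁ Z M nq ⟩
  M * (Z * nq) ≤⟨ *-monoʳ-≤ M e₁ ⟩
  M * (Z * fn + nq) ≡⟨ re₂ Z M fn nq ⟩
  fn * (Z * M) + M * nq ≤⟨ +-monoˡ-≤ (M * nq) (*-monoʳ-≤ fn e₃) ⟩
  fn * (Z * P + M) + M * nq ≡⟨ re₃ fn Z P M nq ⟩
  Z * (fn * P) + M * fn + M * nq ≤⟨ +-monoˡ-≤ (M * nq) (+-mono-≤ (*-monoʳ-≤ Z e₄) (*-monoʳ-≤ M fn≤)) ⟩
  Z * (mq * Mx) + M * nq + M * nq ≤⟨ +-monoˡ-≤ (M * nq) (+-monoˡ-≤ (M * nq) s₅) ⟩
  Z * (mq * I) + M * nq + M * nq + M * nq ≤⟨ +-monoˡ-≤ (M * nq) (+-monoˡ-≤ (M * nq) (+-monoˡ-≤ (M * nq) s₆)) ⟩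
  Z * (mq * h) + M * nq + M * nq + M * nq + M * nq ≡⟨ re₄ Z mq h (M * nq) ⟩
  h * (Z * mq) + 4 * (M * nq) ≤⟨ +-monoˡ-≤ (4 * (M * nq)) (*-monoʳ-≤ h e₂) ⟩
  h * (Z * fm + M) + 4 * (M * nq) ≡⟨ re₅ h Z fm M (4 * (M * nq)) ⟩
  Z * (fm * h) + M * h + 4 * (M * nq) ≤⟨ +-monoˡ-≤ (4 * (M * nq)) (+-monoʳ-≤ (Z * (fm * h)) (*-monoʳ-≤ M h≤)) ⟩
  Z * (fm * h) + M * nq + 4 * (M * nq) ≡⟨ re₆ (Z * (fm * h)) (M * nq) ⟩
  Z * (fm * h) + 5 * (M * nq) ∎
  where
  open ≤-Reasoning
  re₁ : ∀ Z M nq → Z * (M * nq) ≡ M * (Z * nq)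
  re₁ = solve-∀
  re₂ : ∀ Z M fn nq → M * (Z * fn + nq) ≡ fn * (Z * M) + M * nq
  re₂ = solve-∀
  re₃ : ∀ fn Z P M nq → fn * (Z * P + M) + M * nq ≡ Z * (fn * P) + M * fn + M * nq
  re₃ = solve-∀
  re₄ : ∀ Z mq h u → Z * (mq * h) + u + u + u + u ≡ h * (Z * mq) + 4 * u
  re₄ = solve-∀
  re₅ : ∀ h Z fm M w → h * (Z * fm + M) + w ≡ Z * (fm * h) + M * h + w
  re₅ = solve-∀
  re₆ : ∀ x u → x + u + 4 * u ≡ x + 5 * u
  re₆ = solve-∀
  re₇ : ∀ Λ Z mq x → Λ * (Z * (mq * x)) ≡ mq * (Z * Λ * x)
  re₇ = solve-∀
  re₈ : ∀ Z Λ mq x y → mq * (Z * Λ * x + y) ≡ Λ * (Z * (mq * x)) + mq * y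
  re₈ = solve-∀
  re₉ : ∀ Λ Z mq x M nq → Λ * (Z * (mq * x)) + Λ * M * nq ≡ Λ * (Z * (mq * x) + M * nq)
  re₉ = solve-∀
  scaled : ∀ {x y e} → Z * Λ * x ≤ Z * Λ * y + e → e ≤ nq → Z * (mq * x) ≤ Z * (mq * y) + M * nq
  scaled {x} {y} {e} le e≤ = *-cancelˡ-≤ Λ (begin
    Λ * (Z * (mq * x)) ≡⟨ re₇ Λ Z mq x ⟩
    mq * (Z * Λ * x) ≤⟨ *-monoʳ-≤ mq le ⟩
    mq * (Z * Λ * y + e) ≡⟨ re₈ Z Λ mq y e ⟩
    Λ * (Z * (mq * y)) + mq * e ≤⟨ +-monoʳ-≤ (Λ * (Z * (mq * y))) (*-mono-≤ mq≤ e≤) ⟩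
    Λ * (Z * (mq * y)) + Λ * M * nq ≡⟨ re₉ Λ Z mq y M nq ⟩
    Λ * (Z * (mq * y) + M * nq) ∎)
  s₅ : Z * (mq * Mx) ≤ Z * (mq * I) + M * nq
  s₅ = scaled e₅ Mx≤
  s₆ : Z * (mq * I) ≤ Z * (mq * h) + M * nq
  s₆ = scaled e₆ ≤-refl

cancelΛ : ∀ Λ .{{_ : NonZero Λ}} {Z x y e M} → Z * Λ * x ≤ Z * Λ * y + e → e ≤ Λ * M → Z * x ≤ Z * y + M
cancelΛ Λ {Z} {x} {y} {e} {M} le e≤ = *-cancelˡ-≤ Λ (certify 0 (+-mono-≤ le e≤) (re Λ Z x y e M))
  where
  re : ∀ Λ Z x y e M → Λ * (Z * x) + (Z * Λ * y + e + Λ * M) + 0 ≡ Λ * (Z * y + M) + (Z * Λ * x + e)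
  re = solve-∀

hom≥1 : ∀ {q} (R : Graph q) (G : Graph n) → ∃ (Hom R G) → 1 ≤ hom R G
hom≥1 R G (f , h) = ≤-trans (≤-reflexive (sym (𝟙-yes (Hom? R G f) h))) (∑-funs-≥ _ (𝟙-ext (Hom? R G) (Hom-resp R G)) f)

-- Average over random ℓ-partite graphs.
maxBound : ∀ {q ℓ n} .{{_ : NonZero ℓ}} .{{_ : NonZero n}} (R : Graph q) → Colourable R ℓ → 2 * suc (q * q) ≤ n → ∀ {M} →
  (∀ (φ : Fin n → Fin ℓ) → injHom R (partite φ) ≤ M) → n ^ q ≤ 2 * ℓ ^ q * M
maxBound {q} {ℓ} {n} R col big {M} top = begin
  n ^ q ≤⟨ mostInjective q n big ⟩
  2 * falling q n ≤⟨ *-monoʳ-≤ 2 (≤-trans (≤-reflexive (sym (*-identityʳ (falling q n)))) (*-monoʳ-≤ (falling q n) (hom≥1 R (K ℓ) col))) ⟩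
  2 * (falling q n * hom R (K ℓ)) ≡⟨ cong (2 *_) (sym (*-identityˡ (falling q n * hom R (K ℓ)))) ⟩
  2 * (1 * (falling q n * hom R (K ℓ))) ≤⟨ *-monoʳ-≤ 2 (average 1 M R (K ℓ) (λ W → ≤-trans (≤-reflexive (*-identityˡ _)) (top W))) ⟩
  2 * (ℓ ^ q * M) ≡⟨ sym (*-assoc 2 (ℓ ^ q) M) ⟩
  2 * ℓ ^ q * M ∎
  where open ≤-Reasoning

positive : ∀ {a b} → 1 ≤ a * b → 1 ≤ b
positive {a} {zero} h = ⊥-elim (<-irrefl refl (≤-trans h (≤-reflexive (*-zeroʳ a))))
positive {a} {suc b} h = s≤s z≤n

-- The graph part of the argument, freed from r-graphs: `I` stands for the number of embeddings of
-- `Q` into the r-graph, `Mx` for the r-graph extremal number, and only these comparisons with them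
-- enter.
Core : ∀ {q} → ℕ → Graph q → ℕ → ℕ → ℕ → ℕ → ℕ → Set₁
Core {q} ℓ R E Δ τ Γ N = ∀ n .{{_ : NonZero n}} → N ≤ n → (G : Graph n) (I Mx : ℕ) →
  (∀ (φ : Fin n → Fin ℓ) → injHom R (partite φ) ≤ Mx) → Mx ≤ n ^ q → Δ * Mx ≤ Δ * I + Mx →
  τ * I ≤ τ * hom R G + q * (q * n ^ q) → Γ * hom (K (suc ℓ)) G ≤ n ^ suc ℓ → NearColourable E ℓ G

core : ∀ {q} ℓ → 2 ≤ ℓ → (R : Graph q) → GraphStable ℓ R → ∀ E .{{_ : NonZero E}} →
  ∃ λ Δ → NonZero Δ × ∃ λ τ → NonZero τ × ∃ λ Γ → ∃ λ N → Core ℓ R E Δ τ Γ N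
core {q} ℓ 2≤ℓ R stable E = build (colourabilityTest ℓ {{ℓ≢0}} E)
  where
  ℓ≢0 : NonZero ℓ
  ℓ≢0 = ℕ.>-nonZero (≤-trans (s≤s z≤n) 2≤ℓ)
  -- By `maxBound`, this factor converts errors measured in `n ^ q` into errors measured in the
  -- extremal number.
  Λ = 2 * ℓ ^ q
  Λ≢0 : NonZero Λ
  Λ≢0 = m*n≢0 2 _ {{_}} {{m^n≢0 ℓ q {{ℓ≢0}}}}
  c = suc (q * q)
  build : (∃ λ k → ∃ λ b → NonZero b × (∀ {n} .{{_ : NonZero n}} (G : Graph n) → ¬ NearColourable E ℓ G →
    n ^ k ≤ b * # (funs k n) (λ T → uncolourable? (pull G T) ℓ))) → _
  -- With this precision the uncolourable `k`-tuples of a near-extremal sample have density at most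
  -- `1 / (8 * b)`.
  build (k , b , b≢0 , test) = step₁ (stable (8 * b * suc (k * k)) {{m*n≢0 (8 * b) _ {{m*n≢0 8 b {{_}} {{b≢0}}}}}})
    where
    step₁ : (∃ λ D → NonZero D × ∃ λ N → ∀ n → N ≤ n → (G : Graph n) → KFree ℓ G →
      (∀ M → IsMax ℓ R n M → D * M ≤ D * injHom R G + M) → NearColourable (8 * b * suc (k * k)) ℓ G) → _
    step₁ (D , D≢0 , N₀ , near₀) = step₂ (stable (Z * Λ * c) {{m*n≢0 (Z * Λ) c {{ZΛ≢0}}}})
      where
      -- Relative to `M * n ^ q`, `sampling` yields a deficit of `6 / Z`, while the comparison in
      -- `chain` loses only `5 / Z`.
      Z = 6 * (4 * b * D)
      Z≢0 : NonZero Z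
      Z≢0 = m*n≢0 6 _ {{_}} {{m*n≢0 (4 * b) D {{m*n≢0 4 b {{_}} {{b≢0}}}} {{D≢0}}}}
      ZΛ≢0 : NonZero (Z * Λ)
      ZΛ≢0 = m*n≢0 Z Λ {{Z≢0}} {{Λ≢0}}
      step₂ : (∃ λ D → NonZero D × ∃ λ N → ∀ n → N ≤ n → (G : Graph n) → KFree ℓ G →
        (∀ M → IsMax ℓ R n M → D * M ≤ D * injHom R G + M) → NearColourable (Z * Λ * c) ℓ G) → _
      step₂ (D₁ , D₁≢0 , N₁ , near₁) =
        Z * Λ , ZΛ≢0 , Z * Λ * c , m*n≢0 (Z * Λ) c {{ZΛ≢0}} , Γ , Z * c , result
        where
        s = N₀ + (N₁ + (2 * suc (k * k) + (2 * c + Z * Λ * c)))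
        -- Makes the expected number of cliques in a sample at most `1 / (8 * b * (D + 1) * s ^ q)`.
        Γ = 8 * b * (D + 1) * s ^ q * s ^ suc ℓ
        b₁ : 2 * suc (k * k) + (2 * c + Z * Λ * c) ≤ s
        b₁ = ≤-trans (m≤n+m _ N₁) (m≤n+m _ N₀)
        k-big : 2 * suc (k * k) ≤ s
        k-big = ≤-trans (m≤m+n _ _) b₁
        q-big : 2 * c ≤ s
        q-big = ≤-trans (m≤m+n _ (Z * Λ * c)) (≤-trans (m≤n+m _ (2 * suc (k * k))) b₁)
        Z-big : Z * Λ * c ≤ s
        Z-big = ≤-trans (m≤n+m _ (2 * c)) (≤-trans (m≤n+m _ (2 * suc (k * k))) b₁)
        s≢0 : NonZero s
        s≢0 = ℕ.>-nonZero (≤-trans (s≤s z≤n) q-big)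
        result : Core ℓ R E (Z * Λ) (Z * Λ * c) Γ (Z * c)
        result n {{n≢0}} Zc≤n G I Mx partiteTop Mx≤ nearMax lost fewCliques =
          decidable-stable (nearColourable? E ℓ G) λ far → isMax-exists ℓ R s (≤-trans (s≤s z≤n) 2≤ℓ) (contra far)
          where
          instance
            _ = s≢0
            _ = b≢0
            _ = ℓ≢0
            _ = Λ≢0
          contra : ¬ NearColourable E ℓ G → Σ ℕ (IsMax ℓ R s) → ⊥
          contra far (M , isMax@((J , Jfree , eM) , top)) = <-irrefl refl (begin-strict
            Z * (M * n ^ q) ≤⟨ chain {Z} {Λ} {M} {n ^ q} {falling q n} {falling q s} {s ^ q} {hom R (partite φ)} {Mx} {I} {hom R G}
                                 (rescale Z q (fallingBound {q} (Z * c) Zc≤n)) e₃ (falling≤ q n) e₄ nearMax Mx≤ mq≤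
                                 (rescale (Z * Λ) q lost)
                                 (cancelΛ Λ {Z} {s ^ q} {falling q s} (rescale (Z * Λ) q (fallingBound {q} (Z * Λ * c) Z-big)) mq≤)
                                 (hom≤ R G) ⟩
            Z * (falling q s * hom R G) + 5 * (M * n ^ q) <⟨ +-monoʳ-< (Z * (falling q s * hom R G)) (*-monoˡ-< (M * n ^ q) {{Mn≢0}} (n<1+n 5)) ⟩
            Z * (falling q s * hom R G) + 6 * (M * n ^ q) ≡⟨ re (4 * b * D) (falling q s * hom R G) (M * n ^ q) ⟩
            6 * (4 * b * D * (falling q s * hom R G) + M * n ^ q) ≤⟨ *-monoʳ-≤ 6 sampled ⟩
            6 * (4 * b * D * (M * n ^ q)) ≡⟨ sym (*-assoc 6 (4 * b * D) _) ⟩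
            Z * (M * n ^ q) ∎)
            where
            open ≤-Reasoning
            re : ∀ x y w → 6 * x * y + 6 * w ≡ 6 * (x * y + w)
            re = solve-∀
            extremal : NearColourable (Z * Λ * c) ℓ J
            extremal = near₁ s (≤-trans (m≤m+n N₁ _) (m≤n+m _ N₀)) J Jfree
              (λ M' max' → ≤-trans (≤-reflexive (cong (D₁ *_) (trans (isMax-unique {R = R} max' isMax) (sym eM)))) (m≤m+n _ M'))
            φ = proj₁ extremal
            mq≤ : s ^ q ≤ Λ * M
            mq≤ = maxBound R (stable⇒colourable ℓ 2≤ℓ R stable) q-big (λ ψ → top (partite ψ) (partite-KFree ψ))
            1≤M : 1 ≤ M
            1≤M = positive {Λ} (≤-trans (ℕ.>-nonZero⁻¹ (s ^ q) {{m^n≢0 s q}}) mq≤)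
            Mn≢0 : NonZero (M * n ^ q)
            Mn≢0 = m*n≢0 M (n ^ q) {{ℕ.>-nonZero 1≤M}} {{m^n≢0 n q}}
            e₃ : Z * M ≤ Z * hom R (partite φ) + M
            e₃ = cancelΛ Λ {Z} {M} {hom R (partite φ)} (rescale (Z * Λ) q (≤-trans (≤-reflexive (cong (Z * Λ * c *_) (sym eM)))
              (≤-trans (colourLoss (Z * Λ * c) R J φ (proj₂ extremal))
                (+-monoˡ-≤ _ (*-monoʳ-≤ (Z * Λ * c) (#-mono (funs q s) (InjHom? R (partite φ)) (Hom? R (partite φ)) (λ _ → proj₂))))))) mq≤
            -- Random blow-ups to `n` vertices of the ℓ-partite approximation of `J` are again
            -- complete ℓ-partite, so `Mx` bounds them.
            e₄ : falling q n * hom R (partite φ) ≤ s ^ q * Mx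
            e₄ = ≤-trans (≤-reflexive (sym (*-identityˡ _))) (average 1 Mx R (partite φ) (λ W → ≤-trans (≤-reflexive (*-identityˡ _)) (partiteTop (φ ∘ W))))
            sampled : 4 * b * D * (falling q s * hom R G) + M * n ^ q ≤ 4 * b * D * (M * n ^ q)
            sampled = sampling {q} {k} {b} {s} {n} {ℓ} {D} {M} R
              (λ J' free' close → near₀ s (m≤m+n N₀ _) J' free' (λ M' max' → subst (λ z → D * z ≤ D * injHom R J' + z) (isMax-unique {R = R} isMax max') close))
              top 1≤M (≤-trans (≤-reflexive (sym eM)) (injHom≤ R J)) (mostInjective k s k-big) G (test G far) fewCliques

-- Boolean predicates

isYes⇒ : {P : Set} (d : Dec P) → ⌊ d ⌋ ≡ true → P
isYes⇒ (yes p) _ = p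

isYes⇐ : {P : Set} (d : Dec P) → P → ⌊ d ⌋ ≡ true
isYes⇐ (yes _) _ = refl
isYes⇐ (no ¬p) p = ⊥-elim (¬p p)

∧⇒ : ∀ {a b} → a Bool.∧ b ≡ true → a ≡ true × b ≡ true
∧⇒ {true} {true} _ = refl , refl

∧⇐ : ∀ {a b} → a ≡ true → b ≡ true → a Bool.∧ b ≡ true
∧⇐ refl refl = refl

∨⇒ : ∀ {a b} → a Bool.∨ b ≡ true → a ≡ true ⊎ b ≡ true
∨⇒ {true} _ = inj₁ refl
∨⇒ {false} e = inj₂ e

∨⇐ : ∀ {a b} → a ≡ true ⊎ b ≡ true → a Bool.∨ b ≡ true
∨⇐ (inj₁ refl) = refl
∨⇐ {true} (inj₂ _) = refl
∨⇐ {false} (inj₂ e) = e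

implies⇒ : ∀ {a b} → not a Bool.∨ b ≡ true → a ≡ true → b ≡ true
implies⇒ e refl = e

implies⇐ : ∀ {a b} → (a ≡ true → b ≡ true) → not a Bool.∨ b ≡ true
implies⇐ {true} h = h refl
implies⇐ {false} h = refl

iff⇒≡ : ∀ {a b} → (a ≡ true → b ≡ true) → (b ≡ true → a ≡ true) → a ≡ b
iff⇒≡ {true} {true} f g = refl
iff⇒≡ {true} {false} f g = sym (f refl)
iff⇒≡ {false} {true} f g = g refl
iff⇒≡ {false} {false} f g = refl

allFin⇒ : ∀ {k} {P : Fin k → Bool} → allFin P ≡ true → ∀ i → P i ≡ true
allFin⇒ e zero = proj₁ (∧⇒ e)
allFin⇒ e (suc i) = allFin⇒ (proj₂ (∧⇒ e)) i

allFin⇐ : ∀ {k} {P : Fin k → Bool} → (∀ i → P i ≡ true) → allFin P ≡ true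
allFin⇐ {zero} h = refl
allFin⇐ {suc k} h = ∧⇐ (h zero) (allFin⇐ (h ∘ suc))

anyFin⇒ : ∀ {k} {P : Fin k → Bool} → anyFin P ≡ true → ∃ λ i → P i ≡ true
anyFin⇒ {suc k} e with ∨⇒ e
... | inj₁ p = zero , p
... | inj₂ q with anyFin⇒ q
... | i , p = suc i , p

anyFin⇐ : ∀ {k} {P : Fin k → Bool} i → P i ≡ true → anyFin P ≡ true
anyFin⇐ zero p = ∨⇐ (inj₁ p)
anyFin⇐ {P = P} (suc i) p = ∨⇐ {P zero} (inj₂ (anyFin⇐ i p))

allSub⇒ : ∀ {n} {P : Subset n → Bool} → allSub P ≡ true → ∀ s → P s ≡ true
allSub⇒ e [] = e
allSub⇒ e (true ∷ s) = allSub⇒ (proj₁ (∧⇒ e)) s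
allSub⇒ e (false ∷ s) = allSub⇒ (proj₂ (∧⇒ e)) s

allSub⇐ : ∀ {n} {P : Subset n → Bool} → (∀ s → P s ≡ true) → allSub P ≡ true
allSub⇐ {zero} h = h []
allSub⇐ {suc n} h = ∧⇐ (allSub⇐ (λ s → h (true ∷ s))) (allSub⇐ (λ s → h (false ∷ s)))

anySub⇒ : ∀ {n} {P : Subset n → Bool} → anySub P ≡ true → ∃ λ s → P s ≡ true
anySub⇒ {zero} e = [] , e
anySub⇒ {suc n} e with ∨⇒ e
... | inj₁ p with anySub⇒ p
...   | s , q = true ∷ s , q
anySub⇒ {suc n} e | inj₂ p with anySub⇒ p
...   | s , q = false ∷ s , q

anySub⇐ : ∀ {n} {P : Subset n → Bool} s → P s ≡ true → anySub P ≡ true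
anySub⇐ [] p = p
anySub⇐ (true ∷ s) p = ∨⇐ (inj₁ (anySub⇐ s p))
anySub⇐ {suc n} {P} (false ∷ s) p = ∨⇐ {anySub (λ t → P (true ∷ t))} (inj₂ (anySub⇐ s p))

isEdge⇒ : ∀ {n} r (H : RGraph n) s → isEdge r H s ≡ true → ∣ s ∣ ≡ r × H s ≡ true
isEdge⇒ r H s e with ∧⇒ e
... | a , b = isYes⇒ (∣ s ∣ ℕ.≟ r) a , b

isEdge⇐ : ∀ {n} r (H : RGraph n) s → ∣ s ∣ ≡ r → H s ≡ true → isEdge r H s ≡ true
isEdge⇐ r H s e h = ∧⇐ (isYes⇐ (∣ s ∣ ℕ.≟ r) e) h

subset-ext : (s t : Subset n) → (∀ i → lookup s i ≡ true → lookup t i ≡ true) → (∀ i → lookup t i ≡ true → lookup s i ≡ true) → s ≡ t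
subset-ext s t f g = trans (sym (Vecₚ.tabulate∘lookup s)) (trans (Vecₚ.tabulate-cong (λ i → iff⇒≡ (f i) (g i))) (Vecₚ.tabulate∘lookup t))

-- Tuples enumerating subsets

Enumerates : (Fin k → Fin n) → Subset n → Set
Enumerates g s = (∀ i → lookup s (g i) ≡ true) × (∀ j → lookup s j ≡ true → ∃ λ i → g i ≡ j)

enumerate : (s : Subset n) → ∃ λ (g : Fin ∣ s ∣ → Fin n) → Inj g × Enumerates g s
enumerate [] = (λ ()) , (λ ()) , (λ ()) , λ ()
enumerate (true ∷ s) with enumerate s
... | g , i , sound , complete′ = (λ { zero → zero ; (suc j) → suc (g j) }) ,
  (λ { zero zero _ → refl ; (suc a) (suc b) e → cong suc (i a b (Finₚ.suc-injective e)) }) ,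
  (λ { zero → refl ; (suc j) → sound j }) ,
  λ { zero _ → zero , refl ; (suc j) h → suc (proj₁ (complete′ j h)) , cong suc (proj₂ (complete′ j h)) }
enumerate (false ∷ s) with enumerate s
... | g , i , sound , complete′ = (λ j → suc (g j)) , (λ a b e → i a b (Finₚ.suc-injective e)) , sound ,
  λ { zero () ; (suc j) h → proj₁ (complete′ j h) , cong suc (proj₂ (complete′ j h)) }

factor-≤ : ∀ {a b} {f : Fin a → Fin n} (g : Fin b → Fin n) → Inj f → (∀ i → ∃ λ j → g j ≡ f i) → a ≤ b
factor-≤ g i h = Finₚ.injective⇒≤ {f = λ x → proj₁ (h x)} (λ {x} {y} e → i x y (trans (sym (proj₂ (h x))) (trans (cong g e) (proj₂ (h y)))))

enumerates-size : ∀ {g : Fin k → Fin n} (s : Subset n) → Inj g → Enumerates g s → ∣ s ∣ ≡ k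
enumerates-size {g = g} s i (sound , complete′) with enumerate s
... | h , i' , sound' , complete″ = ≤-antisym
  (factor-≤ g i' (λ x → complete′ _ (sound' x))) (factor-≤ h i (λ x → complete″ _ (sound x)))

im : (Fin k → Fin n) → Subset n
im g = tabulate (λ j → ⌊ Finₚ.any? (λ i → g i Fin.≟ j) ⌋)

∈im⇒ : (g : Fin k → Fin n) → ∀ {j} → lookup (im g) j ≡ true → ∃ λ i → g i ≡ j
∈im⇒ g {j} e = isYes⇒ (Finₚ.any? (λ i → g i Fin.≟ j)) (trans (sym (Vecₚ.lookup∘tabulate _ j)) e)

∈im⇐ : (g : Fin k → Fin n) → ∀ i → lookup (im g) (g i) ≡ true
∈im⇐ g i = trans (Vecₚ.lookup∘tabulate _ (g i)) (isYes⇐ (Finₚ.any? (λ j → g j Fin.≟ g i)) (i , refl))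

im-enumerates : (g : Fin k → Fin n) → Enumerates g (im g)
im-enumerates g = ∈im⇐ g , λ j → ∈im⇒ g

enumerates-im : (g : Fin k → Fin n) {s : Subset n} → Enumerates g s → im g ≡ s
enumerates-im g {s} (sound , complete′) = subset-ext (im g) s
  (λ j e → subst (λ z → lookup s z ≡ true) (proj₂ (∈im⇒ g e)) (sound _))
  (λ j e → subst (λ z → lookup (im g) z ≡ true) (proj₂ (complete′ j e)) (∈im⇐ g _))

im-cong : ∀ {a b} (f : Fin a → Fin n) (g : Fin b → Fin n) → (∀ i → ∃ λ j → g j ≡ f i) → (∀ j → ∃ λ i → f i ≡ g j) → im f ≡ im g
im-cong f g h h' = enumerates-im f ((λ i → subst (λ z → lookup (im g) z ≡ true) (proj₂ (h i)) (∈im⇐ g _)) ,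
  λ j e → let (i , p) = ∈im⇒ g e in proj₁ (h' i) , trans (proj₂ (h' i)) p)

im-≗ : {f g : Fin k → Fin n} → f ≗ g → im f ≡ im g
im-≗ {f = f} {g} e = im-cong f g (λ i → i , sym (e i)) (λ i → i , e i)

image⇒ : (f : Fin m → Fin n) (s : Subset m) → ∀ {j} → lookup (image f s) j ≡ true → ∃ λ i → lookup s i ≡ true × f i ≡ j
image⇒ f s {j} e with anyFin⇒ (trans (sym (Vecₚ.lookup∘tabulate _ j)) e)
... | i , p = i , proj₁ (∧⇒ p) , isYes⇒ (f i Fin.≟ j) (proj₂ (∧⇒ p))

image⇐ : (f : Fin m → Fin n) (s : Subset m) → ∀ i → lookup s i ≡ true → lookup (image f s) (f i) ≡ true
image⇐ f s i p = trans (Vecₚ.lookup∘tabulate _ (f i)) (anyFin⇐ i (∧⇐ p (isYes⇐ (f i Fin.≟ f i) refl)))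

image-im : ∀ {k} (f : Fin m → Fin n) (g : Fin k → Fin m) → im (f ∘ g) ≡ image f (im g)
image-im f g = enumerates-im (f ∘ g) ((λ i → image⇐ f (im g) (g i) (∈im⇐ g i)) ,
  λ j e → let (x , p , q) = image⇒ f (im g) e ; (i , r) = ∈im⇒ g p in i , trans (cong f r) q)

-- Edges become injective tuples, so that sums over `funs` count them. No size is recorded, as an
-- injective `k`-tuple has an image of size `k`.
EdgeT : RGraph n → (Fin k → Fin n) → Set
EdgeT H z = Inj z × H (im z) ≡ true

edgeT? : (H : RGraph n) (z : Fin k → Fin n) → Dec (EdgeT H z)
edgeT? H z = inj? z ×-dec (H (im z) Bool.≟ true)

edgeT-resp : (H : RGraph n) → Resp (EdgeT {k = k} H)
edgeT-resp H e (i , h) = Inj-resp e i , subst (λ s → H s ≡ true) (im-≗ e) h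

edge⇒tuple : ∀ r (H : RGraph n) s → isEdge r H s ≡ true → ∃ λ (z : Fin r → Fin n) → EdgeT H z × im z ≡ s
edge⇒tuple r H s e with isEdge⇒ r H s e
... | refl , h with enumerate s
... | g , i , en = g , (i , subst (λ t → H t ≡ true) (sym (enumerates-im g en)) h) , enumerates-im g en

tuple⇒edge : ∀ r (H : RGraph n) (z : Fin r → Fin n) → EdgeT H z → isEdge r H (im z) ≡ true
tuple⇒edge r H z (i , h) = isEdge⇐ r H (im z) (enumerates-size (im z) i (im-enumerates z)) h

HomT : ℕ → RGraph m → RGraph n → (Fin m → Fin n) → Set
HomT {m} r Q H f = ∀ (z : Fin r → Fin m) → EdgeT Q z → EdgeT H (f ∘ z)

InjPres : ℕ → RGraph m → RGraph n → (Fin m → Fin n) → Set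
InjPres r Q H f = (injB f Bool.∧ presB r Q H f) ≡ true

injB⇒ : (f : Fin m → Fin n) → injB f ≡ true → Inj f
injB⇒ f e i j p = isYes⇒ (i Fin.≟ j) (implies⇒ (allFin⇒ (allFin⇒ e i) j) (isYes⇐ (f i Fin.≟ f j) p))

injB⇐ : (f : Fin m → Fin n) → Inj f → injB f ≡ true
injB⇐ f h = allFin⇐ (λ i → allFin⇐ (λ j → implies⇐ (λ p → isYes⇐ (i Fin.≟ j) (h i j (isYes⇒ (f i Fin.≟ f j) p)))))

injPres⇒ : ∀ r (Q : RGraph m) (H : RGraph n) f → InjPres r Q H f → Inj f × HomT r Q H f
injPres⇒ r Q H f e with ∧⇒ e
... | a , b = injB⇒ f a , λ z ez → (λ i j p → proj₁ ez i j (injB⇒ f a _ _ p)) ,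
  proj₂ (isEdge⇒ r H _ (subst (λ s → isEdge r H s ≡ true) (sym (image-im f z)) (implies⇒ (allSub⇒ b (im z)) (tuple⇒edge r Q z ez))))

injPres⇐ : ∀ r (Q : RGraph m) (H : RGraph n) f → Inj f → HomT r Q H f → InjPres r Q H f
injPres⇐ r Q H f i h = ∧⇐ (injB⇐ f i) (allSub⇐ (λ e → implies⇐ (pres e)))
  where
  pres : ∀ e → isEdge r Q e ≡ true → isEdge r H (image f e) ≡ true
  pres e isE with edge⇒tuple r Q e isE
  ... | z , ez , refl = subst (λ s → isEdge r H s ≡ true) (image-im f z) (tuple⇒edge r H (f ∘ z) (h z ez))

homT-resp : ∀ r (Q : RGraph m) (H : RGraph n) → Resp (HomT r Q H)
homT-resp r Q H e h z ez = edgeT-resp H (λ i → e (z i)) (h z ez)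

injPres-resp : ∀ r (Q : RGraph m) (H : RGraph n) → Resp (InjPres r Q H)
injPres-resp r Q H e p with injPres⇒ r Q H _ p
... | i , h = injPres⇐ r Q H _ (Inj-resp e i) (homT-resp r Q H e h)

injPres? : ∀ r (Q : RGraph m) (H : RGraph n) f → Dec (InjPres r Q H f)
injPres? r Q H f = (injB f Bool.∧ presB r Q H f) Bool.≟ true

-- Counting by sums

sumFin-∑ : ∀ {k} (f : Fin k → ℕ) → sumFin f ≡ ∑ (fins k) f
sumFin-∑ {zero} f = refl
sumFin-∑ {suc k} f = trans (cong (f zero +_) (sumFin-∑ (f ∘ suc))) (sym (∑-fins-suc k f))

if-𝟙 : ∀ b → (if b then 1 else 0) ≡ 𝟙 (b Bool.≟ true)
if-𝟙 true = refl
if-𝟙 false = refl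

sumFin-cong : ∀ {k} {f g : Fin k → ℕ} → (∀ i → f i ≡ g i) → sumFin f ≡ sumFin g
sumFin-cong {zero} h = refl
sumFin-cong {suc k} h = cong₂ _+_ (h zero) (sumFin-cong (h ∘ suc))

countFun-# : ∀ m n (P : (Fin m → Fin n) → Bool) → Ext P → countFun P ≡ # (funs m n) (λ f → P f Bool.≟ true)
countFun-# zero n P ext = trans (if-𝟙 (P _)) (trans (cong (λ b → 𝟙 (b Bool.≟ true)) (ext (λ ()))) (sym (+-identityʳ _)))
countFun-# (suc m) n P ext = trans
  (sumFin-cong (λ j → countFun-# m n (λ g → P (cons j g)) (λ e → ext (λ { zero → refl ; (suc i) → e i }))))
  (trans (sumFin-∑ (λ j → # (funs m n) (λ g → P (cons j g) Bool.≟ true))) (sym (∑-funs-suc m n _)))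

inj-# : ∀ r (Q : RGraph m) (H : RGraph n) → inj r Q H ≡ # (funs m n) (injPres? r Q H)
inj-# {m} {n} r Q H = countFun-# m n (λ f → injB f Bool.∧ presB r Q H f)
  (λ e → iff⇒≡ (injPres-resp r Q H e) (injPres-resp r Q H (λ i → sym (e i))))

countSub-# : ∀ n (P : Subset n → Bool) → countSub P ≡ # (allSubsets n) (λ s → P s Bool.≟ true)
countSub-# zero P = trans (if-𝟙 (P [])) (sym (+-identityʳ _))
countSub-# (suc n) P = trans (cong₂ _+_ (countSub-# n (λ s → P (true ∷ s))) (countSub-# n (λ s → P (false ∷ s))))
  (sym (trans (∑-++ (map (true ∷_) (allSubsets n)) _ _) (cong₂ _+_ (∑-map (true ∷_) (allSubsets n) _) (∑-map (false ∷_) (allSubsets n) _))))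

_≟ˢ_ : (s t : Subset n) → Dec (s ≡ t)
_≟ˢ_ = Vecₚ.≡-dec Bool._≟_

∷-𝟙 : ∀ b (s t : Subset n) → 𝟙 ((b ∷ s) ≟ˢ (b ∷ t)) ≡ 𝟙 (s ≟ˢ t)
∷-𝟙 b s t = 𝟙-cong ((b ∷ s) ≟ˢ (b ∷ t)) (s ≟ˢ t) Vecₚ.∷-injectiveʳ (cong (b ∷_))

∑-subsets-unique : (t : Subset n) → # (allSubsets n) (λ s → s ≟ˢ t) ≡ 1
∑-subsets-unique [] = refl
∑-subsets-unique {suc n} (b ∷ t) = trans (∑-++ (map (true ∷_) (allSubsets n)) _ _)
  (trans (cong₂ _+_ (∑-map (true ∷_) (allSubsets n) _) (∑-map (false ∷_) (allSubsets n) _)) (go b))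
  where
  same : ∀ b → # (allSubsets n) (λ s → (b ∷ s) ≟ˢ (b ∷ t)) ≡ 1
  same b = trans (∑-cong (allSubsets n) (λ s → ∷-𝟙 b s t)) (∑-subsets-unique t)
  other : ∀ a b → a ≢ b → # (allSubsets n) (λ s → (a ∷ s) ≟ˢ (b ∷ t)) ≡ 0
  other a b ne = trans (∑-cong (allSubsets n) (λ s → 𝟙-no ((a ∷ s) ≟ˢ (b ∷ t)) (λ e → ne (Vecₚ.∷-injectiveˡ e)))) (∑-zero (allSubsets n))
  go : ∀ b → # (allSubsets n) (λ s → (true ∷ s) ≟ˢ (b ∷ t)) + # (allSubsets n) (λ s → (false ∷ s) ≟ˢ (b ∷ t)) ≡ 1
  go true = cong₂ _+_ (same true) (other false true (λ ()))
  go false = cong₂ _+_ (other true false (λ ())) (same false)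

-- Every selected set is the image of at least one tuple and a tuple has only one image;
-- multiplicities are dropped.
countSub-≤ : ∀ r (P : Subset n → Bool) {X : (Fin r → Fin n) → Set} (X? : ∀ z → Dec (X z)) → Resp X →
  (∀ s → P s ≡ true → ∃ λ z → X z × im z ≡ s) → countSub P ≤ # (funs r n) X?
countSub-≤ {n} r P {X} X? resp cover = begin
  countSub P ≡⟨ countSub-# n P ⟩
  # (allSubsets n) (λ s → P s Bool.≟ true) ≤⟨ ∑-mono (allSubsets n) point ⟩
  ∑ (allSubsets n) (λ s → ∑ (funs r n) (λ z → 𝟙 (s ≟ˢ im z) * 𝟙 (X? z))) ≡⟨ ∑-swap (allSubsets n) (funs r n) _ ⟩
  ∑ (funs r n) (λ z → ∑ (allSubsets n) (λ s → 𝟙 (s ≟ˢ im z) * 𝟙 (X? z)))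
    ≡⟨ ∑-cong (funs r n) (λ z → trans (∑-*ʳ (allSubsets n) (𝟙 (X? z)) (λ s → 𝟙 (s ≟ˢ im z))) (trans (cong (_* 𝟙 (X? z)) (∑-subsets-unique (im z))) (*-identityˡ _))) ⟩
  # (funs r n) X? ∎
  where
  open ≤-Reasoning
  hit? : ∀ s z → Dec (s ≡ im z × X z)
  hit? s z = (s ≟ˢ im z) ×-dec X? z
  hit-resp : ∀ s → Resp (λ z → s ≡ im z × X z)
  hit-resp s e (p , x) = trans p (im-≗ e) , resp e x
  point : ∀ s → 𝟙 (P s Bool.≟ true) ≤ ∑ (funs r n) (λ z → 𝟙 (s ≟ˢ im z) * 𝟙 (X? z))
  point s with P s Bool.≟ true
  ... | no _ = z≤n
  ... | yes p with cover s p
  ...   | z , x , e = ≤-trans (≤-reflexive (sym (𝟙-yes (hit? s z) (sym e , x))))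
          (≤-trans (∑-funs-≥ _ (𝟙-ext (hit? s) (hit-resp s)) z)
            (≤-reflexive (∑-cong (funs r n) (λ z → 𝟙-× (hit? s z) (s ≟ˢ im z) (X? z) _,_ id))))

-- Tuples with a given image of size `r` take values in an `r`-set, which leaves at most `r ^ r` of
-- them; against `r!` only a constant is lost.
#tuples-≤ : ∀ r (P : Subset n → Bool) {X : (Fin r → Fin n) → Set} (X? : ∀ z → Dec (X z)) →
  (∀ z → X z → P (im z) ≡ true × Inj z) → # (funs r n) X? ≤ r ^ r * countSub P
#tuples-≤ {n} r P {X} X? cover = begin
  # (funs r n) X? ≡⟨ ∑-cong (funs r n) (λ z → sym (trans (∑-*ʳ (allSubsets n) (𝟙 (X? z)) (λ s → 𝟙 (s ≟ˢ im z))) (trans (cong (_* 𝟙 (X? z)) (∑-subsets-unique (im z))) (*-identityˡ _)))) ⟩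
  ∑ (funs r n) (λ z → ∑ (allSubsets n) (λ s → 𝟙 (s ≟ˢ im z) * 𝟙 (X? z))) ≡⟨ sym (∑-swap (allSubsets n) (funs r n) _) ⟩
  ∑ (allSubsets n) (λ s → ∑ (funs r n) (λ z → 𝟙 (s ≟ˢ im z) * 𝟙 (X? z))) ≤⟨ ∑-mono (allSubsets n) point ⟩
  ∑ (allSubsets n) (λ s → r ^ r * 𝟙 (P s Bool.≟ true)) ≡⟨ trans (∑-*ˡ (allSubsets n) (r ^ r) _) (cong (r ^ r *_) (sym (countSub-# n P))) ⟩
  r ^ r * countSub P ∎
  where
  open ≤-Reasoning
  size-∑ : ∀ {n} (s : Subset n) → # (fins n) (λ i → lookup s i Bool.≟ true) ≡ ∣ s ∣
  size-∑ [] = refl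
  size-∑ {suc n} (true ∷ s) = trans (∑-fins-suc n (λ i → 𝟙 (lookup (true ∷ s) i Bool.≟ true))) (cong suc (size-∑ s))
  size-∑ {suc n} (false ∷ s) = trans (∑-fins-suc n (λ i → 𝟙 (lookup (false ∷ s) i Bool.≟ true))) (size-∑ s)
  point : ∀ s → ∑ (funs r n) (λ z → 𝟙 (s ≟ˢ im z) * 𝟙 (X? z)) ≤ r ^ r * 𝟙 (P s Bool.≟ true)
  point s = ≤-trans (≤-reflexive (∑-cong (funs r n) (λ z → sym (𝟙-× ((s ≟ˢ im z) ×-dec X? z) (s ≟ˢ im z) (X? z) _,_ id)))) (main (P s Bool.≟ true) (∣ s ∣ ℕ.≟ r))
    where
    main : (d : Dec (P s ≡ true)) → Dec (∣ s ∣ ≡ r) → # (funs r n) (λ z → (s ≟ˢ im z) ×-dec X? z) ≤ r ^ r * 𝟙 d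
    main (no ¬p) _ = ≤-trans (≤-reflexive (trans (∑-cong (funs r n) (λ z → 𝟙-no ((s ≟ˢ im z) ×-dec X? z) (λ { (refl , x) → ¬p (proj₁ (cover z x)) }))) (∑-zero (funs r n)))) z≤n
    main (yes p) (no ne) = ≤-trans (≤-reflexive (trans (∑-cong (funs r n) (λ z → 𝟙-no ((s ≟ˢ im z) ×-dec X? z) (λ { (refl , x) → ne (enumerates-size (im z) (proj₂ (cover z x)) (im-enumerates z)) }))) (∑-zero (funs r n)))) z≤n
    main (yes p) (yes e) = begin
      # (funs r n) (λ z → (s ≟ˢ im z) ×-dec X? z)
        ≤⟨ #-mono (funs r n) (λ z → (s ≟ˢ im z) ×-dec X? z) inside? (λ { z (refl , _) i → ∈im⇐ z i }) ⟩
      # (funs r n) inside? ≡⟨ ∑-cong (funs r n) (λ z → 𝟙-∀ (λ i → lookup s (z i) Bool.≟ true) (inside? z) id id) ⟩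
      ∑ (funs r n) (λ z → ∏ r (λ i → 𝟙 (lookup s (z i) Bool.≟ true))) ≡⟨ ∑-∏ r n (λ _ y → 𝟙 (lookup s y Bool.≟ true)) ⟩
      ∏ r (λ _ → # (fins n) (λ y → lookup s y Bool.≟ true)) ≡⟨ trans (∏-const r _) (cong (_^ r) (trans (size-∑ s) e)) ⟩
      r ^ r ≡⟨ sym (*-identityʳ _) ⟩
      r ^ r * 1 ∎
      where
      inside? : ∀ z → Dec (∀ i → lookup s (z i) ≡ true)
      inside? z = Finₚ.all? (λ i → lookup s (z i) Bool.≟ true)

-- Permutations

transpose-left : ∀ {n} (i j : Fin n) → PC.transpose i j i ≡ j
transpose-left i j with i Fin.≟ i
... | yes _ = refl
... | no ne = ⊥-elim (ne refl)

transpose-other : ∀ {n} {i j k : Fin n} → k ≢ i → k ≢ j → PC.transpose i j k ≡ k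
transpose-other {i = i} {j} {k} ki kj with k Fin.≟ i
... | yes e = ⊥-elim (ki e)
... | no _ with k Fin.≟ j
... | yes e = ⊥-elim (kj e)
... | no _ = refl

perm-injective : ∀ {n} (π : Permutation′ n) → Inj (π ⟨$⟩ʳ_)
perm-injective π i j e = trans (sym (Perm.inverseˡ π)) (trans (cong (π ⟨$⟩ˡ_) e) (Perm.inverseˡ π))

-- The assignments are realised one at a time: a transposition corrects the new value and, by
-- injectivity, moves none of those already in place.
extendPerm : ∀ {k n} (a b : Fin k → Fin n) → Inj a → Inj b → Σ (Permutation′ n) λ π → ∀ i → π ⟨$⟩ʳ a i ≡ b i
extendPerm {zero} a b _ _ = Perm.id , λ ()
extendPerm {suc k} a b ia ib with extendPerm (a ∘ suc) (b ∘ suc) (λ i j e → Finₚ.suc-injective (ia _ _ e)) (λ i j e → Finₚ.suc-injective (ib _ _ e))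
... | π , h = π Perm.∘ₚ Perm.transpose (π ⟨$⟩ʳ a zero) (b zero) ,
  λ { zero → transpose-left (π ⟨$⟩ʳ a zero) (b zero)
    ; (suc i) → trans (cong (PC.transpose (π ⟨$⟩ʳ a zero) (b zero)) (h i))
        (transpose-other (λ e → Finₚ.0≢1+n (sym (ia _ _ (perm-injective π _ _ (trans (h i) e))))) (λ e → Finₚ.0≢1+n (sym (ib _ _ e)))) }

injective⇒permutation : ∀ {n} (σ : Fin n → Fin n) → Inj σ → Σ (Permutation′ n) λ π → ∀ i → π ⟨$⟩ʳ i ≡ σ i
injective⇒permutation σ i = extendPerm id σ (λ _ _ e → e) i

edgeT-perm : (H : RGraph n) (z : Fin k → Fin n) (π : Permutation′ k) → EdgeT H z → EdgeT H (λ i → z (π ⟨$⟩ʳ i))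
edgeT-perm H z π (i , h) = (λ a b e → perm-injective π a b (i _ _ e)) ,
  subst (λ s → H s ≡ true) (im-cong z (λ i → z (π ⟨$⟩ʳ i)) (λ j → π ⟨$⟩ˡ j , cong z (Perm.inverseʳ π)) (λ j → π ⟨$⟩ʳ j , refl)) h

-- Rational parameters

ℕtoℚᵘ : ∀ m → ℚ.toℚᵘ (ℕtoℚ m) ℚᵘ.≃ ℚᵘ.mkℚᵘ (ℤ.+ m) 0
ℕtoℚᵘ m = ℚₚ.toℚᵘ-fromℚᵘ (ℚᵘ.mkℚᵘ (ℤ.+ m) 0)

ℕtoℚ-mono : ∀ {a b} → a ≤ b → ℕtoℚ a ℚ.≤ ℕtoℚ b
ℕtoℚ-mono {a} {b} a≤b = ℚₚ.toℚᵘ-cancel-≤ (ℚᵘₚ.≤-respˡ-≃ (ℚᵘₚ.≃-sym (ℕtoℚᵘ a)) (ℚᵘₚ.≤-respʳ-≃ (ℚᵘₚ.≃-sym (ℕtoℚᵘ b))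
  (ℚᵘ.*≤* (ℤₚ.*-monoʳ-≤-nonNeg (ℤ.+ 1) (ℤ.+≤+ a≤b)))))

ℕtoℚ-cancel : ∀ {a b} → ℕtoℚ a ℚ.≤ ℕtoℚ b → a ≤ b
ℕtoℚ-cancel {a} {b} h with ℚᵘₚ.≤-respˡ-≃ (ℕtoℚᵘ a) (ℚᵘₚ.≤-respʳ-≃ (ℕtoℚᵘ b) (ℚₚ.toℚᵘ-mono-≤ h))
... | ℚᵘ.*≤* le = ℤₚ.drop‿+≤+ (ℤₚ.*-cancelʳ-≤-pos (ℤ.+ a) (ℤ.+ b) (ℤ.+ 1) le)

ℕtoℚ-* : ∀ a b → ℕtoℚ (a * b) ≡ ℕtoℚ a ℚ.* ℕtoℚ b
ℕtoℚ-* a b = ℚₚ.toℚᵘ-injective (ℚᵘₚ.≃-trans (ℕtoℚᵘ (a * b)) (ℚᵘₚ.≃-trans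
  (ℚᵘ.*≡* (cong (ℤ._* (ℤ.+ 1)) (ℤₚ.pos-* a b)))
  (ℚᵘₚ.≃-sym (ℚᵘₚ.≃-trans (ℚₚ.toℚᵘ-homo-* (ℕtoℚ a) (ℕtoℚ b)) (ℚᵘₚ.*-cong (ℕtoℚᵘ a) (ℕtoℚᵘ b))))))

ℕtoℚ-+ : ∀ a b → ℕtoℚ (a + b) ≡ ℕtoℚ a ℚ.+ ℕtoℚ b
ℕtoℚ-+ a b = ℚₚ.toℚᵘ-injective (ℚᵘₚ.≃-trans (ℕtoℚᵘ (a + b)) (ℚᵘₚ.≃-trans
  (ℚᵘ.*≡* (cong (ℤ._* (ℤ.+ 1)) (trans (ℤₚ.pos-+ a b) (sym (cong₂ ℤ._+_ (ℤₚ.*-identityʳ (ℤ.+ a)) (ℤₚ.*-identityʳ (ℤ.+ b)))))))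
  (ℚᵘₚ.≃-sym (ℚᵘₚ.≃-trans (ℚₚ.toℚᵘ-homo-+ (ℕtoℚ a) (ℕtoℚ b)) (ℚᵘₚ.+-cong (ℕtoℚᵘ a) (ℕtoℚᵘ b))))))

reciprocal : (E : ℕ) .{{_ : NonZero E}} → ℚ
reciprocal E = (ℤ.+ 1) ℚ./ E

reciprocalᵘ : ∀ d → ℚ.toℚᵘ (reciprocal (suc d)) ℚᵘ.≃ ℚᵘ.mkℚᵘ (ℤ.+ 1) d
reciprocalᵘ d = ℚₚ.toℚᵘ-fromℚᵘ (ℚᵘ.mkℚᵘ (ℤ.+ 1) d)

reciprocal-pos : ∀ E .{{_ : NonZero E}} → 0ℚ ℚ.< reciprocal E
reciprocal-pos E = ℚₚ.positive⁻¹ (reciprocal E) {{ℚₚ.normalize-pos 1 E}}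

reciprocal-*ˡ : ∀ E .{{_ : NonZero E}} → ℕtoℚ E ℚ.* reciprocal E ≡ 1ℚ
reciprocal-*ˡ (suc d) = ℚₚ.toℚᵘ-injective (ℚᵘₚ.≃-trans (ℚₚ.toℚᵘ-homo-* (ℕtoℚ (suc d)) (reciprocal (suc d)))
  (ℚᵘₚ.≃-trans (ℚᵘₚ.*-cong (ℕtoℚᵘ (suc d)) (reciprocalᵘ d))
    (ℚᵘ.*≡* (trans (ℤₚ.*-identityʳ _) (trans (ℤₚ.*-identityʳ (ℤ.+ suc d)) (sym (trans (ℤₚ.*-identityˡ _) (cong ℤ.+_ (+-identityʳ (suc d))))))))))

-- The denominator of `ε` serves, its numerator being at least 1.
archimedean : ∀ ε → 0ℚ ℚ.< ε → ∃ λ E → Σ (NonZero E) λ nz → reciprocal E {{nz}} ℚ.≤ ε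
archimedean (ℚ.mkℚ ℤ.+[1+ k ] d c) _ = suc d , _ , ℚₚ.toℚᵘ-cancel-≤ (ℚᵘₚ.≤-respˡ-≃ (ℚᵘₚ.≃-sym (reciprocalᵘ d))
  (ℚᵘ.*≤* (ℤₚ.*-monoʳ-≤-nonNeg (ℤ.+ suc d) (ℤ.+≤+ (s≤s (z≤n {k}))))))
archimedean (ℚ.mkℚ (ℤ.+ 0) d c) (ℚ.*<* (ℤ.+<+ ()))
archimedean (ℚ.mkℚ ℤ.-[1+ k ] d c) (ℚ.*<* ())

ℕtoℚ-nonNeg : ∀ m → ℚ.NonNegative (ℕtoℚ m)
ℕtoℚ-nonNeg m = ℚ.nonNegative (ℕtoℚ-mono {0} {m} z≤n)

ℕtoℚ-pos : ∀ m .{{_ : NonZero m}} → ℚ.Positive (ℕtoℚ m)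
ℕtoℚ-pos (suc m) = ℚₚ.normalize-pos (suc m) 1

toFraction : ∀ E .{{_ : NonZero E}} {ε a b} → reciprocal E ℚ.≤ ε → E * a ≤ b → ℕtoℚ a ℚ.≤ ε ℚ.* ℕtoℚ b
toFraction E {ε} {a} {b} inv≤ le = ℚₚ.≤-trans (ℚₚ.*-cancelˡ-≤-pos (ℕtoℚ E) {{ℕtoℚ-pos E}} (begin
    ℕtoℚ E ℚ.* ℕtoℚ a ≡⟨ sym (ℕtoℚ-* E a) ⟩
    ℕtoℚ (E * a) ≤⟨ ℕtoℚ-mono le ⟩
    ℕtoℚ b ≡⟨ sym (ℚₚ.*-identityˡ (ℕtoℚ b)) ⟩
    1ℚ ℚ.* ℕtoℚ b ≡⟨ cong (ℚ._* ℕtoℚ b) (sym (reciprocal-*ˡ E)) ⟩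
    (ℕtoℚ E ℚ.* reciprocal E) ℚ.* ℕtoℚ b ≡⟨ ℚₚ.*-assoc (ℕtoℚ E) (reciprocal E) (ℕtoℚ b) ⟩
    ℕtoℚ E ℚ.* (reciprocal E ℚ.* ℕtoℚ b) ∎))
  (ℚₚ.*-monoʳ-≤-nonNeg (ℕtoℚ b) {{ℕtoℚ-nonNeg b}} inv≤)
  where open ℚₚ.≤-Reasoning

fromFraction : ∀ E .{{_ : NonZero E}} {a b} → ℕtoℚ a ℚ.≤ reciprocal E ℚ.* ℕtoℚ b → E * a ≤ b
fromFraction E {a} {b} le = ℕtoℚ-cancel (begin
    ℕtoℚ (E * a) ≡⟨ ℕtoℚ-* E a ⟩
    ℕtoℚ E ℚ.* ℕtoℚ a ≤⟨ ℚₚ.*-monoˡ-≤-nonNeg (ℕtoℚ E) {{ℕtoℚ-nonNeg E}} le ⟩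
    ℕtoℚ E ℚ.* (reciprocal E ℚ.* ℕtoℚ b) ≡⟨ sym (ℚₚ.*-assoc (ℕtoℚ E) (reciprocal E) (ℕtoℚ b)) ⟩
    (ℕtoℚ E ℚ.* reciprocal E) ℚ.* ℕtoℚ b ≡⟨ cong (ℚ._* ℕtoℚ b) (reciprocal-*ˡ E) ⟩
    1ℚ ℚ.* ℕtoℚ b ≡⟨ ℚₚ.*-identityˡ (ℕtoℚ b) ⟩
    ℕtoℚ b ∎)
  where open ℚₚ.≤-Reasoning

1-δ : ∀ δ x → (1ℚ ℚ.- δ) ℚ.* x ≡ x ℚ.- δ ℚ.* x
1-δ δ x = trans (ℚₚ.*-distribʳ-+ x 1ℚ (ℚ.- δ)) (cong₂ ℚ._+_ (ℚₚ.*-identityˡ x) (sym (ℚₚ.neg-distribˡ-* δ x)))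

minus-cancel : ∀ x y → (x ℚ.+ y) ℚ.- y ≡ x
minus-cancel x y = trans (ℚₚ.+-assoc x y (ℚ.- y)) (trans (cong (x ℚ.+_) (ℚₚ.+-inverseʳ y)) (ℚₚ.+-identityʳ x))

cancel-minus : ∀ x y → (x ℚ.- y) ℚ.+ y ≡ x
cancel-minus x y = trans (ℚₚ.+-assoc x (ℚ.- y) y) (trans (cong (x ℚ.+_) (ℚₚ.+-inverseˡ y)) (ℚₚ.+-identityʳ x))

-- Over `ℕ` the deficit is stated additively, because subtraction there would be truncated.
toDeficit : ∀ D .{{_ : NonZero D}} {δ M x} → reciprocal D ℚ.≤ δ → D * M ≤ D * x + M → (1ℚ ℚ.- δ) ℚ.* ℕtoℚ M ℚ.≤ ℕtoℚ x
toDeficit D {δ} {M} {x} inv≤ le = begin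
  (1ℚ ℚ.- δ) ℚ.* ℕtoℚ M ≡⟨ 1-δ δ (ℕtoℚ M) ⟩
  ℕtoℚ M ℚ.- δ ℚ.* ℕtoℚ M ≤⟨ ℚₚ.+-monoˡ-≤ (ℚ.- (δ ℚ.* ℕtoℚ M)) (ℚₚ.≤-trans scaled (ℚₚ.+-monoʳ-≤ (ℕtoℚ x) (ℚₚ.*-monoʳ-≤-nonNeg (ℕtoℚ M) {{ℕtoℚ-nonNeg M}} inv≤))) ⟩
  (ℕtoℚ x ℚ.+ δ ℚ.* ℕtoℚ M) ℚ.- δ ℚ.* ℕtoℚ M ≡⟨ minus-cancel (ℕtoℚ x) (δ ℚ.* ℕtoℚ M) ⟩
  ℕtoℚ x ∎
  where
  open ℚₚ.≤-Reasoning
  scaled : ℕtoℚ M ℚ.≤ ℕtoℚ x ℚ.+ reciprocal D ℚ.* ℕtoℚ M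
  scaled = ℚₚ.*-cancelˡ-≤-pos (ℕtoℚ D) {{ℕtoℚ-pos D}} (begin
    ℕtoℚ D ℚ.* ℕtoℚ M ≡⟨ sym (ℕtoℚ-* D M) ⟩
    ℕtoℚ (D * M) ≤⟨ ℕtoℚ-mono le ⟩
    ℕtoℚ (D * x + M) ≡⟨ trans (ℕtoℚ-+ (D * x) M) (cong₂ ℚ._+_ (ℕtoℚ-* D x) (trans (sym (ℚₚ.*-identityˡ (ℕtoℚ M))) (trans (cong (ℚ._* ℕtoℚ M) (sym (reciprocal-*ˡ D))) (ℚₚ.*-assoc (ℕtoℚ D) _ (ℕtoℚ M))))) ⟩
    ℕtoℚ D ℚ.* ℕtoℚ x ℚ.+ ℕtoℚ D ℚ.* (reciprocal D ℚ.* ℕtoℚ M) ≡⟨ sym (ℚₚ.*-distribˡ-+ (ℕtoℚ D) (ℕtoℚ x) _) ⟩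
    ℕtoℚ D ℚ.* (ℕtoℚ x ℚ.+ reciprocal D ℚ.* ℕtoℚ M) ∎)

fromDeficit : ∀ D .{{_ : NonZero D}} {M x} → (1ℚ ℚ.- reciprocal D) ℚ.* ℕtoℚ M ℚ.≤ ℕtoℚ x → D * M ≤ D * x + M
fromDeficit D {M} {x} le = ℕtoℚ-cancel (begin
  ℕtoℚ (D * M) ≡⟨ ℕtoℚ-* D M ⟩
  ℕtoℚ D ℚ.* ℕtoℚ M ≤⟨ ℚₚ.*-monoˡ-≤-nonNeg (ℕtoℚ D) {{ℕtoℚ-nonNeg D}} moved ⟩
  ℕtoℚ D ℚ.* (ℕtoℚ x ℚ.+ ρM) ≡⟨ ℚₚ.*-distribˡ-+ (ℕtoℚ D) (ℕtoℚ x) ρM ⟩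
  ℕtoℚ D ℚ.* ℕtoℚ x ℚ.+ ℕtoℚ D ℚ.* ρM ≡⟨ cong₂ ℚ._+_ (sym (ℕtoℚ-* D x)) (trans (sym (ℚₚ.*-assoc (ℕtoℚ D) (reciprocal D) (ℕtoℚ M))) (trans (cong (ℚ._* ℕtoℚ M) (reciprocal-*ˡ D)) (ℚₚ.*-identityˡ (ℕtoℚ M)))) ⟩
  ℕtoℚ (D * x) ℚ.+ ℕtoℚ M ≡⟨ sym (ℕtoℚ-+ (D * x) M) ⟩
  ℕtoℚ (D * x + M) ∎)
  where
  open ℚₚ.≤-Reasoning
  ρM = reciprocal D ℚ.* ℕtoℚ M
  moved : ℕtoℚ M ℚ.≤ ℕtoℚ x ℚ.+ ρM
  moved = begin
    ℕtoℚ M ≡⟨ sym (cancel-minus (ℕtoℚ M) ρM) ⟩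
    (ℕtoℚ M ℚ.- ρM) ℚ.+ ρM ≡⟨ cong (ℚ._+ ρM) (sym (1-δ (reciprocal D) (ℕtoℚ M))) ⟩
    (1ℚ ℚ.- reciprocal D) ℚ.* ℕtoℚ M ℚ.+ ρM ≤⟨ ℚₚ.+-monoˡ-≤ ρM le ⟩
    ℕtoℚ x ℚ.+ ρM ∎

-- Graphs as 2-graphs

fromR : RGraph n → Graph n
fromR H .Adj u v = u ≢ v × H (im (pairFun u v)) ≡ true
fromR H .adj? u v = ¬? (u Fin.≟ v) ×-dec (H (im (pairFun u v)) Bool.≟ true)
fromR H .symm {u} {v} (ne , h) = (λ e → ne (sym e)) , subst (λ s → H s ≡ true)
  (im-cong (pairFun u v) (pairFun v u) (λ { zero → suc zero , refl ; (suc _) → zero , refl }) (λ { zero → suc zero , refl ; (suc _) → zero , refl })) h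
fromR H .irr (ne , _) = ne

pair-≗ : (z : Fin 2 → Fin n) → pairFun (z zero) (z (suc zero)) ≗ z
pair-≗ z zero = refl
pair-≗ z (suc zero) = refl

pair-∘ : (f : Fin m → Fin n) (u v : Fin m) → f ∘ pairFun u v ≗ pairFun (f u) (f v)
pair-∘ f u v zero = refl
pair-∘ f u v (suc _) = refl

adj⇒edgeT : (H : RGraph n) {u v : Fin n} → Adj (fromR H) u v → EdgeT H (pairFun u v)
adj⇒edgeT H (ne , h) = (λ i j e → pairFun-inj ne e) , h

edgeT⇒adj : (H : RGraph n) (z : Fin 2 → Fin n) → EdgeT H z → Adj (fromR H) (z zero) (z (suc zero))
edgeT⇒adj H z (i , h) = (λ e → Finₚ.0≢1+n (i _ _ e)) , subst (λ s → H s ≡ true) (im-≗ (λ x → sym (pair-≗ z x))) h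

injPres₂⇒ : (Q : RGraph m) (H : RGraph n) (f : Fin m → Fin n) → InjPres 2 Q H f → InjHom (fromR Q) (fromR H) f
injPres₂⇒ Q H f p = proj₁ (injPres⇒ 2 Q H f p) ,
  λ u v a → edgeT⇒adj H (f ∘ pairFun u v) (proj₂ (injPres⇒ 2 Q H f p) (pairFun u v) (adj⇒edgeT Q a))

injPres₂⇐ : (Q : RGraph m) (H : RGraph n) (f : Fin m → Fin n) → InjHom (fromR Q) (fromR H) f → InjPres 2 Q H f
injPres₂⇐ Q H f (i , h) = injPres⇐ 2 Q H f i (λ z ez → edgeT-resp H (λ x → trans (sym (pair-∘ f (z zero) (z (suc zero)) x)) (cong f (pair-≗ z x)))
  (adj⇒edgeT H (h _ _ (edgeT⇒adj Q z ez))))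

inj₂-injHom : (Q : RGraph m) (H : RGraph n) → inj 2 Q H ≡ injHom (fromR Q) (fromR H)
inj₂-injHom {m} {n} Q H = trans (inj-# 2 Q H) (∑-cong (funs m n) (λ f → 𝟙-cong (injPres? 2 Q H f) (InjHom? (fromR Q) (fromR H) f) (injPres₂⇒ Q H f) (injPres₂⇐ Q H f)))

Clique : Graph n → Subset n → Set
Clique G s = ∀ i j → lookup s i ≡ true → lookup s j ≡ true → i ≢ j → Adj G i j

clique?ˢ : (G : Graph n) (s : Subset n) → Dec (Clique G s)
clique?ˢ G s = Finₚ.all? (λ i → Finₚ.all? (λ j → (lookup s i Bool.≟ true) →-dec ((lookup s j Bool.≟ true) →-dec (¬? (i Fin.≟ j) →-dec adj? G i j))))

-- The r-graph of r-cliques of G, for every r at once.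
abstract
  toR : Graph n → RGraph n
  toR G s = ⌊ clique?ˢ G s ⌋

  toR⇒ : (G : Graph n) (s : Subset n) → toR G s ≡ true → Clique G s
  toR⇒ G s = isYes⇒ (clique?ˢ G s)

  toR⇐ : (G : Graph n) (s : Subset n) → Clique G s → toR G s ≡ true
  toR⇐ G s = isYes⇐ (clique?ˢ G s)

cliqueT⇐ : (G : Graph n) (z : Fin k → Fin n) → (∀ i j → i ≢ j → Adj G (z i) (z j)) → EdgeT (toR G) z
cliqueT⇐ G z h = (λ i j e → decidable-stable (i Fin.≟ j) (λ ne → irr G (h i j ne) e)) , toR⇐ G (im z) cl
  where
  cl : Clique G (im z)
  cl x y px py ne with ∈im⇒ z px | ∈im⇒ z py
  ... | i , refl | j , refl = h i j (λ e → ne (cong z e))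

cliqueT⇒ : (G : Graph n) (z : Fin k → Fin n) → EdgeT (toR G) z → ∀ i j → i ≢ j → Adj G (z i) (z j)
cliqueT⇒ G z (inj , h) i j ne = toR⇒ G (im z) h (z i) (z j) (∈im⇐ z i) (∈im⇐ z j) (λ e → ne (inj i j e))

fromR-toR⇒ : (G : Graph n) {u v : Fin n} → Adj (fromR (toR G)) u v → Adj G u v
fromR-toR⇒ G {u} {v} a = cliqueT⇒ G (pairFun u v) (adj⇒edgeT (toR G) a) zero (suc zero) (λ ())

fromR-toR⇐ : (G : Graph n) {u v : Fin n} → Adj G u v → Adj (fromR (toR G)) u v
fromR-toR⇐ G {u} {v} a = edgeT⇒adj (toR G) (pairFun u v) (cliqueT⇐ G (pairFun u v)
  (λ { zero zero ne → ⊥-elim (ne refl) ; zero (suc zero) _ → a ; (suc zero) zero _ → symm G a ; (suc zero) (suc zero) ne → ⊥-elim (ne refl) }))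

inj₂-toR : (Q : RGraph m) (G : Graph n) → inj 2 Q (toR G) ≡ injHom (fromR Q) G
inj₂-toR {m} {n} Q G = trans (inj₂-injHom Q (toR G)) (∑-cong (funs m n) (λ f → 𝟙-cong (InjHom? (fromR Q) (fromR (toR G)) f) (InjHom? (fromR Q) G f)
  (λ { (i , h) → i , λ u v a → fromR-toR⇒ G (h u v a) }) (λ { (i , h) → i , λ u v a → fromR-toR⇐ G (h u v a) })))

free⇒KFree : ∀ ℓ (H : RGraph n) → Free 2 (complete (suc ℓ)) H → KFree ℓ (fromR H)
free⇒KFree ℓ H free (f , h) = free (f , injPres₂⇐ (complete (suc ℓ)) H f (clique-inj {G = fromR H} f h , λ u v a → h u v (proj₁ a)))

KFree⇒free : ∀ ℓ (G : Graph n) → KFree ℓ G → Free 2 (complete (suc ℓ)) (toR G)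
KFree⇒free ℓ G free (f , p) = free (f , λ u v ne → fromR-toR⇒ G (proj₂ (injPres₂⇒ (complete (suc ℓ)) (toR G) f p) u v (ne , refl)))

isInjMax⇒isMax : ∀ {q} ℓ (Q : RGraph q) {M} → IsInjMax 2 n Q (complete (suc ℓ)) M → IsMax ℓ (fromR Q) n M
isInjMax⇒isMax ℓ Q ((H , free , e) , top) = (fromR H , free⇒KFree ℓ H free , trans (sym (inj₂-injHom Q H)) e) ,
  λ G gfree → ≤-trans (≤-reflexive (sym (inj₂-toR Q G))) (top (toR G) (KFree⇒free ℓ G gfree))

pairs-funs : {P : Fin n → Fin n → Set} (P? : ∀ u v → Dec (P u v)) → pairs P P? ≡ # (funs 2 n) (λ z → P? (z zero) (z (suc zero)))
pairs-funs {n} P? = sym (trans (∑-funs-suc 1 n _) (∑-cong (fins n) (λ x → trans (∑-funs-suc 0 n _) (∑-cong (fins n) (λ y → +-identityʳ _)))))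

square : ∀ n → n ^ 2 ≡ n * n
square n = cong (n *_) (*-identityʳ n)

NearExtremal : ∀ {q p} → ℕ → RGraph q → RGraph p → ℚ → RGraph n → Set
NearExtremal {n} r Q F δ H = (m : ℕ) → IsInjMax r n Q F m → (1ℚ ℚ.- δ) ℚ.* ℕtoℚ m ℚ.≤ ℕtoℚ (inj r Q H)

EdgeClose : ℕ → ℕ → ℚ → RGraph n → Set
EdgeClose {n} r ℓ ε H = Σ (RGraph n) λ H' → SubGraph r H' H × ℕtoℚ (numRemoved r H H') ℚ.≤ ε ℚ.* ℕtoℚ (n ^ r) × InK r ℓ H'

nearExtremal-toR : ∀ {q ℓ} (Q : RGraph q) D .{{_ : NonZero D}} {δ} → reciprocal D ℚ.≤ δ → (G : Graph n) →
  (∀ M → IsMax ℓ (fromR Q) n M → D * M ≤ D * injHom (fromR Q) G + M) → NearExtremal 2 Q (complete (suc ℓ)) δ (toR G)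
nearExtremal-toR {ℓ = ℓ} Q D inv≤ G near M isMax = ℚₚ.≤-trans (toDeficit D inv≤ (near M (isInjMax⇒isMax ℓ Q isMax)))
  (ℚₚ.≤-reflexive (cong ℕtoℚ (sym (inj₂-toR Q G))))

-- `H'` has no monochromatic edge, so every monochromatic edge of `G` was removed, and a removed
-- edge accounts for at most `2 ^ 2` ordered pairs; hence `4 * E`.
edgeClose⇒nearColourable : ∀ ℓ E .{{_ : NonZero E}} (G : Graph n) → EdgeClose 2 ℓ (reciprocal (4 * E) {{m*n≢0 4 E}}) (toR G) → NearColourable E ℓ G
edgeClose⇒nearColourable {n} ℓ E G (H' , sub , few , φ , col) = φ , (begin
    E * mono G φ ≡⟨ cong (E *_) (pairs-funs (mono? G φ)) ⟩
    E * # (funs 2 n) (λ z → mono? G φ (z zero) (z (suc zero))) ≤⟨ *-monoʳ-≤ E (#tuples-≤ 2 (λ s → isEdge 2 (toR G) s Bool.∧ not (H' s)) (λ z → mono? G φ (z zero) (z (suc zero))) removed) ⟩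
    E * (4 * numRemoved 2 (toR G) H') ≡⟨ re E (numRemoved 2 (toR G) H') ⟩
    4 * E * numRemoved 2 (toR G) H' ≤⟨ fromFraction (4 * E) {{m*n≢0 4 E}} few ⟩
    n ^ 2 ≡⟨ square n ⟩
    n * n ∎)
    where
    open ≤-Reasoning
    re : ∀ E x → E * (4 * x) ≡ 4 * E * x
    re = solve-∀
    removed : ∀ z → Adj G (z zero) (z (suc zero)) × φ (z zero) ≡ φ (z (suc zero)) →
      (isEdge 2 (toR G) (im z) Bool.∧ not (H' (im z))) ≡ true × Inj z
    removed z (a , e) = ∧⇐ isE (notH' (H' (im z)) refl) , proj₁ ez
      where
      ez : EdgeT (toR G) z
      ez = edgeT-resp (toR G) (pair-≗ z) (adj⇒edgeT (toR G) (fromR-toR⇐ G a))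
      isE = tuple⇒edge 2 (toR G) z ez
      notH' : ∀ b → H' (im z) ≡ b → not b ≡ true
      notH' false _ = refl
      notH' true eq = ⊥-elim (col (im z) (isEdge⇐ 2 H' (im z) (proj₁ (isEdge⇒ 2 (toR G) (im z) isE)) eq) (z zero) (z (suc zero)) (∈im⇐ z zero) (∈im⇐ z (suc zero)) (irr G a) e)

edgeStable⇒graphStable : ∀ {q} ℓ (Q : RGraph q) → EdgeStable 2 ℓ Q (complete (suc ℓ)) → GraphStable ℓ (fromR Q)
edgeStable⇒graphStable ℓ Q stable E = convert (stable (reciprocal (4 * E) {{m*n≢0 4 E}}) (reciprocal-pos (4 * E) {{m*n≢0 4 E}}))
  where
  convert : (Σ ℚ λ δ → 0ℚ ℚ.< δ × Σ ℕ λ N → ∀ n → N ≤ n → (H : RGraph n) → Free 2 (complete (suc ℓ)) H →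
    NearExtremal 2 Q (complete (suc ℓ)) δ H → EdgeClose 2 ℓ (reciprocal (4 * E) {{m*n≢0 4 E}}) H) → _
  convert (δ , 0<δ , N , close) = let (D , D≢0 , inv≤) = archimedean δ 0<δ in D , D≢0 , N , λ n N≤n G free near →
    edgeClose⇒nearColourable ℓ E G (close n N≤n (toR G) (KFree⇒free ℓ G free) (nearExtremal-toR Q D {{D≢0}} inv≤ G near))

-- The Turán graph and closeness to it

turanColour : ∀ ℓ .{{_ : NonZero ℓ}} → Fin n → Fin ℓ
turanColour (suc k) i = Fin.fromℕ< (DivMod.m%n<n (toℕ i) (suc k))

toℕ-turanColour : ∀ ℓ .{{_ : NonZero ℓ}} (i : Fin n) → toℕ (turanColour ℓ i) ≡ part ℓ (toℕ i)
toℕ-turanColour (suc k) i = Finₚ.toℕ-fromℕ< _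

turan-toR : ∀ r ℓ .{{_ : NonZero ℓ}} (s : Subset n) → turan r n ℓ s ≡ toR (partite (turanColour ℓ)) s
turan-toR {n} r ℓ s = iff⇒≡
  (λ t → toR⇐ (partite (turanColour ℓ)) s (λ i j pi pj ne e → ¬true⇐ {⌊ part ℓ (toℕ i) ℕ.≟ part ℓ (toℕ j) ⌋}
    (implies⇒ (allFin⇒ (allFin⇒ t i) j) (∧⇐ pi (∧⇐ pj (not⇐ (λ y → ne (isYes⇒ (i Fin.≟ j) y))))))
    (isYes⇐ (part ℓ (toℕ i) ℕ.≟ part ℓ (toℕ j)) (trans (sym (toℕ-turanColour ℓ i)) (trans (cong toℕ e) (toℕ-turanColour ℓ j))))))
  (λ t → allFin⇐ (λ i → allFin⇐ (λ j → implies⇐ (λ h → not⇐ (λ y →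
    toR⇒ (partite (turanColour ℓ)) s t i j (proj₁ (∧⇒ h)) (proj₁ (∧⇒ (proj₂ (∧⇒ {lookup s i} h))))
      (λ e → ¬true⇐ {⌊ i Fin.≟ j ⌋} (proj₂ (∧⇒ {lookup s j} (proj₂ (∧⇒ {lookup s i} h)))) (isYes⇐ (i Fin.≟ j) e))
      (Finₚ.toℕ-injective (trans (toℕ-turanColour ℓ i) (trans (isYes⇒ (part ℓ (toℕ i) ℕ.≟ part ℓ (toℕ j)) y) (sym (toℕ-turanColour ℓ j)))))))))) 
  where
  not⇐ : ∀ {b} → ¬ (b ≡ true) → not b ≡ true
  not⇐ {true} h = ⊥-elim (h refl)
  not⇐ {false} h = refl
  ¬true⇐ : ∀ {b} → not b ≡ true → ¬ (b ≡ true)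
  ¬true⇐ {true} () _
  ¬true⇐ {false} _ ()

∑-fins-perm : ∀ {n} (π : Permutation′ n) (f : Fin n → ℕ) → ∑ (fins n) (λ i → f (π ⟨$⟩ʳ i)) ≡ ∑ (fins n) f
∑-fins-perm {n} π f = begin
  ∑ (fins n) (λ i → f (π ⟨$⟩ʳ i)) ≡⟨ ∑-cong (fins n) (λ i → sym (trans (∑-cong (fins n) (λ j → 𝟙-*-cong (π ⟨$⟩ʳ i Fin.≟ j) (λ e → cong f (sym e))))
     (trans (∑-*ʳ (fins n) (f (π ⟨$⟩ʳ i)) (λ j → 𝟙 (π ⟨$⟩ʳ i Fin.≟ j))) (trans (cong (_* f (π ⟨$⟩ʳ i)) (∑-fins-unique (λ j → π ⟨$⟩ʳ i Fin.≟ j) _ refl (λ _ → sym))) (*-identityˡ _))))) ⟩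
  ∑ (fins n) (λ i → ∑ (fins n) (λ j → 𝟙 (π ⟨$⟩ʳ i Fin.≟ j) * f j)) ≡⟨ ∑-swap (fins n) (fins n) _ ⟩
  ∑ (fins n) (λ j → ∑ (fins n) (λ i → 𝟙 (π ⟨$⟩ʳ i Fin.≟ j) * f j)) ≡⟨ ∑-cong (fins n) (λ j → trans (∑-*ʳ (fins n) (f j) (λ i → 𝟙 (π ⟨$⟩ʳ i Fin.≟ j)))
     (trans (cong (_* f j) (∑-fins-unique (λ i → π ⟨$⟩ʳ i Fin.≟ j) (π ⟨$⟩ˡ j) (Perm.inverseʳ π) (λ i e → trans (sym (Perm.inverseˡ π)) (cong (π ⟨$⟩ˡ_) e)))) (*-identityˡ _))) ⟩
  ∑ (fins n) f ∎
  where open ≡-Reasoning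

∑-funs-perm : ∀ {n} (π : Permutation′ n) r (φ : (Fin r → Fin n) → ℕ) → Ext φ → ∑ (funs r n) (λ z → φ (λ i → π ⟨$⟩ʳ z i)) ≡ ∑ (funs r n) φ
∑-funs-perm {n} π zero φ ext = cong (_+ 0) (ext (λ ()))
∑-funs-perm {n} π (suc r) φ ext = begin
  ∑ (funs (suc r) n) (λ z → φ (λ i → π ⟨$⟩ʳ z i)) ≡⟨ ∑-funs-suc r n _ ⟩
  ∑ (fins n) (λ j → ∑ (funs r n) (λ g → φ (λ i → π ⟨$⟩ʳ cons j g i)))
    ≡⟨ ∑-cong (fins n) (λ j → trans (∑-cong (funs r n) (λ g → ext (λ { zero → refl ; (suc i) → refl })))
         (∑-funs-perm π r (λ g → φ (cons (π ⟨$⟩ʳ j) g)) (λ e → ext (λ { zero → refl ; (suc i) → e i })))) ⟩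
  ∑ (fins n) (λ j → ∑ (funs r n) (λ g → φ (cons (π ⟨$⟩ʳ j) g))) ≡⟨ ∑-fins-perm π (λ j → ∑ (funs r n) (λ g → φ (cons j g))) ⟩
  ∑ (fins n) (λ j → ∑ (funs r n) (λ g → φ (cons j g))) ≡⟨ sym (∑-funs-suc r n φ) ⟩
  ∑ (funs (suc r) n) φ ∎
  where open ≡-Reasoning

-- The partition of the copy of the Turán graph in which vertex `i` is moved to `π ⟨$⟩ʳ i`.
permutedColour : ∀ ℓ .{{_ : NonZero ℓ}} → Permutation′ n → Fin n → Fin ℓ
permutedColour ℓ π u = turanColour ℓ (π ⟨$⟩ˡ u)

-- Ordered pairs in the symmetric difference of `G` and the complete multipartite graph with
-- partition `κ`.
Differ : ∀ {ℓ} → Graph n → (Fin n → Fin ℓ) → Fin n → Fin n → Set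
Differ G κ u v = u ≢ v × (Adj G u v × κ u ≡ κ v ⊎ ¬ Adj G u v × κ u ≢ κ v)

differ? : ∀ {ℓ} (G : Graph n) (κ : Fin n → Fin ℓ) u v → Dec (Differ G κ u v)
differ? G κ u v = ¬? (u Fin.≟ v) ×-dec ((adj? G u v ×-dec (κ u Fin.≟ κ v)) ⊎-dec (¬? (adj? G u v) ×-dec ¬? (κ u Fin.≟ κ v)))

GraphTuranStable : ∀ {q} ℓ .{{_ : NonZero ℓ}} → Graph q → Set₁
GraphTuranStable ℓ R = ∀ E .{{_ : NonZero E}} → ∃ λ D → NonZero D × ∃ λ N → ∀ n → N ≤ n → (G : Graph n) → KFree ℓ G →
  (∀ M → IsMax ℓ R n M → D * M ≤ D * injHom R G + M) →
  Σ (Permutation′ n) λ π → E * pairs _ (differ? G (permutedColour ℓ π)) ≤ n * n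

graphTuran⇒graphStable : ∀ {q} ℓ .{{_ : NonZero ℓ}} (R : Graph q) → GraphTuranStable ℓ R → GraphStable ℓ R
graphTuran⇒graphStable ℓ R stable E with stable E
... | D , D≢0 , N , close = D , D≢0 , N , λ n N≤n G free near → let (π , few) = close n N≤n G free near in
  permutedColour ℓ π , ≤-trans (*-monoʳ-≤ E (∑-mono (fins n) (λ u → #-mono (fins n) (mono? G (permutedColour ℓ π) u) (differ? G (permutedColour ℓ π) u)
    (λ { v (a , e) → irr G a , inj₁ (a , e) })))) few

xor⇐ˡ : ∀ {a b} → a ≡ true → ¬ (b ≡ true) → a Bool.xor b ≡ true
xor⇐ˡ {b = true} refl h = ⊥-elim (h refl)
xor⇐ˡ {b = false} refl h = refl

xor⇐ʳ : ∀ {a b} → ¬ (a ≡ true) → b ≡ true → a Bool.xor b ≡ true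
xor⇐ʳ {true} h _ = ⊥-elim (h refl)
xor⇐ʳ {false} _ e = e

xor⇒ : ∀ {a b} → a Bool.xor b ≡ true → (a ≡ true × ¬ (b ≡ true)) ⊎ (¬ (a ≡ true) × b ≡ true)
xor⇒ {true} {false} _ = inj₁ (refl , λ ())
xor⇒ {false} {true} _ = inj₂ ((λ ()) , refl)

TuranClose : ℕ → ℕ → ℚ → RGraph n → Set
TuranClose {n} r ℓ ε H = Σ (Fin n → Fin n) λ σ → Injective _≡_ _≡_ σ ×
  ℕtoℚ (countSub (λ s → isSize r s Bool.∧ (isEdge r H (image σ s) Bool.xor turan r n ℓ s))) ℚ.≤ ε ℚ.* ℕtoℚ (n ^ r)

turanClose⇒ : ∀ ℓ .{{_ : NonZero ℓ}} E .{{_ : NonZero E}} (G : Graph n) (σ : Fin n → Fin n) → Injective _≡_ _≡_ σ →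
  (π : Permutation′ n) → (∀ i → π ⟨$⟩ʳ i ≡ σ i) →
  ℕtoℚ (countSub (λ s → isSize 2 s Bool.∧ (isEdge 2 (toR G) (image σ s) Bool.xor turan 2 n ℓ s))) ℚ.≤ reciprocal (4 * E) {{m*n≢0 4 E}} ℚ.* ℕtoℚ (n ^ 2) →
  E * pairs _ (differ? G (permutedColour ℓ π)) ≤ n * n
turanClose⇒ {n} ℓ E G σ σ-inj π π≗σ few = begin
    E * pairs _ (differ? G κ) ≡⟨ cong (E *_) (trans (pairs-funs (differ? G κ)) (sym (∑-funs-perm π 2 (λ z → 𝟙 (differ? G κ (z zero) (z (suc zero)))) ext))) ⟩
    E * # (funs 2 n) (λ z → differ? G κ (π ⟨$⟩ʳ z zero) (π ⟨$⟩ʳ z (suc zero)))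
      ≤⟨ *-monoʳ-≤ E (#tuples-≤ 2 edited (λ z → differ? G κ (π ⟨$⟩ʳ z zero) (π ⟨$⟩ʳ z (suc zero))) covered) ⟩
    E * (4 * countSub edited) ≡⟨ re E (countSub edited) ⟩
    4 * E * countSub edited ≤⟨ fromFraction (4 * E) {{m*n≢0 4 E}} few ⟩
    n ^ 2 ≡⟨ square n ⟩
    n * n ∎
  where
  open ≤-Reasoning
  κ = permutedColour ℓ π
  edited : Subset n → Bool
  edited s = isSize 2 s Bool.∧ (isEdge 2 (toR G) (image σ s) Bool.xor turan 2 n ℓ s)
  re : ∀ E x → E * (4 * x) ≡ 4 * E * x
  re = solve-∀
  ext : Ext (λ z → 𝟙 (differ? G κ (z zero) (z (suc zero))))
  ext e = cong₂ (λ u v → 𝟙 (differ? G κ u v)) (e zero) (e (suc zero))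
  covered : ∀ z → Differ G κ (π ⟨$⟩ʳ z zero) (π ⟨$⟩ʳ z (suc zero)) → edited (im z) ≡ true × Inj z
  covered z (ne , d) = ∧⇐ (isYes⇐ (∣ im z ∣ ℕ.≟ 2) (enumerates-size (im z) z-inj (im-enumerates z))) (xor d) , z-inj
    where
    z₀≢z₁ : z zero ≢ z (suc zero)
    z₀≢z₁ e = ne (cong (π ⟨$⟩ʳ_) e)
    z-inj : Inj z
    z-inj = Inj-resp (pair-≗ z) (λ i j → pairFun-inj z₀≢z₁)
    κπ : ∀ x → κ (π ⟨$⟩ʳ x) ≡ turanColour ℓ x
    κπ x = cong (turanColour ℓ) (Perm.inverseˡ π)
    edge⇒adj : isEdge 2 (toR G) (image σ (im z)) ≡ true → Adj G (π ⟨$⟩ʳ z zero) (π ⟨$⟩ʳ z (suc zero))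
    edge⇒adj e = subst id (cong₂ (Adj G) (sym (π≗σ (z zero))) (sym (π≗σ (z (suc zero)))))
      (toR⇒ G _ (proj₂ (isEdge⇒ 2 (toR G) _ e)) (σ (z zero)) (σ (z (suc zero))) (image⇐ σ (im z) _ (∈im⇐ z zero)) (image⇐ σ (im z) _ (∈im⇐ z (suc zero)))
        (λ e → z₀≢z₁ (σ-inj e)))
    adj⇒edge : Adj G (π ⟨$⟩ʳ z zero) (π ⟨$⟩ʳ z (suc zero)) → isEdge 2 (toR G) (image σ (im z)) ≡ true
    adj⇒edge a = subst (λ s → isEdge 2 (toR G) s ≡ true) (image-im σ z) (tuple⇒edge 2 (toR G) (σ ∘ z)
      (edgeT-resp (toR G) (pair-≗ (σ ∘ z)) (adj⇒edgeT (toR G) (fromR-toR⇐ G (subst id (cong₂ (Adj G) (π≗σ (z zero)) (π≗σ (z (suc zero)))) a)))))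
    turan⇒ : turan 2 n ℓ (im z) ≡ true → κ (π ⟨$⟩ʳ z zero) ≢ κ (π ⟨$⟩ʳ z (suc zero))
    turan⇒ t e = toR⇒ (partite (turanColour ℓ)) (im z) (trans (sym (turan-toR 2 ℓ (im z))) t) (z zero) (z (suc zero)) (∈im⇐ z zero) (∈im⇐ z (suc zero)) z₀≢z₁
      (trans (sym (κπ _)) (trans e (κπ _)))
    turan⇐ : κ (π ⟨$⟩ʳ z zero) ≢ κ (π ⟨$⟩ʳ z (suc zero)) → turan 2 n ℓ (im z) ≡ true
    turan⇐ ne' = trans (turan-toR 2 ℓ (im z)) (proj₂ (edgeT-resp (toR (partite (turanColour ℓ))) (pair-≗ z)
      (adj⇒edgeT (toR (partite (turanColour ℓ))) (fromR-toR⇐ (partite (turanColour ℓ)) (λ e → ne' (trans (κπ _) (trans e (sym (κπ _)))))))))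
    xor : Adj G (π ⟨$⟩ʳ z zero) (π ⟨$⟩ʳ z (suc zero)) × κ (π ⟨$⟩ʳ z zero) ≡ κ (π ⟨$⟩ʳ z (suc zero)) ⊎
          ¬ Adj G (π ⟨$⟩ʳ z zero) (π ⟨$⟩ʳ z (suc zero)) × κ (π ⟨$⟩ʳ z zero) ≢ κ (π ⟨$⟩ʳ z (suc zero)) →
        (isEdge 2 (toR G) (image σ (im z)) Bool.xor turan 2 n ℓ (im z)) ≡ true
    xor (inj₁ (a , e)) = xor⇐ˡ (adj⇒edge a) (λ t → turan⇒ t e)
    xor (inj₂ (¬a , ne')) = xor⇐ʳ (λ e → ¬a (edge⇒adj e)) (turan⇐ ne')

turanStable⇒graphTuran : ∀ {q} ℓ .{{_ : NonZero ℓ}} (Q : RGraph q) → TuranStable 2 ℓ Q (complete (suc ℓ)) → GraphTuranStable ℓ (fromR Q)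
turanStable⇒graphTuran ℓ Q stable E = convert (stable (reciprocal (4 * E) {{m*n≢0 4 E}}) (reciprocal-pos (4 * E) {{m*n≢0 4 E}}))
  where
  permute : ∀ n (G : Graph n) → TuranClose 2 ℓ (reciprocal (4 * E) {{m*n≢0 4 E}}) (toR G) →
    Σ (Permutation′ n) λ π → E * pairs _ (differ? G (permutedColour ℓ π)) ≤ n * n
  permute n G (σ , σ-inj , few) = let (π , π≗σ) = injective⇒permutation σ (λ i j → σ-inj) in π , turanClose⇒ ℓ E G σ σ-inj π π≗σ few
  convert : (Σ ℚ λ δ → 0ℚ ℚ.< δ × Σ ℕ λ N → ∀ n → N ≤ n → (H : RGraph n) → Free 2 (complete (suc ℓ)) H →
    NearExtremal 2 Q (complete (suc ℓ)) δ H → TuranClose 2 ℓ (reciprocal (4 * E) {{m*n≢0 4 E}}) H) → _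
  convert (δ , 0<δ , N , close) = let (D , D≢0 , inv≤) = archimedean δ 0<δ in D , D≢0 , N , λ n N≤n G free near →
    permute n G (close n N≤n (toR G) (KFree⇒free ℓ G free) (nearExtremal-toR Q D {{D≢0}} inv≤ G near))

-- Shadows

shadowGraph : ∀ {q} → ℕ → RGraph q → Graph q
shadowGraph r Q = fromR (shadow r Q)

subsetB⇒ : (s t : Subset n) → subsetB s t ≡ true → ∀ i → lookup s i ≡ true → lookup t i ≡ true
subsetB⇒ s t h i = implies⇒ (allFin⇒ h i)

subsetB⇐ : (s t : Subset n) → (∀ i → lookup s i ≡ true → lookup t i ≡ true) → subsetB s t ≡ true
subsetB⇐ s t h = allFin⇐ (λ i → implies⇐ (h i))

shadow⇐ : ∀ {q} r (Q : RGraph q) (z : Fin r → Fin q) → EdgeT Q z → ∀ i j → i ≢ j → Adj (shadowGraph r Q) (z i) (z j)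
shadow⇐ r Q z ez i j ne = (λ e → ne (proj₁ ez i j e)) ,
  anySub⇐ (im z) (∧⇐ (tuple⇒edge r Q z ez) (subsetB⇐ (im (pairFun (z i) (z j))) (im z) inside′))
  where
  inside′ : ∀ x → lookup (im (pairFun (z i) (z j))) x ≡ true → lookup (im z) x ≡ true
  inside′ x h = onPair (∈im⇒ (pairFun (z i) (z j)) h)
    where
    onPair : (∃ λ a → pairFun (z i) (z j) a ≡ x) → lookup (im z) x ≡ true
    onPair (zero , refl) = ∈im⇐ z i
    onPair (suc _ , refl) = ∈im⇐ z j

-- A permutation brings the pair to the first two coordinates, where `codeg` expects it.
shadow⇒ : ∀ {q} r (Q : RGraph q) {u v} → Adj (shadowGraph (suc (suc r)) Q) u v →
  ∃ λ (z : Fin (suc (suc r)) → Fin q) → EdgeT Q z × z zero ≡ u × z (suc zero) ≡ v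
shadow⇒ {q} r Q {u} {v} (ne , h) = fromEdge (anySub⇒ h)
  where
  fromEdge : (∃ λ e → isEdge (suc (suc r)) Q e Bool.∧ subsetB (im (pairFun u v)) e ≡ true) → _
  fromEdge (e , p) = z′ (edge⇒tuple (suc (suc r)) Q e (proj₁ (∧⇒ p))) (subsetB⇒ (im (pairFun u v)) e (proj₂ (∧⇒ {isEdge (suc (suc r)) Q e} p)))
    where
    z′ : (∃ λ (z : Fin (suc (suc r)) → Fin q) → EdgeT Q z × im z ≡ e) → (∀ i → lookup (im (pairFun u v)) i ≡ true → lookup e i ≡ true) → _
    z′ (z , ez , refl) sub = place (∈im⇒ z (sub u (∈im⇐ (pairFun u v) zero))) (∈im⇒ z (sub v (∈im⇐ (pairFun u v) (suc zero))))
      where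
      place : (∃ λ i → z i ≡ u) → (∃ λ j → z j ≡ v) →
        ∃ λ (z : Fin (suc (suc r)) → Fin q) → EdgeT Q z × z zero ≡ u × z (suc zero) ≡ v
      place (i , refl) (j , refl) = let (π , h) = extendPerm (pairFun zero (suc zero)) (pairFun i j) (λ a b → pairFun-inj (λ ())) (λ a b → pairFun-inj (λ e → ne (cong z e))) in
        (λ x → z (π ⟨$⟩ʳ x)) , edgeT-perm Q z π ez , cong z (h zero) , cong z (h (suc zero))

hom⇒homT : ∀ {q} r (Q : RGraph q) (G : Graph n) f → Hom (shadowGraph r Q) G f → HomT r Q (toR G) f
hom⇒homT r Q G f h z ez = cliqueT⇐ G (f ∘ z) (λ i j ne → h _ _ (shadow⇐ r Q z ez i j ne))

-- An embedding of the shadow takes every edge of `Q` to a clique. For complete ℓ-partite `G` this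
-- bounds the r-graph extremal number from below.
injHom≤inj : ∀ {q} r (Q : RGraph q) (G : Graph n) → injHom (shadowGraph r Q) G ≤ inj r Q (toR G)
injHom≤inj {n} {q} r Q G = ≤-trans (#-mono (funs q n) (InjHom? (shadowGraph r Q) G) (injPres? r Q (toR G))
  (λ { f (i , h) → injPres⇐ r Q (toR G) f i (hom⇒homT r Q G f h) })) (≤-reflexive (sym (inj-# r Q (toR G))))

-- Expansions

∈-allSubsets : (s : Subset n) → s ∈ allSubsets n
∈-allSubsets [] = here refl
∈-allSubsets (true ∷ s) = ∈-++⁺ˡ (∈-map⁺ (true ∷_) (∈-allSubsets s))
∈-allSubsets {suc n} (false ∷ s) = ∈-++⁺ʳ (map (true ∷_) (allSubsets n)) (∈-map⁺ (false ∷_) (∈-allSubsets s))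

T⇒≡ : ∀ {b} → Bool.T b → b ≡ true
T⇒≡ = Equivalence.to Boolₚ.T-≡

edgeNo : ∀ {p} (F : RGraph p) → Fin (length (edgeList F)) → Subset p
edgeNo F k = List.lookup (edgeList F) k

edgeNo-isEdge : ∀ {p} (F : RGraph p) k → isEdge 2 F (edgeNo F k) ≡ true
edgeNo-isEdge {p} F k = T⇒≡ (proj₂ (∈-filter⁻ (λ s → Bool.T? (isEdge 2 F s)) {xs = allSubsets p} (∈-lookup {xs = edgeList F} k)))

edgeNo-complete : ∀ {p} (F : RGraph p) s → isEdge 2 F s ≡ true → ∃ λ k → edgeNo F k ≡ s
edgeNo-complete {p} F s h = index mem , sym (lookup-index mem)
  where
  mem : s ∈ edgeList F
  mem = ∈-filter⁺ (λ s → Bool.T? (isEdge 2 F s)) (∈-allSubsets s) (Equivalence.from Boolₚ.T-≡ h)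

pair-∪ : ∀ {p} (i j : Fin p) → im (pairFun i j) ≡ ⁅ i ⁆ ∪ ⁅ j ⁆
pair-∪ i j = enumerates-im (pairFun i j) ((λ { zero → Vecₚ.[]=⇒lookup (Subsetₚ.x∈p∪q⁺ {p = ⁅ i ⁆} {⁅ j ⁆} (inj₁ (Subsetₚ.x∈⁅x⁆ i)))
                                            ; (suc _) → Vecₚ.[]=⇒lookup (Subsetₚ.x∈p∪q⁺ {p = ⁅ i ⁆} {⁅ j ⁆} (inj₂ (Subsetₚ.x∈⁅x⁆ j))) }) ,
  λ x h → which x (Subsetₚ.x∈p∪q⁻ ⁅ i ⁆ ⁅ j ⁆ (Vecₚ.lookup⇒[]= x _ h)))
  where
  which : ∀ x → _ ⊎ _ → ∃ λ a → pairFun i j a ≡ x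
  which x (inj₁ m) = zero , sym (Subsetₚ.x∈⁅y⁆⇒x≡y i m)
  which x (inj₂ m) = suc zero , sym (Subsetₚ.x∈⁅y⁆⇒x≡y j m)

lookup-tabulate : {h : Fin n → Bool} (s : Subset n) → s ≡ tabulate h → ∀ i → lookup s i ≡ h i
lookup-tabulate s refl i = Vecₚ.lookup∘tabulate _ i

module _ {p : ℕ} (F : RGraph p) (r : ℕ) where

  private
    e = length (edgeList F)
    V = expSize (suc (suc r)) F

  core₂ : (k : Fin e) → ∃ λ (z : Fin 2 → Fin p) → EdgeT F z × im z ≡ edgeNo F k
  core₂ k = edge⇒tuple 2 F (edgeNo F k) (edgeNo-isEdge F k)

  endpoint : Fin e → Fin 2 → Fin p
  endpoint k = proj₁ (core₂ k)

  old : Fin p → Fin V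
  old a = a Fin.↑ˡ (e * r)

  new : Fin e → Fin r → Fin V
  new k i = p Fin.↑ʳ Fin.combine k i

  -- The endpoints come first, to match the coordinates fixed in `codeg`.
  expTuple : Fin e → Fin (suc (suc r)) → Fin V
  expTuple k = cons (old (endpoint k zero)) (cons (old (endpoint k (suc zero))) (new k))

  ∈old : ∀ k a → lookup (expEdge (suc (suc r)) F k) (old a) ≡ lookup (edgeNo F k) a
  ∈old k a rewrite lookup-tabulate (expEdge (suc (suc r)) F k) refl (old a) | Finₚ.splitAt-↑ˡ p a (e * r) = refl

  ∈new : ∀ k k' i → lookup (expEdge (suc (suc r)) F k) (new k' i) ≡ ⌊ k' Fin.≟ k ⌋
  ∈new k k' i rewrite lookup-tabulate (expEdge (suc (suc r)) F k) refl (new k' i) | Finₚ.splitAt-↑ʳ p (e * r) (Fin.combine k' i) =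
    cong (λ x → ⌊ proj₁ x Fin.≟ k ⌋) (Finₚ.remQuot-combine k' i)

  -- A view that replaces computations with `splitAt` and `remQuot` by pattern matching.
  data Vertex : Fin V → Set where
    isOld : ∀ a → Vertex (old a)
    isNew : ∀ k i → Vertex (new k i)

  vertex : ∀ v → Vertex v
  vertex v = go (Fin.splitAt p v) refl
    where
    go : ∀ s → Fin.splitAt p v ≡ s → Vertex v
    go (inj₁ a) eq = subst Vertex (trans (cong (Fin.join p (e * r)) (sym eq)) (Finₚ.join-splitAt p (e * r) v)) (isOld a)
    go (inj₂ w) eq = subst Vertex (trans (cong (p Fin.↑ʳ_) (Finₚ.combine-remQuot {e} r w)) (trans (cong (Fin.join p (e * r)) (sym eq)) (Finₚ.join-splitAt p (e * r) v)))
      (isNew (proj₁ (Fin.remQuot {e} r w)) (proj₂ (Fin.remQuot {e} r w)))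

  old-injective : ∀ {a b} → old a ≡ old b → a ≡ b
  old-injective = Finₚ.↑ˡ-injective (e * r) _ _

  new-injective : ∀ {k k' i i'} → new k i ≡ new k' i' → k ≡ k' × i ≡ i'
  new-injective {k} {k'} {i} {i'} h = Finₚ.combine-injective k i k' i' (Finₚ.↑ʳ-injective p _ _ h)

  old≢new : ∀ {a k i} → old a ≢ new k i
  old≢new {a} {k} {i} h with trans (sym (Finₚ.splitAt-↑ˡ p a (e * r))) (trans (cong (Fin.splitAt p) h) (Finₚ.splitAt-↑ʳ p (e * r) (Fin.combine k i)))
  ... | ()

  expTuple-enumerates : ∀ k → Enumerates (expTuple k) (expEdge (suc (suc r)) F k)
  expTuple-enumerates k = sound , λ v → complete′ v (vertex v)
    where
    endpoint∈ : ∀ a → lookup (edgeNo F k) (endpoint k a) ≡ true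
    endpoint∈ a = subst (λ s → lookup s (endpoint k a) ≡ true) (proj₂ (proj₂ (core₂ k))) (∈im⇐ (endpoint k) a)
    sound : ∀ i → lookup (expEdge (suc (suc r)) F k) (expTuple k i) ≡ true
    sound zero = trans (∈old k _) (endpoint∈ zero)
    sound (suc zero) = trans (∈old k _) (endpoint∈ (suc zero))
    sound (suc (suc i)) = trans (∈new k k i) (isYes⇐ (k Fin.≟ k) refl)
    complete′ : ∀ v → Vertex v → lookup (expEdge (suc (suc r)) F k) v ≡ true → ∃ λ i → expTuple k i ≡ v
    complete′ _ (isOld a) h = which (∈im⇒ (endpoint k) (subst (λ s → lookup s a ≡ true) (sym (proj₂ (proj₂ (core₂ k)))) (trans (sym (∈old k a)) h)))
      where
      which : (∃ λ b → endpoint k b ≡ a) → ∃ λ i → expTuple k i ≡ old a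
      which (zero , eq) = zero , cong old eq
      which (suc zero , eq) = suc zero , cong old eq
    complete′ _ (isNew k' i) h with isYes⇒ (k' Fin.≟ k) (trans (sym (∈new k k' i)) h)
    ... | refl = suc (suc i) , refl

  expTuple-injective : ∀ k → Inj (expTuple k)
  expTuple-injective k zero zero h = refl
  expTuple-injective k zero (suc zero) h = ⊥-elim (Finₚ.0≢1+n (proj₁ (proj₁ (proj₂ (core₂ k))) _ _ (old-injective h)))
  expTuple-injective k zero (suc (suc j)) h = ⊥-elim (old≢new h)
  expTuple-injective k (suc zero) zero h = ⊥-elim (Finₚ.0≢1+n (sym (proj₁ (proj₁ (proj₂ (core₂ k))) _ _ (old-injective h))))
  expTuple-injective k (suc zero) (suc zero) h = refl
  expTuple-injective k (suc zero) (suc (suc j)) h = ⊥-elim (old≢new h)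
  expTuple-injective k (suc (suc i)) zero h = ⊥-elim (old≢new (sym h))
  expTuple-injective k (suc (suc i)) (suc zero) h = ⊥-elim (old≢new (sym h))
  expTuple-injective k (suc (suc i)) (suc (suc j)) h = cong (λ x → suc (suc x)) (proj₂ (new-injective h))

  im-expTuple : ∀ k → im (expTuple k) ≡ expEdge (suc (suc r)) F k
  im-expTuple k = enumerates-im (expTuple k) (expTuple-enumerates k)

  expTuple-edge : ∀ k → EdgeT (expansion (suc (suc r)) F) (expTuple k)
  expTuple-edge k = expTuple-injective k , anyFin⇐ k (allFin⇐ (λ i → isYes⇐ (_ Bool.≟ _) (cong (λ s → lookup s i) (im-expTuple k))))

  expansion-homT : ∀ {n} (H : RGraph n) (f : Fin V → Fin n) → Inj f → (∀ k → EdgeT H (f ∘ expTuple k)) → HomT (suc (suc r)) (expansion (suc (suc r)) F) H f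
  expansion-homT H f f-inj h z (z-inj , ez) = (λ i j eq → z-inj i j (f-inj _ _ eq)) , found (anyFin⇒ ez)
    where
    found : (∃ λ k → eqSubB (im z) (expEdge (suc (suc r)) F k) ≡ true) → H (im (f ∘ z)) ≡ true
    found (k , eq) = subst (λ s → H s ≡ true) (trans (image-im f (expTuple k)) (trans (cong (image f) same) (sym (image-im f z)))) (proj₂ (h k))
      where
      same : im (expTuple k) ≡ im z
      same = trans (im-expTuple k) (sym (subset-ext (im z) _
        (λ i p → trans (sym (isYes⇒ (lookup (im z) i Bool.≟ lookup (expEdge (suc (suc r)) F k) i) (allFin⇒ eq i))) p)
        (λ i p → trans (isYes⇒ (lookup (im z) i Bool.≟ lookup (expEdge (suc (suc r)) F k) i) (allFin⇒ eq i)) p)))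

  -- Adjacent vertices of `F` lie in a common edge of the expansion, whose image has pairwise
  -- distinct colours; so the colours of the old vertices would form a proper ℓ-colouring of `F`.
  partite-expansionFree : ∀ {n ℓ} → ¬ Colorable F ℓ → (φ : Fin n → Fin ℓ) → Free (suc (suc r)) (expansion (suc (suc r)) F) (toR (partite φ))
  partite-expansionFree {n} {ℓ} unc φ (f , pres) = unc ((λ a → φ (f (old a))) , λ i j ne edge → proper i j ne (edgeNo-complete F (im (pairFun i j)) (isE i j ne edge)))
    where
    H = toR (partite φ)
    homT : HomT (suc (suc r)) (expansion (suc (suc r)) F) H f
    homT = proj₂ (injPres⇒ (suc (suc r)) (expansion (suc (suc r)) F) H f pres)
    isE : ∀ i j → i ≢ j → F (⁅ i ⁆ ∪ ⁅ j ⁆) ≡ true → isEdge 2 F (im (pairFun i j)) ≡ true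
    isE i j ne edge = tuple⇒edge 2 F (pairFun i j) ((λ a b → pairFun-inj ne) , subst (λ s → F s ≡ true) (sym (pair-∪ i j)) edge)
    proper : ∀ i j → i ≢ j → (∃ λ k → edgeNo F k ≡ im (pairFun i j)) → φ (f (old i)) ≢ φ (f (old j))
    proper i j ne (k , eq) = spot (locate i zero refl) (locate j (suc zero) refl)
      where
      locate : ∀ x b → pairFun i j b ≡ x → ∃ λ a → expTuple k a ≡ old x
      locate x b refl = proj₂ (expTuple-enumerates k) (old x) (trans (∈old k x) (subst (λ s → lookup s x ≡ true) (sym eq) (∈im⇐ (pairFun i j) b)))
      spot : (∃ λ a → expTuple k a ≡ old i) → (∃ λ b → expTuple k b ≡ old j) → φ (f (old i)) ≢ φ (f (old j))
      spot (a , ea) (b , eb) = subst id (cong₂ (λ x y → φ (f x) ≢ φ (f y)) ea eb)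
        (cliqueT⇒ (partite φ) (f ∘ expTuple k) (homT (expTuple k) (expTuple-edge k)) a b
          (λ { refl → ne (old-injective (trans (sym ea) eb)) }))

-- Pairs of large codegree

-- In the heavy-pair constructions `r` is the uniformity minus two; completions of a pair are
-- ordered tuples.
codeg : ∀ r → RGraph n → Fin n → Fin n → ℕ
codeg {n} r H u v = # (funs r n) (λ t → edgeT? H (cons u (cons v t)))

edgeT-swap : ∀ {r} (H : RGraph n) {u v} {t : Fin r → Fin n} → EdgeT H (cons u (cons v t)) → EdgeT H (cons v (cons u t))
edgeT-swap H {u} {v} {t} h = edgeT-resp H (λ { zero → refl ; (suc zero) → refl ; (suc (suc i)) → refl })
  (edgeT-perm H (cons u (cons v t)) (Perm.transpose zero (suc zero)) h)

codeg-sym : ∀ r (H : RGraph n) u v → codeg r H u v ≡ codeg r H v u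
codeg-sym {n} r H u v = ∑-cong (funs r n) (λ t → 𝟙-cong (edgeT? H (cons u (cons v t))) (edgeT? H (cons v (cons u t))) (edgeT-swap H) (edgeT-swap H))

-- Codegree at least `n ^ r / τ`. For `r = 0` and `τ ≥ 1` these are simply the edges of `H`.
heavy : ∀ r → ℕ → RGraph n → Graph n
heavy {n} r τ H .Adj u v = u ≢ v × n ^ r ≤ τ * codeg r H u v
heavy {n} r τ H .adj? u v = ¬? (u Fin.≟ v) ×-dec (n ^ r ≤? τ * codeg r H u v)
heavy {n} r τ H .symm {u} {v} (ne , h) = (λ e → ne (sym e)) , subst (λ c → n ^ r ≤ τ * c) (codeg-sym r H u v) h
heavy r τ H .irr (ne , _) = ne

Light : ∀ r → ℕ → RGraph n → (Fin (suc (suc r)) → Fin n) → Set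
Light {n} r τ H x = EdgeT H x × ¬ (n ^ r ≤ τ * codeg r H (x zero) (x (suc zero)))

light? : ∀ r τ (H : RGraph n) x → Dec (Light r τ H x)
light? {n} r τ H x = edgeT? H x ×-dec ¬? (n ^ r ≤? τ * codeg r H (x zero) (x (suc zero)))

light-resp : ∀ r τ (H : RGraph n) → Resp (Light r τ H)
light-resp {n} r τ H {f} {g} e (h , l) = edgeT-resp H e h ,
  λ le → l (subst (λ c → n ^ r ≤ τ * c) (cong₂ (codeg r H) (sym (e zero)) (sym (e (suc zero)))) le)

light-few : ∀ {n} r τ (H : RGraph n) → τ * # (funs (suc (suc r)) n) (light? r τ H) ≤ n ^ suc (suc r)
light-few {n} r τ H = begin
  τ * # (funs (suc (suc r)) n) (light? r τ H)
    ≡⟨ cong (τ *_) (trans (∑-funs-suc (suc r) n _) (∑-cong (fins n) (λ u → ∑-funs-suc r n _))) ⟩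
  τ * ∑ (fins n) (λ u → ∑ (fins n) (λ v → # (funs r n) (λ t → light? r τ H (cons u (cons v t)))))
    ≡⟨ trans (sym (∑-*ˡ (fins n) τ _)) (∑-cong (fins n) (λ u → sym (∑-*ˡ (fins n) τ _))) ⟩
  ∑ (fins n) (λ u → ∑ (fins n) (λ v → τ * # (funs r n) (λ t → light? r τ H (cons u (cons v t)))))
    ≤⟨ ∑-mono (fins n) (λ u → ∑-mono (fins n) (λ v → small u v)) ⟩
  ∑ (fins n) (λ u → ∑ (fins n) (λ v → n ^ r)) ≡⟨ trans (∑-cong (fins n) (λ _ → ∑-fins-const n (n ^ r))) (∑-fins-const n _) ⟩
  n * (n * n ^ r) ∎
  where
  open ≤-Reasoning
  small : ∀ u v → τ * # (funs r n) (λ t → light? r τ H (cons u (cons v t))) ≤ n ^ r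
  small u v = ≤-trans (*-monoʳ-≤ τ (#-mono (funs r n) (λ t → light? r τ H (cons u (cons v t)))
      (λ t → ¬? (n ^ r ≤? τ * codeg r H u v) ×-dec edgeT? H (cons u (cons v t))) (λ { t (h , l) → l , h })))
    (#-guard τ (funs r n) (¬? (n ^ r ≤? τ * codeg r H u v)) (λ t → edgeT? H (cons u (cons v t))) (λ l → <⇒≤ (≰⇒> l)))

-- A lost map sends some shadow pair to a light pair, and so sends an edge of `Q` through it to a
-- light tuple. The image of a fixed edge is uniform, and a uniform tuple is light with probability
-- at most `1 / τ`.
lightLoss : ∀ {q n} .{{_ : NonZero n}} r τ (Q : RGraph q) (H : RGraph n) {X : (Fin q → Fin n) → Set} (X? : ∀ f → Dec (X f)) →
  (∀ f → X f → HomT (suc (suc r)) Q H f × ¬ Hom (shadowGraph (suc (suc r)) Q) (heavy r τ H) f) →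
  τ * # (funs q n) X? ≤ q * (q * n ^ q)
lightLoss {q} {n} r τ Q H {X} X? lost = pairUnion τ (funs q n) X? {Y = λ u v f → Y (adj? R u v) f} (λ u v f → Y? (adj? R u v) f) cover (λ u v → small (adj? R u v))
  where
  open ≤-Reasoning
  R = shadowGraph (suc (suc r)) Q
  instance nr≢0 = m^n≢0 n (suc (suc r))
  -- The edge of `Q` through `u` and `v` is read off the decision `adj? R u v`, so it stays fixed
  -- while `f` varies and its image is uniform.
  Y : ∀ {u v} → Dec (Adj R u v) → (Fin q → Fin n) → Set
  Y (yes a) f = Light r τ H (f ∘ proj₁ (shadow⇒ r Q a))
  Y (no _) f = ⊥
  Y? : ∀ {u v} (d : Dec (Adj R u v)) f → Dec (Y d f)
  Y? (yes a) f = light? r τ H (f ∘ proj₁ (shadow⇒ r Q a))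
  Y? (no _) f = no id
  cover : ∀ f → X f → ∃ λ u → ∃ λ v → Y (adj? R u v) f
  cover f x = go (notHom⇒ R (heavy r τ H) f (proj₂ (lost f x)))
    where
    go : (∃ λ u → ∃ λ v → Adj R u v × ¬ Adj (heavy r τ H) (f u) (f v)) → ∃ λ u → ∃ λ v → Y (adj? R u v) f
    go (u , v , a , ¬h) = u , v , lift (adj? R u v)
      where
      lift : (d : Dec (Adj R u v)) → Y d f
      lift (no ¬a) = ⊥-elim (¬a a)
      lift (yes a′) = let (z , ez , z₀ , z₁) = shadow⇒ r Q a′ ; ef = proj₁ (lost f x) z ez in
        ef , λ le → ¬h ((λ eq → Finₚ.0≢1+n (proj₁ ef zero (suc zero) (trans (cong f z₀) (trans eq (cong f (sym z₁)))))) ,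
          subst (λ c → n ^ r ≤ τ * c) (cong₂ (codeg r H) (cong f z₀) (cong f z₁)) le)
  small : ∀ {u v} (d : Dec (Adj R u v)) → τ * # (funs q n) (Y? d) ≤ n ^ q
  small (no _) = ≤-trans (≤-reflexive (trans (cong (τ *_) (∑-zero (funs q n))) (*-zeroʳ τ))) z≤n
  small (yes a) = *-cancelʳ-≤ _ _ (n ^ suc (suc r)) (begin
    τ * # (funs q n) (λ f → light? r τ H (f ∘ z)) * n ^ suc (suc r) ≡⟨ *-assoc τ _ _ ⟩
    τ * (# (funs q n) (λ f → light? r τ H (f ∘ z)) * n ^ suc (suc r)) ≡⟨ cong (τ *_) (#-marginal n z (Inj⇒ (proj₁ (proj₁ (proj₂ (shadow⇒ r Q a))))) (light? r τ H) (light-resp r τ H)) ⟩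
    τ * (n ^ q * # (funs (suc (suc r)) n) (light? r τ H)) ≡⟨ re τ (n ^ q) _ ⟩
    n ^ q * (τ * # (funs (suc (suc r)) n) (light? r τ H)) ≤⟨ *-monoʳ-≤ (n ^ q) (light-few r τ H) ⟩
    n ^ q * n ^ suc (suc r) ∎)
    where
    z = proj₁ (shadow⇒ r Q a)
    re : ∀ a b c → a * (b * c) ≡ b * (a * c)
    re = solve-∀

-- Greedy embedding of expansions

hitCount : ∀ {n} r (i : Fin r) (y : Fin n) → # (funs r n) (λ t → t i Fin.≟ y) * n ≡ n ^ r
hitCount {n} r i y = begin
  # (funs r n) (λ t → t i Fin.≟ y) * n ≡⟨ cong (# (funs r n) (λ t → t i Fin.≟ y) *_) (sym (*-identityʳ n)) ⟩
  # (funs r n) (λ t → t i Fin.≟ y) * n ^ 1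
    ≡⟨ #-marginal {1} n (λ _ → i) (λ { {zero} {zero} _ → refl }) (λ x → x zero Fin.≟ y) (λ e p → trans (sym (e zero)) p) ⟩
  n ^ r * # (funs 1 n) (λ x → x zero Fin.≟ y)
    ≡⟨ cong (n ^ r *_) (trans (∑-funs-suc 0 n _) (trans (∑-cong (fins n) (λ j → +-identityʳ _)) (∑-fins-unique (λ j → j Fin.≟ y) y refl (λ _ → id)))) ⟩
  n ^ r * 1 ≡⟨ *-identityʳ _ ⟩
  n ^ r ∎
  where open ≡-Reasoning

hits? : ∀ {r w} (used : Fin w → Fin n) (t : Fin r → Fin n) → Dec (∃ λ i → ∃ λ a → t i ≡ used a)
hits? used t = Finₚ.any? (λ i → Finₚ.any? (λ a → t i Fin.≟ used a))

hits-few : ∀ {n} r {w} (used : Fin w → Fin n) → # (funs r n) (hits? used) * n ≤ r * w * n ^ r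
hits-few {n} r {w} used = begin
  # (funs r n) (hits? used) * n
    ≤⟨ *-monoˡ-≤ n (≤-trans (#-⋃ (funs r n) (hits? used) (λ i t → Finₚ.any? (λ a → t i Fin.≟ used a)) (λ _ → id))
         (∑-mono (fins r) (λ i → #-⋃ (funs r n) (λ t → Finₚ.any? (λ a → t i Fin.≟ used a)) (λ a t → t i Fin.≟ used a) (λ _ → id)))) ⟩
  ∑ (fins r) (λ i → ∑ (fins w) (λ a → # (funs r n) (λ t → t i Fin.≟ used a))) * n
    ≡⟨ trans (sym (∑-*ʳ (fins r) n _)) (∑-cong (fins r) (λ i → trans (sym (∑-*ʳ (fins w) n _)) (∑-cong (fins w) (λ a → hitCount r i (used a))))) ⟩
  ∑ (fins r) (λ i → ∑ (fins w) (λ a → n ^ r)) ≡⟨ trans (∑-cong (fins r) (λ _ → ∑-fins-const w _)) (∑-fins-const r _) ⟩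
  r * (w * n ^ r) ≡⟨ sym (*-assoc r w _) ⟩
  r * w * n ^ r ∎
  where open ≤-Reasoning

-- A heavy pair has at least `n ^ r / τ` completions, while at most `r * w * n ^ r / n` tuples meet
-- the `w` used vertices.
extendEdge : ∀ {n} r τ (H : RGraph n) {w} (used : Fin w → Fin n) {x y} → n ^ r ≤ τ * codeg r H x y → τ * (r * w) < n →
  ∃ λ (t : Fin r → Fin n) → EdgeT H (cons x (cons y t)) × (∀ i a → t i ≢ used a)
extendEdge {n} r τ H {w} used {x} {y} heavyPair room = go (anyFun? good? good-resp)
  where
  good? = λ (t : Fin r → Fin n) → edgeT? H (cons x (cons y t)) ×-dec ¬? (hits? used t)
  good-resp : Resp (λ t → EdgeT H (cons x (cons y t)) × ¬ (∃ λ i → ∃ λ a → t i ≡ used a))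
  good-resp e (h , no-hit) = edgeT-resp H (λ { zero → refl ; (suc zero) → refl ; (suc (suc i)) → e i }) h ,
    λ { (i , a , p) → no-hit (i , a , trans (e i) p) }
  go : Dec (∃ λ t → EdgeT H (cons x (cons y t)) × ¬ (∃ λ i → ∃ λ a → t i ≡ used a)) → _
  go (yes (t , h , no-hit)) = t , h , λ i a p → no-hit (i , a , p)
  go (no none) = ⊥-elim (<-irrefl refl (begin-strict
    n ^ r * n ≤⟨ *-monoˡ-≤ n heavyPair ⟩
    τ * codeg r H x y * n ≤⟨ *-monoˡ-≤ n (*-monoʳ-≤ τ (#-mono (funs r n) (λ t → edgeT? H (cons x (cons y t))) (hits? used) hit)) ⟩
    τ * # (funs r n) (hits? used) * n ≡⟨ *-assoc τ _ n ⟩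
    τ * (# (funs r n) (hits? used) * n) ≤⟨ *-monoʳ-≤ τ (hits-few r used) ⟩
    τ * (r * w * n ^ r) ≡⟨ sym (*-assoc τ (r * w) (n ^ r)) ⟩
    τ * (r * w) * n ^ r <⟨ *-monoˡ-< (n ^ r) {{m^n≢0 n r {{ℕ.>-nonZero (≤-trans (s≤s z≤n) room)}}}} room ⟩
    n * n ^ r ≡⟨ *-comm n (n ^ r) ⟩
    n ^ r * n ∎))
    where
    open ≤-Reasoning
    hit : ∀ t → EdgeT H (cons x (cons y t)) → ∃ λ i → ∃ λ a → t i ≡ used a
    hit t h = decidable-stable (hits? used t) (λ no-hit → none (t , h , no-hit))

-- `used` absorbs each new block, so `w + e * r`, the final number of vertices, is constant along
-- the recursion. Distinctness within a block comes from its edge, so separating the blocks is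
-- enough.
greedy : ∀ {n} r τ (H : RGraph n) e {w} (used : Fin w → Fin n) (x y : Fin e → Fin n) → (∀ k → n ^ r ≤ τ * codeg r H (x k) (y k)) →
  τ * (r * (w + e * r)) < n →
  ∃ λ (t : Fin e → Fin r → Fin n) → (∀ k → EdgeT H (cons (x k) (cons (y k) (t k)))) × (∀ k i a → t k i ≢ used a) ×
    (∀ k k' i i' → t k i ≡ t k' i' → k ≡ k')
greedy r τ H zero used x y _ _ = (λ ()) , (λ ()) , (λ ()) , λ ()
greedy {n} r τ H (suc e) {w} used x y heavyPairs room = combine′ (extendEdge r τ H used (heavyPairs zero) room₀)
  where
  room₀ : τ * (r * w) < n
  room₀ = ≤-trans (s≤s (*-monoʳ-≤ τ (*-monoʳ-≤ r (m≤m+n w _)))) room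
  combine′ : (∃ λ (t : Fin r → Fin n) → EdgeT H (cons (x zero) (cons (y zero) t)) × (∀ i a → t i ≢ used a)) → _
  combine′ (t₀ , h₀ , avoid₀) = finish (greedy r τ H e used′ (x ∘ suc) (y ∘ suc) (heavyPairs ∘ suc)
      (subst (λ z → τ * (r * z) < n) (sym (+-assoc w r (e * r))) room))
    where
    used′ : Fin (w + r) → Fin n
    used′ v = [ used , t₀ ]′ (Fin.splitAt w v)
    used′ˡ : ∀ a → used′ (a Fin.↑ˡ r) ≡ used a
    used′ˡ a = cong [ used , t₀ ]′ (Finₚ.splitAt-↑ˡ w a r)
    used′ʳ : ∀ i → used′ (w Fin.↑ʳ i) ≡ t₀ i
    used′ʳ i = cong [ used , t₀ ]′ (Finₚ.splitAt-↑ʳ w r i)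
    finish : (∃ λ (t : Fin e → Fin r → Fin n) → (∀ k → EdgeT H (cons (x (suc k)) (cons (y (suc k)) (t k)))) × (∀ k i a → t k i ≢ used′ a) ×
      (∀ k k' i i' → t k i ≡ t k' i' → k ≡ k')) → _
    finish (t , h , avoid , apart) = (λ { zero → t₀ ; (suc k) → t k }) , (λ { zero → h₀ ; (suc k) → h k }) ,
      (λ { zero → avoid₀ ; (suc k) i a p → avoid k i (a Fin.↑ˡ r) (trans p (sym (used′ˡ a))) }) ,
      λ { zero zero _ _ _ → refl
        ; zero (suc k') i i' p → ⊥-elim (avoid k' i' (w Fin.↑ʳ i) (trans (sym p) (sym (used′ʳ i))))
        ; (suc k) zero i i' p → ⊥-elim (avoid k i (w Fin.↑ʳ i') (trans p (sym (used′ʳ i'))))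
        ; (suc k) (suc k') i i' p → cong suc (apart k k' i i' p) }

heavy⇒expansion : ∀ {p n} r τ (F : RGraph p) (H : RGraph n) → τ * (r * (p + length (edgeList F) * r)) < n →
  ∃ (InjHom (fromR F) (heavy r τ H)) → Contains (suc (suc r)) (expansion (suc (suc r)) F) H
heavy⇒expansion {p} {n} r τ F H room (f , f-inj , f-hom) = embed (greedy r τ H e f (λ k → f (endpoint F r k zero)) (λ k → f (endpoint F r k (suc zero)))
    (λ k → proj₂ (f-hom _ _ (edgeT⇒adj F (endpoint F r k) (proj₁ (proj₂ (core₂ F r k)))))) room)
  where
  e = length (edgeList F)
  embed : (∃ λ (t : Fin e → Fin r → Fin n) → (∀ k → EdgeT H (cons (f (endpoint F r k zero)) (cons (f (endpoint F r k (suc zero))) (t k)))) ×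
    (∀ k i a → t k i ≢ f a) × (∀ k k' i i' → t k i ≡ t k' i' → k ≡ k')) → _
  embed (t , h , avoid , apart) = g , injPres⇐ (suc (suc r)) (expansion (suc (suc r)) F) H g g-inj
      (expansion-homT F r H g g-inj (λ k → edgeT-resp H
        (λ { zero → sym (g-old _) ; (suc zero) → sym (g-old _) ; (suc (suc i)) → sym (g-new k i) }) (h k)))
    where
    on : Fin p ⊎ Fin (e * r) → Fin n
    on (inj₁ a) = f a
    on (inj₂ w) = t (proj₁ (Fin.remQuot {e} r w)) (proj₂ (Fin.remQuot {e} r w))
    g : Fin (expSize (suc (suc r)) F) → Fin n
    g v = on (Fin.splitAt p v)
    g-old : ∀ a → g (old F r a) ≡ f a
    g-old a = cong on (Finₚ.splitAt-↑ˡ p a (e * r))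
    g-new : ∀ k i → g (new F r k i) ≡ t k i
    g-new k i = trans (cong on (Finₚ.splitAt-↑ʳ p (e * r) (Fin.combine k i))) (cong (λ x → t (proj₁ x) (proj₂ x)) (Finₚ.remQuot-combine k i))
    separate : ∀ {u v} → Vertex F r u → Vertex F r v → g u ≡ g v → u ≡ v
    separate (isOld a) (isOld b) q = cong (old F r) (f-inj a b (trans (sym (g-old a)) (trans q (g-old b))))
    separate (isOld a) (isNew k i) q = ⊥-elim (avoid k i a (trans (sym (g-new k i)) (trans (sym q) (g-old a))))
    separate (isNew k i) (isOld a) q = ⊥-elim (avoid k i a (trans (sym (g-new k i)) (trans q (g-old a))))
    separate (isNew k i) (isNew k' i') q = same (apart k k' i i' tq) tq
      where
      tq : t k i ≡ t k' i'
      tq = trans (sym (g-new k i)) (trans q (g-new k' i'))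
      same : k ≡ k' → t k i ≡ t k' i' → new F r k i ≡ new F r k' i'
      same refl tq = cong (new F r k) (Finₚ.suc-injective (Finₚ.suc-injective (proj₁ (h k) (suc (suc i)) (suc (suc i')) tq)))
    g-inj : Inj g
    g-inj u v q = separate (vertex F r u) (vertex F r v) q

-- Near-extremal r-graphs and their heavy graphs: edge stability

inj≤ : ∀ {q} r (Q : RGraph q) (H : RGraph n) → inj r Q H ≤ n ^ q
inj≤ {n} {q} r Q H = ≤-trans (≤-reflexive (inj-# r Q H)) (≤-trans (#≤length (funs q n) (injPres? r Q H)) (≤-reflexive (length-funs q n)))

isInjMax-exists : ∀ {q p n ℓ} .{{_ : NonZero ℓ}} r (Q : RGraph q) (F : RGraph p) → ¬ Colorable F ℓ →
  ¬ ¬ (Σ ℕ (IsInjMax (suc (suc r)) n Q (expansion (suc (suc r)) F)))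
isInjMax-exists {q} {p} {n} {suc ℓ} r Q F unc none =
  boundedMax {V = λ v → Σ (RGraph n) λ H → Free (suc (suc r)) (expansion (suc (suc r)) F) H × inj (suc (suc r)) Q H ≡ v} (n ^ q)
    (λ { w (H , _ , refl) → inj≤ (suc (suc r)) Q H }) (n ^ q) _
    (toR (partite {n = n} {suc ℓ} (λ _ → zero)) , partite-expansionFree F r unc (λ _ → zero) , refl) (m≤n+m _ _)
    (λ { (M , attained , top) → none (M , attained , λ H free → top _ (H , free , refl)) })

lostByLight : ∀ {q n} .{{_ : NonZero n}} r τ (Q : RGraph q) (H : RGraph n) →
  τ * inj (suc (suc r)) Q H ≤ τ * hom (shadowGraph (suc (suc r)) Q) (heavy r τ H) + q * (q * n ^ q)
lostByLight {q} {n} r τ Q H = begin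
  τ * inj (suc (suc r)) Q H ≡⟨ cong (τ *_) (inj-# (suc (suc r)) Q H) ⟩
  τ * # (funs q n) (injPres? (suc (suc r)) Q H) ≤⟨ *-monoʳ-≤ τ (#-⊎ (funs q n) (injPres? (suc (suc r)) Q H) (Hom? R G) lost? (λ f p → split f p (Hom? R G f))) ⟩
  τ * (hom R G + # (funs q n) lost?) ≡⟨ *-distribˡ-+ τ _ _ ⟩
  τ * hom R G + τ * # (funs q n) lost? ≤⟨ +-monoʳ-≤ _ (lightLoss r τ Q H lost? (λ { f (p , ¬h) → proj₂ (injPres⇒ (suc (suc r)) Q H f p) , ¬h })) ⟩
  τ * hom R G + q * (q * n ^ q) ∎
  where
  open ≤-Reasoning
  R = shadowGraph (suc (suc r)) Q
  G = heavy r τ H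
  lost? = λ f → injPres? (suc (suc r)) Q H f ×-dec ¬? (Hom? R G f)
  split : ∀ f → InjPres (suc (suc r)) Q H f → Dec (Hom R G f) → Hom R G f ⊎ (InjPres (suc (suc r)) Q H f × ¬ Hom R G f)
  split f p (yes h) = inj₁ h
  split f p (no ¬h) = inj₂ (p , ¬h)

colorable⇒ : ∀ {p} {F : RGraph p} {k} → Colorable F k → ∃ (Colouring (fromR F) k)
colorable⇒ {F = F} (c , proper) = c , λ { u v (ne , h) → proper u v ne (subst (λ s → F s ≡ true) (pair-∪ u v) h) }

HeavyCore : ∀ {q p} → ℕ → ℕ → RGraph q → RGraph p → ℕ → ℕ → ℕ → ℕ → Set
HeavyCore ℓ r Q F E Δ τ N = ∀ n → NonZero n → N ≤ n → (H : RGraph n) → Free (suc (suc r)) (expansion (suc (suc r)) F) H →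
  (∀ M → IsInjMax (suc (suc r)) n Q (expansion (suc (suc r)) F) M → Δ * M ≤ Δ * inj (suc (suc r)) Q H + M) → NearColourable E ℓ (heavy r τ H)

-- Supplies `core` with its r-graph data: complete ℓ-partite r-graphs are expansion-free, hence
-- bounded by the extremal number, and too many cliques would put `F` into the heavy graph and its
-- expansion into `H`. The lower bounds `τ₀` and `Δ₀` serve the caller, whose own loss estimates
-- concern the same heavy graph.
heavyCore : ∀ {q p} ℓ → 2 ≤ ℓ → ∀ r (Q : RGraph q) (F : RGraph p) → ChromaticNumber F (suc ℓ) → GraphStable ℓ (shadowGraph (suc (suc r)) Q) →
  ∀ E .{{_ : NonZero E}} τ₀ Δ₀ → ∃ λ Δ → NonZero Δ × Δ₀ ≤ Δ × ∃ λ τ → τ₀ ≤ τ × ∃ λ N → HeavyCore ℓ r Q F E Δ τ N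
heavyCore {q} {p} ℓ 2≤ℓ r Q F (col , unc) stable E τ₀ Δ₀ = build (core ℓ 2≤ℓ R stable E)
  where
  R = shadowGraph (suc (suc r)) Q
  ℓ≢0 : NonZero ℓ
  ℓ≢0 = ℕ.>-nonZero (≤-trans (s≤s z≤n) 2≤ℓ)
  build : (∃ λ Δ → NonZero Δ × ∃ λ τ → NonZero τ × ∃ λ Γ → ∃ λ N → Core ℓ R E Δ τ Γ N) → _
  build (Δ₁ , Δ₁≢0 , τ₁ , τ₁≢0 , Γ , N₁ , coreBound) =
    Δ , ℕ.>-nonZero (≤-trans (ℕ.>-nonZero⁻¹ Δ₁ {{Δ₁≢0}}) (m≤m+n Δ₁ Δ₀)) , m≤n+m Δ₀ Δ₁ , τ , m≤n+m τ₀ τ₁ , N , result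
    where
    Δ = Δ₁ + Δ₀
    τ = τ₁ + τ₀
    cliques = manyCliques⇒contains (suc ℓ) (fromR F) (proj₂ (colorable⇒ {F = F} col)) Γ
    N = N₁ + (proj₁ cliques + suc (τ * (r * (p + length (edgeList F) * r))))
    result : HeavyCore ℓ r Q F E Δ τ N
    result n n≢0 N≤n H free near = decidable-stable (nearColourable? E ℓ (heavy r τ H)) λ far →
      isInjMax-exists {{ℓ≢0}} r Q F unc λ (Mx , isMax) → far (coreBound n {{n≢0}} (≤-trans (m≤m+n N₁ _) N≤n) (heavy r τ H) (inj (suc (suc r)) Q H) Mx
        (λ φ → ≤-trans (injHom≤inj (suc (suc r)) Q (partite φ)) (proj₂ isMax (toR (partite φ)) (partite-expansionFree F r unc φ)))
        (bounded (proj₁ isMax))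
        (weaken (m≤m+n Δ₁ Δ₀) (near Mx isMax))
        (weaken (m≤m+n τ₁ τ₀) (lostByLight {{n≢0}} r τ Q H))
        few)
      where
      bounded : ∀ {M} → (Σ (RGraph n) λ H′ → Free (suc (suc r)) (expansion (suc (suc r)) F) H′ × inj (suc (suc r)) Q H′ ≡ M) → M ≤ n ^ q
      bounded (H′ , _ , refl) = inj≤ (suc (suc r)) Q H′
      few : Γ * hom (K (suc ℓ)) (heavy r τ H) ≤ n ^ suc ℓ
      few = decidable-stable (_ ≤? _) λ many → free (heavy⇒expansion r τ F H
        (≤-trans (m≤n+m _ (proj₁ cliques)) (≤-trans (m≤n+m _ N₁) N≤n))
        (proj₂ cliques n (≤-trans (m≤m+n _ _) (≤-trans (m≤n+m _ N₁) N≤n)) (heavy r τ H) (<⇒≤ (≰⇒> many))))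

-- A lost map leaves the heavy graph or uses a monochromatic heavy edge; each kind costs `q * q`.
lossBound : ∀ {q n ℓ} .{{_ : NonZero n}} r {E τ} → E ≤ τ → (Q : RGraph q) (H : RGraph n) (φ : Fin n → Fin ℓ) → E * mono (heavy r τ H) φ ≤ n * n →
  {X : (Fin q → Fin n) → Set} (X? : ∀ f → Dec (X f)) →
  (∀ f → X f → HomT (suc (suc r)) Q H f ×
    ¬ (Hom (shadowGraph (suc (suc r)) Q) (heavy r τ H) f × Hom (shadowGraph (suc (suc r)) Q) (partite φ) f)) → E * # (funs q n) X? ≤ 2 * (q * (q * n ^ q))
lossBound {q} {n} r {E} {τ} E≤τ Q H φ few {X} X? lost = begin
  E * # (funs q n) X? ≤⟨ *-monoʳ-≤ E (#-⊎ (funs q n) X? light mono′ (λ f x → split f x (Hom? R G f))) ⟩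
  E * (# (funs q n) light + # (funs q n) mono′) ≡⟨ *-distribˡ-+ E _ _ ⟩
  E * # (funs q n) light + E * # (funs q n) mono′
    ≤⟨ +-mono-≤ (≤-trans (*-monoˡ-≤ _ E≤τ) (lightLoss r τ Q H light (λ { f (x , ¬h) → proj₁ (lost f x) , ¬h }))) (monoLoss E R G φ few) ⟩
  q * (q * n ^ q) + q * (q * n ^ q) ≡⟨ re (q * (q * n ^ q)) ⟩
  2 * (q * (q * n ^ q)) ∎
  where
  open ≤-Reasoning
  R = shadowGraph (suc (suc r)) Q
  G = heavy r τ H
  light = λ f → X? f ×-dec ¬? (Hom? R G f)
  mono′ = λ f → Hom? R G f ×-dec ¬? (Hom? R (partite φ) f)
  split : ∀ f → X f → Dec (Hom R G f) → (X f × ¬ Hom R G f) ⊎ (Hom R G f × ¬ Hom R (partite φ) f)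
  split f x (yes h) = inj₂ (h , λ c → proj₂ (lost f x) (h , c))
  split f x (no ¬h) = inj₁ (x , ¬h)
  re : ∀ x → x + x ≡ 2 * x
  re = solve-∀

-- The r-graph with the single edge [r] turns statements about maps from Q into statements about edges.
edgeT⇒homT : ∀ r (H : RGraph n) (z : Fin r → Fin n) → EdgeT H z → HomT r (complete r) H z
edgeT⇒homT r H z ez w (w-inj , _) = let (π , h) = injective⇒permutation w w-inj in
  edgeT-resp H (λ i → cong z (h i)) (edgeT-perm H z π ez)

shadow-complete : ∀ r (i j : Fin r) → i ≢ j → Adj (shadowGraph r (complete r)) i j
shadow-complete r = shadow⇐ r (complete r) id ((λ _ _ e → e) , refl)

-- `H′` keeps the edges that are rainbow under `φ`. The others are counted by `lossBound` for the
-- single-edge r-graph, and the precision contains the resulting factor `2 * (ρ * ρ)` in advance.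
edgeClose : ∀ {n} .{{_ : NonZero n}} ℓ r {E ε τ} .{{_ : NonZero E}} → reciprocal E ℚ.≤ ε → E * (2 * (suc (suc r) * suc (suc r))) ≤ τ → (H : RGraph n) →
  NearColourable (E * (2 * (suc (suc r) * suc (suc r)))) ℓ (heavy r τ H) → EdgeClose (suc (suc r)) ℓ ε H
edgeClose {n} ℓ r {E} {ε} {τ} inv≤ E≤τ H (φ , near) = H′ , sub , toFraction E inv≤ few , φ , rainbow
  where
  open ≤-Reasoning
  ρ = suc (suc r)
  H′ : RGraph n
  H′ s = H s Bool.∧ toR (partite φ) s
  sub : SubGraph ρ H′ H
  sub s h = isEdge⇐ ρ H s (proj₁ (isEdge⇒ ρ H′ s h)) (proj₁ (∧⇒ (proj₂ (isEdge⇒ ρ H′ s h))))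
  rainbow : ∀ s → isEdge ρ H′ s ≡ true → Clique (partite φ) s
  rainbow s h = toR⇒ (partite φ) s (proj₂ (∧⇒ {H s} (proj₂ (isEdge⇒ ρ H′ s h))))
  bad? = λ (z : Fin ρ → Fin n) → edgeT? H z ×-dec ¬? (Hom? (shadowGraph ρ (complete ρ)) (partite φ) z)
  bad-resp : Resp (λ z → EdgeT H z × ¬ Hom (shadowGraph ρ (complete ρ)) (partite φ) z)
  bad-resp e (h , ¬c) = edgeT-resp H e h , λ c → ¬c (Hom-resp (shadowGraph ρ (complete ρ)) (partite φ) (λ i → sym (e i)) c)
  cover : ∀ s → (isEdge ρ H s Bool.∧ not (H′ s)) ≡ true → ∃ λ z → (EdgeT H z × ¬ Hom (shadowGraph ρ (complete ρ)) (partite φ) z) × im z ≡ s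
  cover s h = tuple (edge⇒tuple ρ H s (proj₁ (∧⇒ h)))
    where
    tuple : (∃ λ (z : Fin ρ → Fin n) → EdgeT H z × im z ≡ s) → _
    tuple (z , ez , refl) = z , (ez , λ c → absurd (H′ (im z)) (∧⇐ (proj₂ ez) (proj₂ (cliqueT⇐ (partite φ) z (λ i j ne → c i j (shadow-complete ρ i j ne)))))
      (proj₂ (∧⇒ {isEdge ρ H (im z)} h))) , refl
      where
      absurd : ∀ b → b ≡ true → not b ≡ true → ⊥
      absurd true _ ()
  few : E * numRemoved ρ H H′ ≤ n ^ ρ
  few = *-cancelˡ-≤ (2 * (ρ * ρ)) (begin
    2 * (ρ * ρ) * (E * numRemoved ρ H H′) ≡⟨ re₁ (2 * (ρ * ρ)) E (numRemoved ρ H H′) ⟩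
    E * (2 * (ρ * ρ)) * numRemoved ρ H H′ ≤⟨ *-monoʳ-≤ (E * (2 * (ρ * ρ))) (countSub-≤ ρ (λ s → isEdge ρ H s Bool.∧ not (H′ s)) bad? bad-resp cover) ⟩
    E * (2 * (ρ * ρ)) * # (funs ρ n) bad? ≤⟨ lossBound r E≤τ (complete ρ) H φ near bad? (λ { z (ez , ¬c) → edgeT⇒homT ρ H z ez , λ (_ , c) → ¬c c }) ⟩
    2 * (ρ * (ρ * n ^ ρ)) ≡⟨ re₂ ρ (n ^ ρ) ⟩
    2 * (ρ * ρ) * n ^ ρ ∎)
    where
    re₁ : ∀ c E x → c * (E * x) ≡ E * c * x
    re₁ = solve-∀
    re₂ : ∀ r x → 2 * (r * (r * x)) ≡ 2 * (r * r) * x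
    re₂ = solve-∀

edgePart : ∀ {q p} ℓ → 2 ≤ ℓ → ∀ r (Q : RGraph q) (F : RGraph p) → ChromaticNumber F (suc ℓ) → GraphStable ℓ (shadowGraph (suc (suc r)) Q) →
  EdgeStable (suc (suc r)) ℓ Q (expansion (suc (suc r)) F)
edgePart {q} {p} ℓ 2≤ℓ r Q F chrom stable ε 0<ε = build (archimedean ε 0<ε)
  where
  build : (∃ λ E → Σ (NonZero E) λ nz → reciprocal E {{nz}} ℚ.≤ ε) → _
  build (E , E≢0 , inv≤) = convert (heavyCore ℓ 2≤ℓ r Q F chrom stable E′ {{m*n≢0 E _ {{E≢0}}}} E′ 0)
    where
    E′ = E * (2 * (suc (suc r) * suc (suc r)))
    convert : (∃ λ Δ → NonZero Δ × 0 ≤ Δ × ∃ λ τ → E′ ≤ τ × ∃ λ N → HeavyCore ℓ r Q F E′ Δ τ N) → _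
    convert (Δ , Δ≢0 , _ , τ , E′≤τ , N , structure) = reciprocal Δ {{Δ≢0}} , reciprocal-pos Δ {{Δ≢0}} , suc N ,
      λ n N≤n H free near → let n≢0 = ℕ.>-nonZero (≤-trans (s≤s z≤n) N≤n) in
        edgeClose {{n≢0}} ℓ r {E} {ε} {τ} {{E≢0}} inv≤ E′≤τ H
          (structure n n≢0 (≤-trans (n≤1+n N) N≤n) H free (λ M isMax → fromDeficit Δ {{Δ≢0}} (near M isMax)))

-- Turán stability

half-quotient : ∀ {n} ℓ .{{_ : NonZero ℓ}} → 2 * ℓ ≤ n → n ≤ 2 * ℓ * (n ℕ./ ℓ)
half-quotient {n} ℓ big = certify 0 (+-mono-≤ (*-monoʳ-≤ 2 n≤) big) (re ℓ (n ℕ./ ℓ) n)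
  where
  n≤ : n ≤ ℓ + n ℕ./ ℓ * ℓ
  n≤ = ≤-trans (≤-reflexive (DivMod.m≡m%n+[m/n]*n n ℓ)) (+-monoˡ-≤ (n ℕ./ ℓ * ℓ) (<⇒≤ (DivMod.m%n<n n ℓ)))
  re : ∀ l d n → n + (2 * (l + d * l) + n) + 0 ≡ 2 * l * d + (2 * n + 2 * l)
  re = solve-∀

-- The class contains the vertices `c + j * ℓ` with `j < n / ℓ`.
turanClass : ∀ {n} ℓ .{{_ : NonZero ℓ}} (c : Fin ℓ) → n ℕ./ ℓ ≤ # (fins n) (λ i → turanColour ℓ i Fin.≟ c)
turanClass {n} ℓ@(suc k) c = begin
    d ≡⟨ sym (trans (∑-fins-const d 1) (*-identityʳ d)) ⟩
    ∑ (fins d) (λ _ → 1) ≤⟨ ∑-mono (fins d) (λ j → ≤-trans (≤-reflexive (sym (𝟙-yes (toℕ (Fin.fromℕ< (at<n j)) ℕ.≟ at j) (Finₚ.toℕ-fromℕ< (at<n j)))))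
                                     (∑-fins-≥ (Fin.fromℕ< (at<n j)) (λ i → 𝟙 (toℕ i ℕ.≟ at j)))) ⟩
    ∑ (fins d) (λ j → # (fins n) (λ i → toℕ i ℕ.≟ at j)) ≡⟨ ∑-swap (fins d) (fins n) _ ⟩
    ∑ (fins n) (λ i → # (fins d) (λ j → toℕ i ℕ.≟ at j)) ≤⟨ ∑-mono (fins n) (λ i → column i (class? i)) ⟩
    # (fins n) class? ∎
  where
  open ≤-Reasoning
  d = n ℕ./ ℓ
  class? : (i : Fin n) → Dec (turanColour ℓ i ≡ c)
  class? i = turanColour ℓ i Fin.≟ c
  at : Fin d → ℕ
  at j = toℕ c + toℕ j * ℓ
  at<n : ∀ j → at j < n
  at<n j = ≤-trans (+-monoˡ-≤ (toℕ j * ℓ) (Finₚ.toℕ<n c)) (≤-trans (*-monoˡ-≤ ℓ (Finₚ.toℕ<n j))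
    (≤-trans (m≤n+m (d * ℓ) (n ℕ.% ℓ)) (≤-reflexive (sym (DivMod.m≡m%n+[m/n]*n n ℓ)))))
  colour-at : ∀ i j → toℕ i ≡ at j → turanColour ℓ i ≡ c
  colour-at i j e = Finₚ.toℕ-injective (trans (toℕ-turanColour ℓ i) (trans (cong (ℕ._% ℓ) e)
    (trans (DivMod.[m+kn]%n≡m%n (toℕ c) (toℕ j) ℓ) (DivMod.m<n⇒m%n≡m (Finₚ.toℕ<n c)))))
  at-injective : ∀ j j' → at j ≡ at j' → j ≡ j'
  at-injective j j' e = Finₚ.toℕ-injective (*-cancelʳ-≡ _ _ ℓ (+-cancelˡ-≡ (toℕ c) _ _ e))
  column : ∀ i (D : Dec (turanColour ℓ i ≡ c)) → # (fins d) (λ j → toℕ i ℕ.≟ at j) ≤ 𝟙 D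
  column i (yes _) = #-fins≤1 (λ j → toℕ i ℕ.≟ at j) (λ a b p q → at-injective a b (trans (sym p) q))
  column i (no ne) = ≤-trans (≤-reflexive (trans (∑-cong (fins d) (λ j → 𝟙-no (toℕ i ℕ.≟ at j) (λ e → ne (colour-at i j e)))) (∑-zero (fins d)))) z≤n

permutedClass : ∀ {n} ℓ .{{_ : NonZero ℓ}} (π : Permutation′ n) (c : Fin ℓ) → n ℕ./ ℓ ≤ # (fins n) (λ u → permutedColour ℓ π u Fin.≟ c)
permutedClass {n} ℓ π c = subst (n ℕ./ ℓ ≤_) (sym (∑-fins-perm (Perm.flip π) (λ i → 𝟙 (turanColour ℓ i Fin.≟ c)))) (turanClass ℓ c)

permutedClass-large : ∀ {n} ℓ .{{_ : NonZero ℓ}} (π : Permutation′ n) (c : Fin ℓ) → 2 * ℓ ≤ n → n ≤ 2 * ℓ * # (fins n) (λ u → permutedColour ℓ π u Fin.≟ c)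
permutedClass-large ℓ π c big = ≤-trans (half-quotient ℓ big) (*-monoʳ-≤ (2 * ℓ) (permutedClass ℓ π c))

emptyGraph : Graph n
emptyGraph .Adj _ _ = ⊥
emptyGraph .adj? _ _ = no id
emptyGraph .symm ()
emptyGraph .irr ()

-- If `R` has no edge, all graphs on `n` vertices have the same count and the empty graph is
-- extremal; yet it misses every pair between two Turán classes of size at least `n / (2 * ℓ)`. The
-- edge of `Q` obtained from this is what later detects missing edges of `H`.
turanStable⇒edge : ∀ {q} ℓ .{{_ : NonZero ℓ}} → 2 ≤ ℓ → (R : Graph q) → GraphTuranStable ℓ R → ¬ (∀ u v → ¬ Adj R u v)
turanStable⇒edge {q} ℓ@(suc (suc _)) 2≤ℓ R stable noEdge = contra (stable (suc (2 * ℓ * (2 * ℓ))))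
  where
  contra : (∃ λ D → NonZero D × ∃ λ N → ∀ n → N ≤ n → (G : Graph n) → KFree ℓ G → (∀ M → IsMax ℓ R n M → D * M ≤ D * injHom R G + M) →
    Σ (Permutation′ n) λ π → suc (2 * ℓ * (2 * ℓ)) * pairs _ (differ? G (permutedColour ℓ π)) ≤ n * n) → ⊥
  contra (D , _ , N , close) = tooMany (close size (m≤m+n N _) emptyGraph (λ { (f , h) → h zero (suc zero) (λ ()) })
      (λ { M ((G′ , _ , refl) , _) → ≤-trans (*-monoʳ-≤ D (#-mono (funs q size) (InjHom? R G′) (InjHom? R emptyGraph)
        (λ { f (i , _) → i , λ u v a → noEdge u v a }))) (m≤m+n _ _) }))
    where
    size = N + 2 * ℓ
    tooMany : (Σ (Permutation′ size) λ π → suc (2 * ℓ * (2 * ℓ)) * pairs _ (differ? emptyGraph (permutedColour ℓ π)) ≤ size * size) → ⊥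
    tooMany (π , few) = <-irrefl refl (begin-strict
      size * size ≤⟨ *-mono-≤ (permutedClass-large ℓ π zero (m≤n+m _ N)) (permutedClass-large ℓ π (suc zero) (m≤n+m _ N)) ⟩
      2 * ℓ * α * (2 * ℓ * β) ≡⟨ re (2 * ℓ) α β ⟩
      2 * ℓ * (2 * ℓ) * (α * β) ≤⟨ *-monoʳ-≤ (2 * ℓ * (2 * ℓ)) product≤ ⟩
      2 * ℓ * (2 * ℓ) * δ <⟨ *-monoˡ-< δ {{ℕ.>-nonZero (≤-trans αβ≥1 product≤)}} (n<1+n (2 * ℓ * (2 * ℓ))) ⟩
      suc (2 * ℓ * (2 * ℓ)) * δ ≤⟨ few ⟩
      size * size ∎)
      where
      open ≤-Reasoning
      κ : Fin size → Fin ℓ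
      κ = permutedColour ℓ π
      α = # (fins size) (λ u → κ u Fin.≟ zero)
      β = # (fins size) (λ v → κ v Fin.≟ suc zero)
      δ = pairs _ (differ? emptyGraph κ)
      re : ∀ l a b → l * a * (l * b) ≡ l * l * (a * b)
      re = solve-∀
      size≥1 : 1 ≤ size
      size≥1 = ≤-trans (s≤s z≤n) (m≤n+m (2 * ℓ) N)
      αβ≥1 : 1 ≤ α * β
      αβ≥1 = *-mono-≤ {1} {α} {1} {β} (positive {2 * ℓ} {α} (≤-trans size≥1 (permutedClass-large ℓ π zero (m≤n+m _ N)))) (positive {2 * ℓ} {β} (≤-trans size≥1 (permutedClass-large ℓ π (suc zero) (m≤n+m _ N))))
      product≤ : α * β ≤ δ
      product≤ = begin
        α * β ≡⟨ sym (∑-*ʳ (fins size) β _) ⟩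
        ∑ (fins size) (λ u → 𝟙 (κ u Fin.≟ zero) * β) ≡⟨ ∑-cong (fins size) (λ u → sym (∑-*ˡ (fins size) (𝟙 (κ u Fin.≟ zero)) _)) ⟩
        ∑ (fins size) (λ u → ∑ (fins size) (λ v → 𝟙 (κ u Fin.≟ zero) * 𝟙 (κ v Fin.≟ suc zero)))
          ≤⟨ ∑-mono (fins size) (λ u → ∑-mono (fins size) (λ v → ≤-trans
               (≤-reflexive (sym (𝟙-× ((κ u Fin.≟ zero) ×-dec (κ v Fin.≟ suc zero)) (κ u Fin.≟ zero) (κ v Fin.≟ suc zero) _,_ id)))
               (𝟙-mono ((κ u Fin.≟ zero) ×-dec (κ v Fin.≟ suc zero)) (differ? emptyGraph κ u v) (λ (p , p′) → (λ e → Finₚ.0≢1+n (trans (sym p) (trans (cong κ e) p′))) ,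
                 inj₂ (id , λ e → Finₚ.0≢1+n (trans (sym p) (trans e p′)))))) ) ⟩
        δ ∎
turanStable⇒edge (suc zero) (s≤s ()) R stable noEdge

-- Permute the colours to match y on the image of z, then choose the other vertices freely inside the classes.
rainbowExtensions : ∀ {q n ℓ} a ρ (R : Graph q) (κ : Fin n → Fin ℓ) → a ≤ n → (∀ c → a ≤ # (fins n) (λ u → κ u Fin.≟ c)) →
  (ψ : Fin q → Fin ℓ) → Colouring R ℓ ψ → (z : Fin ρ → Fin q) → Inj z → Inj (ψ ∘ z) → (y : Fin ρ → Fin n) → Inj (κ ∘ y) →
  a ^ q ≤ # (funs q n) (λ f → (y ≗? (f ∘ z)) ×-dec Hom? R (partite κ) f) * n ^ ρ
rainbowExtensions {q} {n} {ℓ} a ρ R κ a≤n classes ψ ψ-col z z-inj ψz-inj y κy-inj = recolour (extendPerm (ψ ∘ z) (κ ∘ y) ψz-inj κy-inj)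
  where
  open ≤-Reasoning
  recolour : (Σ (Permutation′ ℓ) λ θ → ∀ i → θ ⟨$⟩ʳ ψ (z i) ≡ κ (y i)) → _
  recolour (θ , match) = begin
    a ^ q ≡⟨ sym (∏-const q a) ⟩
    ∏ q (λ _ → a) ≤⟨ ∏-mono q (λ v → coord v (Finₚ.any? (λ i → z i Fin.≟ v))) ⟩
    ∏ q (λ v → # (fins n) (Slot? v) * n ^ hits v) ≡⟨ ∏-* q _ _ ⟩
    ∏ q (λ v → # (fins n) (Slot? v)) * ∏ q (λ v → n ^ hits v)
      ≡⟨ cong₂ _*_ (sym (trans (∑-cong (funs q n) (λ f → 𝟙-∀ (λ v → Slot? v (f v)) (Finₚ.all? (λ v → Slot? v (f v))) id id)) (∑-∏ q n (λ v x → 𝟙 (Slot? v x)))))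
           (trans (∏-^ q n hits) (cong (n ^_) total)) ⟩
    # (funs q n) (λ f → Finₚ.all? (λ v → Slot? v (f v))) * n ^ ρ
      ≤⟨ *-monoˡ-≤ (n ^ ρ) (#-mono (funs q n) (λ f → Finₚ.all? (λ v → Slot? v (f v))) (λ f → (y ≗? (f ∘ z)) ×-dec Hom? R (partite κ) f) good) ⟩
    # (funs q n) (λ f → (y ≗? (f ∘ z)) ×-dec Hom? R (partite κ) f) * n ^ ρ ∎
    where
    Slot : Fin q → Fin n → Set
    Slot v x = κ x ≡ θ ⟨$⟩ʳ ψ v × (∀ i → z i ≡ v → y i ≡ x)
    Slot? : ∀ v x → Dec (Slot v x)
    Slot? v x = (κ x Fin.≟ θ ⟨$⟩ʳ ψ v) ×-dec Finₚ.all? (λ i → (z i Fin.≟ v) →-dec (y i Fin.≟ x))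
    good : ∀ f → (∀ v → Slot v (f v)) → (y ≗ (f ∘ z)) × Hom R (partite κ) f
    good f b = (λ i → proj₂ (b (z i)) i refl) ,
      λ u v adj e → ψ-col u v adj (perm-injective θ _ _ (trans (sym (proj₁ (b u))) (trans e (proj₁ (b v)))))
    hits : Fin q → ℕ
    hits v = # (fins ρ) (λ i → z i Fin.≟ v)
    total : ∑ (fins q) hits ≡ ρ
    total = trans (∑-swap (fins q) (fins ρ) _) (trans (∑-cong (fins ρ) (λ i → ∑-fins-unique (λ v → z i Fin.≟ v) (z i) refl (λ _ → sym))) (trans (∑-fins-const ρ 1) (*-identityʳ ρ)))
    -- A vertex on `z` has one admissible value, and the factor `n ≥ a` stands in for the lost
    -- choices; any other vertex ranges over a whole class.
    coord : ∀ v → Dec (∃ λ i → z i ≡ v) → a ≤ # (fins n) (Slot? v) * n ^ hits v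
    coord v (yes (i , refl)) = ≤-trans a≤n (≤-trans (≤-reflexive (trans (sym (*-identityʳ n)) (sym (*-identityˡ _))))
      (*-mono-≤ {1} (≤-trans (≤-reflexive (sym (𝟙-yes (Slot? (z i) (y i)) (sym (match i) , λ j e → cong y (z-inj j i e))))) (∑-fins-≥ (y i) (λ x → 𝟙 (Slot? (z i) x))))
        (≤-reflexive (cong (n ^_) (sym (∑-fins-unique (λ j → z j Fin.≟ z i) i refl (λ j e → z-inj j i e)))))))
    coord v (no none) = ≤-trans (classes (θ ⟨$⟩ʳ ψ v)) (≤-trans
      (#-mono (fins n) (λ x → κ x Fin.≟ θ ⟨$⟩ʳ ψ v) (Slot? v) (λ x e → e , λ i h → ⊥-elim (none (i , h))))
      (≤-reflexive (sym (trans (cong (λ k → # (fins n) (Slot? v) * n ^ k) (trans (∑-cong (fins ρ) (λ i → 𝟙-no (z i Fin.≟ v) (λ e → none (i , e)))) (∑-zero (fins ρ)))) (*-identityʳ _)))))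

meet : Graph n → Graph n → Graph n
meet G J .Adj u v = Adj G u v × Adj J u v
meet G J .adj? u v = adj? G u v ×-dec adj? J u v
meet G J .symm (a , b) = symm G a , symm J b
meet G J .irr (a , _) = irr G a

meet-KFree : ∀ {ℓ} (G : Graph n) (φ : Fin n → Fin ℓ) → KFree ℓ (meet G (partite φ))
meet-KFree G φ (f , h) = partite-KFree φ (f , λ u v ne → proj₂ (h u v ne))

-- Comparison of the graph and the r-graph extremal numbers, through ℓ-partite graphs.
meetNearMax : ∀ {q p ℓ n r D D₁ E τ M Mx} .{{_ : NonZero n}} .{{_ : NonZero ℓ}} (Q : RGraph q) (F : RGraph p) (H : RGraph n) (φ : Fin n → Fin ℓ) →
  let R = shadowGraph (suc (suc r)) Q in
  ¬ Colorable F ℓ → Colourable R ℓ → 2 * suc (q * q) ≤ n →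
  (∀ (G : Graph n) → KFree ℓ G → (∀ M → IsMax ℓ R n M → D₁ * M ≤ D₁ * injHom R G + M) → NearColourable E ℓ G) →
  D * (suc (3 * (q * q)) * (2 * ℓ ^ q)) ≤ E → E ≤ τ → E * mono (heavy r τ H) φ ≤ n * n →
  IsInjMax (suc (suc r)) n Q (expansion (suc (suc r)) F) Mx → E * Mx ≤ E * inj (suc (suc r)) Q H + Mx → IsMax ℓ R n M →
  D * M ≤ D * injHom R (meet (heavy r τ H) (partite φ)) + M
meetNearMax {q} {p} {ℓ} {n} {r} {D} {D₁} {E} {τ} {M} {Mx} Q F H φ unc col big near E≥ E≤τ few isInjMax nearMax isMax@((J , Jfree , eM) , top) =
  *-cancelʳ-≤ _ _ κ (begin
    D * M * κ ≡⟨ re₁ D M κ ⟩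
    D * κ * M ≤⟨ weaken E≥ (begin
      E * M ≤⟨ viaPartite ⟩
      E * Mx + L ≤⟨ +-monoˡ-≤ L (≤-trans nearMax (+-monoʳ-≤ _ Mx≤)) ⟩
      E * I + W + L ≤⟨ +-monoˡ-≤ L (+-monoˡ-≤ W viaMeet) ⟩
      E * g + 2 * L + W + L ≡⟨ re₂ (E * g) q W ⟩
      E * g + suc (3 * (q * q)) * W ≤⟨ +-monoʳ-≤ (E * g) (*-monoʳ-≤ (suc (3 * (q * q))) W≤) ⟩
      E * g + suc (3 * (q * q)) * (2 * ℓ ^ q * M) ≡⟨ cong (λ x → E * g + x) (sym (*-assoc (suc (3 * (q * q))) (2 * ℓ ^ q) M)) ⟩
      E * g + κ * M ∎) ⟩
    D * κ * g + κ * M ≡⟨ re₃ D κ g M ⟩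
    (D * g + M) * κ ∎)
  where
  open ≤-Reasoning
  ρ = suc (suc r)
  R = shadowGraph ρ Q
  G = heavy r τ H
  -- Three losses `L` and one term `Mx ≤ W` add up to `suc (3 * (q * q)) * W`, and `W` is at most
  -- `2 * ℓ ^ q * M`.
  κ = suc (3 * (q * q)) * (2 * ℓ ^ q)
  W = n ^ q
  L = q * (q * W)
  I = inj ρ Q H
  g = injHom R (meet G (partite φ))
  instance κ≢0 = m*n≢0 (suc (3 * (q * q))) (2 * ℓ ^ q) {{_}} {{m*n≢0 2 (ℓ ^ q) {{_}} {{m^n≢0 ℓ q}}}}
  re₁ : ∀ D M k → D * M * k ≡ D * k * M
  re₁ = solve-∀
  re₂ : ∀ x q W → x + 2 * (q * (q * W)) + W + q * (q * W) ≡ x + (1 + 3 * (q * q)) * W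
  re₂ = solve-∀
  re₃ : ∀ D k g M → D * k * g + k * M ≡ (D * g + M) * k
  re₃ = solve-∀
  bounded : (Σ (RGraph n) λ H′ → Free ρ (expansion ρ F) H′ × inj ρ Q H′ ≡ Mx) → Mx ≤ n ^ q
  bounded (H′ , _ , refl) = inj≤ ρ Q H′
  Mx≤ : Mx ≤ W
  Mx≤ = bounded (proj₁ isInjMax)
  W≤ : W ≤ 2 * ℓ ^ q * M
  W≤ = maxBound R col big (λ χ → top (partite χ) (partite-KFree χ))
  viaPartite : E * M ≤ E * Mx + L
  viaPartite = let (χ , nearχ) = near J Jfree (λ M′ max′ → ≤-trans (≤-reflexive (cong (D₁ *_) (trans (isMax-unique {R = R} max′ isMax) (sym eM)))) (m≤m+n _ M′)) in
    ≤-trans (≤-reflexive (cong (E *_) (sym eM))) (≤-trans (colourLoss E R J χ nearχ)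
      (+-monoˡ-≤ L (*-monoʳ-≤ E (≤-trans (injHom≤inj ρ Q (partite χ)) (proj₂ isInjMax (toR (partite χ)) (partite-expansionFree F r unc χ))))))
  lost? = λ f → injPres? ρ Q H f ×-dec ¬? (Hom? R (meet G (partite φ)) f)
  split : ∀ f → InjPres ρ Q H f → Dec (Hom R (meet G (partite φ)) f) → InjHom R (meet G (partite φ)) f ⊎ (InjPres ρ Q H f × ¬ Hom R (meet G (partite φ)) f)
  split f p (yes h) = inj₁ (proj₁ (injPres⇒ ρ Q H f p) , h)
  split f p (no ¬h) = inj₂ (p , ¬h)
  viaMeet : E * I ≤ E * g + 2 * L
  viaMeet = begin
    E * I ≡⟨ cong (E *_) (inj-# ρ Q H) ⟩
    E * # (funs q n) (injPres? ρ Q H)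
      ≤⟨ *-monoʳ-≤ E (#-⊎ (funs q n) (injPres? ρ Q H) (InjHom? R (meet G (partite φ))) lost? (λ f p → split f p (Hom? R (meet G (partite φ)) f))) ⟩
    E * (g + # (funs q n) lost?) ≡⟨ *-distribˡ-+ E g _ ⟩
    E * g + E * # (funs q n) lost? ≤⟨ +-monoʳ-≤ (E * g) (lossBound r E≤τ Q H φ few lost?
       (λ { f (p , ¬h) → proj₂ (injPres⇒ ρ Q H f p) , λ (a , b) → ¬h (λ u v e → a u v e , b u v e) })) ⟩
    E * g + 2 * L ∎

-- Leaving the graph of heavy bichromatic pairs costs `2 * (q * q)`, and the edges of that graph
-- inside Turán classes cost one more `q * q`.
turanLoss : ∀ {q n ℓ} .{{_ : NonZero n}} r {E τ} → E ≤ τ → (Q : RGraph q) (H : RGraph n) (φ κ : Fin n → Fin ℓ) → E * mono (heavy r τ H) φ ≤ n * n →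
  E * pairs _ (differ? (meet (heavy r τ H) (partite φ)) κ) ≤ n * n →
  {X : (Fin q → Fin n) → Set} (X? : ∀ f → Dec (X f)) →
  (∀ f → X f → HomT (suc (suc r)) Q H f × ¬ Hom (shadowGraph (suc (suc r)) Q) (partite κ) f) → E * # (funs q n) X? ≤ 3 * (q * (q * n ^ q))
turanLoss {q} {n} r {E} {τ} E≤τ Q H φ κ few close {X} X? lost = begin
  E * # (funs q n) X? ≤⟨ *-monoʳ-≤ E (#-⊎ (funs q n) X? far? mono′ (λ f x → split f x (Hom? R G f))) ⟩
  E * (# (funs q n) far? + # (funs q n) mono′) ≡⟨ *-distribˡ-+ E _ _ ⟩
  E * # (funs q n) far? + E * # (funs q n) mono′
    ≤⟨ +-mono-≤ (lossBound r E≤τ Q H φ few far? (λ { f (x , ¬h) → proj₁ (lost f x) , λ (a , b) → ¬h (λ u v e → a u v e , b u v e) }))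
         (monoLoss E R G κ (≤-trans (*-monoʳ-≤ E (∑-mono (fins n) (λ u → #-mono (fins n) (mono? G κ u) (differ? G κ u) (λ { v (a , e) → irr G a , inj₁ (a , e) })))) close)) ⟩
  2 * (q * (q * n ^ q)) + q * (q * n ^ q) ≡⟨ re (q * (q * n ^ q)) ⟩
  3 * (q * (q * n ^ q)) ∎
  where
  open ≤-Reasoning
  R = shadowGraph (suc (suc r)) Q
  G = meet (heavy r τ H) (partite φ)
  far? = λ f → X? f ×-dec ¬? (Hom? R G f)
  mono′ = λ f → Hom? R G f ×-dec ¬? (Hom? R (partite κ) f)
  split : ∀ f → X f → Dec (Hom R G f) → (X f × ¬ Hom R G f) ⊎ (Hom R G f × ¬ Hom R (partite κ) f)
  split f x (yes h) = inj₂ (h , proj₂ (lost f x))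
  split f x (no ¬h) = inj₁ (x , ¬h)
  re : ∀ x → 2 * x + x ≡ 3 * x
  re = solve-∀

missing? : ∀ {ℓ} ρ (H : RGraph n) (κ : Fin n → Fin ℓ) (y : Fin ρ → Fin n) → Dec (Hom (K ρ) (partite κ) y × ¬ EdgeT H y)
missing? ρ H κ y = Hom? (K ρ) (partite κ) y ×-dec ¬? (edgeT? H y)

missing-resp : ∀ {ℓ} ρ (H : RGraph n) (κ : Fin n → Fin ℓ) → Resp (λ (y : Fin ρ → Fin n) → Hom (K ρ) (partite κ) y × ¬ EdgeT H y)
missing-resp ρ H κ e (h , ¬h) = Hom-resp (K ρ) (partite κ) e h , λ t → ¬h (edgeT-resp H (λ i → sym (e i)) t)

-- Double counting of missing tuples `y` and rainbow maps extending them: each `y` has at least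
-- `a ^ q / n ^ ρ` extensions by `rainbowExtensions`, and a map determines `y` as `f ∘ z`.
missingExtensions : ∀ {q n ℓ} a ρ (Q : RGraph q) (H : RGraph n) (κ : Fin n → Fin ℓ) → a ≤ n → (∀ c → a ≤ # (fins n) (λ u → κ u Fin.≟ c)) →
  Colourable (shadowGraph ρ Q) ℓ → (z : Fin ρ → Fin q) → EdgeT Q z →
  # (funs ρ n) (missing? ρ H κ) * a ^ q ≤ # (funs q n) (λ f → Hom? (shadowGraph ρ Q) (partite κ) f ×-dec ¬? (edgeT? H (f ∘ z))) * n ^ ρ
missingExtensions {q} {n} {ℓ} a ρ Q H κ a≤n classes (ψ , ψ-col) z ez = begin
  # (funs ρ n) (missing? ρ H κ) * a ^ q ≡⟨ sym (∑-*ʳ (funs ρ n) (a ^ q) _) ⟩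
  ∑ (funs ρ n) (λ y → 𝟙 (missing? ρ H κ y) * a ^ q) ≤⟨ ∑-mono (funs ρ n) (λ y → point y (missing? ρ H κ y)) ⟩
  ∑ (funs ρ n) (λ y → ∑ (funs q n) (λ f → 𝟙 (y ≗? (f ∘ z)) * 𝟙 (target? f)) * n ^ ρ) ≡⟨ ∑-*ʳ (funs ρ n) (n ^ ρ) _ ⟩
  ∑ (funs ρ n) (λ y → ∑ (funs q n) (λ f → 𝟙 (y ≗? (f ∘ z)) * 𝟙 (target? f))) * n ^ ρ ≡⟨ cong (_* n ^ ρ) (trans (∑-swap (funs ρ n) (funs q n) _)
     (∑-cong (funs q n) (λ f → ∑-δ ρ n (λ _ → 𝟙 (target? f)) (λ _ → refl) (f ∘ z)))) ⟩
  # (funs q n) target? * n ^ ρ ∎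
  where
  open ≤-Reasoning
  R = shadowGraph ρ Q
  target? : (f : Fin q → Fin n) → Dec (Hom R (partite κ) f × ¬ EdgeT H (f ∘ z))
  target? f = Hom? R (partite κ) f ×-dec ¬? (edgeT? H (f ∘ z))
  ψz-inj : Inj (ψ ∘ z)
  ψz-inj i j e = decidable-stable (i Fin.≟ j) (λ ne → ψ-col _ _ (shadow⇐ ρ Q z ez i j ne) e)
  point : ∀ y (d : Dec (Hom (K ρ) (partite κ) y × ¬ EdgeT H y)) → 𝟙 d * a ^ q ≤ ∑ (funs q n) (λ f → 𝟙 (y ≗? (f ∘ z)) * 𝟙 (target? f)) * n ^ ρ
  point y (no _) = z≤n
  point y (yes (rb , ¬e)) = ≤-trans (≤-reflexive (*-identityˡ (a ^ q))) (≤-trans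
    (rainbowExtensions a ρ R κ a≤n classes ψ ψ-col z (proj₁ ez) ψz-inj y (λ i j e → decidable-stable (i Fin.≟ j) (λ ne → rb i j ne e)))
    (*-monoˡ-≤ (n ^ ρ) (∑-mono (funs q n) (λ f → ≤-trans
      (𝟙-mono ((y ≗? (f ∘ z)) ×-dec Hom? R (partite κ) f) ((y ≗? (f ∘ z)) ×-dec target? f) (λ (e , h) → e , h , λ t → ¬e (edgeT-resp H (λ i → sym (e i)) t)))
      (≤-reflexive (𝟙-× ((y ≗? (f ∘ z)) ×-dec target? f) (y ≗? (f ∘ z)) (target? f) _,_ id))))))

-- There are hardly more than `Mx` maps rainbow for `κ`, since the complete ℓ-partite r-graph is
-- expansion-free. Nearly all of the almost `Mx` embeddings of `Q` into `H` are among them, and none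
-- of these sends `z` to a missing tuple; so few maps can do that.
missingFew : ∀ {q p n ℓ} r {E τ Mx} .{{_ : NonZero n}} .{{_ : NonZero ℓ}} (Q : RGraph q) (F : RGraph p) (H : RGraph n) (φ : Fin n → Fin ℓ) (π : Permutation′ n) →
  let κ = permutedColour ℓ π in
  ¬ Colorable F ℓ → Colourable (shadowGraph (suc (suc r)) Q) ℓ → (z : Fin (suc (suc r)) → Fin q) → EdgeT Q z → 2 * ℓ ≤ n → E ≤ n →
  E ≤ τ → E * mono (heavy r τ H) φ ≤ n * n → E * pairs _ (differ? (meet (heavy r τ H) (partite φ)) κ) ≤ n * n →
  IsInjMax (suc (suc r)) n Q (expansion (suc (suc r)) F) Mx → E * Mx ≤ E * inj (suc (suc r)) Q H + Mx →
  E * # (funs (suc (suc r)) n) (missing? (suc (suc r)) H κ) ≤ (2 * ℓ) ^ q * suc (4 * (q * q)) * n ^ suc (suc r)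
missingFew {q} {p} {n} {ℓ} r {E} {τ} {Mx} Q F H φ π unc col z ez ℓ-big E≤n E≤τ few close isInjMax nearMax = *-cancelʳ-≤ _ _ W (begin
  E * μ * W ≤⟨ *-monoʳ-≤ (E * μ) (≤-trans (^-monoˡ-≤ q a-big) (≤-reflexive (*-^ q (2 * ℓ) a))) ⟩
  E * μ * (β * a ^ q) ≡⟨ re₁ E μ β (a ^ q) ⟩
  E * β * (μ * a ^ q) ≤⟨ *-monoʳ-≤ (E * β) (missingExtensions a ρ Q H κ a≤n classes col z ez) ⟩
  E * β * (ν * n ^ ρ) ≡⟨ re₂ E β ν (n ^ ρ) ⟩
  β * n ^ ρ * (E * ν) ≤⟨ *-monoʳ-≤ (β * n ^ ρ) ν-few ⟩
  β * n ^ ρ * (suc (4 * (q * q)) * W) ≡⟨ re₃ β (n ^ ρ) (suc (4 * (q * q))) W ⟩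
  β * suc (4 * (q * q)) * n ^ ρ * W ∎)
  where
  open ≤-Reasoning
  ρ = suc (suc r)
  R = shadowGraph ρ Q
  κ = permutedColour ℓ π
  W = n ^ q
  β = (2 * ℓ) ^ q
  μ = # (funs ρ n) (missing? ρ H κ)
  instance W≢0 = m^n≢0 n q
  a = n ℕ./ ℓ
  a≤n : a ≤ n
  a≤n = DivMod.m/n≤m n ℓ
  a-big : n ≤ 2 * ℓ * a
  a-big = half-quotient ℓ ℓ-big
  classes : ∀ c → a ≤ # (fins n) (λ u → κ u Fin.≟ c)
  classes = permutedClass ℓ π
  re₁ : ∀ E m β x → E * m * (β * x) ≡ E * β * (m * x)
  re₁ = solve-∀
  re₂ : ∀ E β v x → E * β * (v * x) ≡ β * x * (E * v)
  re₂ = solve-∀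
  re₃ : ∀ β x s W → β * x * (s * W) ≡ β * s * x * W
  re₃ = solve-∀
  L = q * (q * W)
  I = inj ρ Q H
  target? = λ (f : Fin q → Fin n) → Hom? R (partite κ) f ×-dec ¬? (edgeT? H (f ∘ z))
  kept? = λ (f : Fin q → Fin n) → injPres? ρ Q H f ×-dec Hom? R (partite κ) f
  lost? = λ (f : Fin q → Fin n) → injPres? ρ Q H f ×-dec ¬? (Hom? R (partite κ) f)
  ν = # (funs q n) target?
  Y = # (funs q n) kept?
  disjoint : Y + ν ≤ hom R (partite κ)
  disjoint = ≤-trans (≤-reflexive (sym (∑-+ (funs q n) _ _))) (∑-mono (funs q n) (λ f → 𝟙-disjoint (kept? f) (target? f) (Hom? R (partite κ) f) proj₂ proj₁
    (λ (p , _) (_ , ¬e) → ¬e (proj₂ (injPres⇒ ρ Q H f p) z ez))))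
  homs : E * hom R (partite κ) ≤ E * Mx + L
  homs = ≤-trans (injPart {q} E E≤n (Hom? R (partite κ))) (+-monoˡ-≤ L (*-monoʳ-≤ E
    (≤-trans (injHom≤inj ρ Q (partite κ)) (proj₂ isInjMax (toR (partite κ)) (partite-expansionFree F r unc κ)))))
  bounded : (Σ (RGraph n) λ H′ → Free ρ (expansion ρ F) H′ × inj ρ Q H′ ≡ Mx) → Mx ≤ n ^ q
  bounded (H′ , _ , refl) = inj≤ ρ Q H′
  split : ∀ f → InjPres ρ Q H f → Dec (Hom R (partite κ) f) → (InjPres ρ Q H f × Hom R (partite κ) f) ⊎ (InjPres ρ Q H f × ¬ Hom R (partite κ) f)
  split f p (yes h) = inj₁ (p , h)
  split f p (no ¬h) = inj₂ (p , ¬h)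
  I≤ : E * I ≤ E * Y + 3 * L
  I≤ = begin
    E * I ≡⟨ cong (E *_) (inj-# ρ Q H) ⟩
    E * # (funs q n) (injPres? ρ Q H) ≤⟨ *-monoʳ-≤ E (#-⊎ (funs q n) (injPres? ρ Q H) kept? lost? (λ f p → split f p (Hom? R (partite κ) f))) ⟩
    E * (Y + # (funs q n) lost?) ≡⟨ *-distribˡ-+ E Y _ ⟩
    E * Y + E * # (funs q n) lost? ≤⟨ +-monoʳ-≤ (E * Y) (turanLoss r E≤τ Q H φ κ few close lost? (λ { f (p , ¬h) → proj₂ (injPres⇒ ρ Q H f p) , ¬h })) ⟩
    E * Y + 3 * L ∎
  ν-few : E * ν ≤ suc (4 * (q * q)) * W
  -- One `q * q` is for non-injective maps and three come from `turanLoss`; the final 1 is the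
  -- deficit of `H`, as `Mx` is at most `W`.
  ν-few = certify 0 (+-mono-≤ (*-monoʳ-≤ E disjoint) (+-mono-≤ homs (+-mono-≤ nearMax (+-mono-≤ I≤ (bounded (proj₁ isInjMax))))))
    (re E ν Y (hom R (partite κ)) Mx I q W)
    where
    re : ∀ E v Y h M I q W → E * v + (E * h + (E * M + q * (q * W) + (E * I + M + (E * Y + 3 * (q * (q * W)) + W)))) + 0
      ≡ (1 + 4 * (q * q)) * W + (E * (Y + v) + (E * h + (E * M + (E * I + M))))
    re = solve-∀

extra? : ∀ {ℓ} ρ (H : RGraph n) (κ : Fin n → Fin ℓ) (y : Fin ρ → Fin n) → Dec (EdgeT H y × ¬ Hom (shadowGraph ρ (complete ρ)) (partite κ) y)
extra? ρ H κ y = edgeT? H y ×-dec ¬? (Hom? (shadowGraph ρ (complete ρ)) (partite κ) y)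

turanCount : ∀ {n ℓ} .{{_ : NonZero ℓ}} ρ (H : RGraph n) (π : Permutation′ n) →
  countSub (λ s → isSize ρ s Bool.∧ (isEdge ρ H (image (π ⟨$⟩ʳ_) s) Bool.xor turan ρ n ℓ s))
    ≤ # (funs ρ n) (extra? ρ H (permutedColour ℓ π)) + # (funs ρ n) (missing? ρ H (permutedColour ℓ π))
turanCount {n} {ℓ} ρ H π = begin
  countSub edited ≤⟨ countSub-≤ ρ edited (λ z → X? (λ i → σ (z i))) (λ e → X-resp (λ i → cong σ (e i))) cover ⟩
  # (funs ρ n) (λ z → X? (λ i → σ (z i))) ≡⟨ ∑-funs-perm π ρ (λ z → 𝟙 (X? z)) (𝟙-ext X? X-resp) ⟩
  # (funs ρ n) X? ≤⟨ #-⊎ (funs ρ n) X? (extra? ρ H κ) (missing? ρ H κ) (λ _ → id) ⟩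
  # (funs ρ n) (extra? ρ H κ) + # (funs ρ n) (missing? ρ H κ) ∎
  where
  open ≤-Reasoning
  κ = permutedColour ℓ π
  σ = π ⟨$⟩ʳ_
  Rρ = shadowGraph ρ (complete ρ)
  edited : Subset n → Bool
  edited s = isSize ρ s Bool.∧ (isEdge ρ H (image σ s) Bool.xor turan ρ n ℓ s)
  X? = λ y → extra? ρ H κ y ⊎-dec missing? ρ H κ y
  X-resp : Resp (λ y → (EdgeT H y × ¬ Hom Rρ (partite κ) y) ⊎ (Hom (K ρ) (partite κ) y × ¬ EdgeT H y))
  X-resp e (inj₁ (h , ¬c)) = inj₁ (edgeT-resp H e h , λ c → ¬c (Hom-resp Rρ (partite κ) (λ i → sym (e i)) c))
  X-resp e (inj₂ m) = inj₂ (missing-resp ρ H κ e m)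
  κσ : ∀ x → κ (σ x) ≡ turanColour ℓ x
  κσ x = cong (turanColour ℓ) (Perm.inverseˡ π)
  cover : ∀ s → edited s ≡ true → ∃ λ z → ((EdgeT H (λ i → σ (z i)) × ¬ Hom Rρ (partite κ) (λ i → σ (z i))) ⊎
    (Hom (K ρ) (partite κ) (λ i → σ (z i)) × ¬ EdgeT H (λ i → σ (z i)))) × im z ≡ s
  cover s h = tuple (edge⇒tuple ρ (λ _ → true) s (∧⇐ (proj₁ (∧⇒ {isSize ρ s} h)) refl)) (proj₂ (∧⇒ {isSize ρ s} h))
    where
    tuple : (∃ λ (z : Fin ρ → Fin n) → EdgeT (λ _ → true) z × im z ≡ s) → (isEdge ρ H (image σ s) Bool.xor turan ρ n ℓ s) ≡ true → _
    tuple (z , (z-inj , _) , refl) x = z , cases (xor⇒ x) , refl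
      where
      σz-inj : Inj (λ i → σ (z i))
      σz-inj i j e = z-inj i j (perm-injective π _ _ e)
      cases : (isEdge ρ H (image σ (im z)) ≡ true × ¬ (turan ρ n ℓ (im z) ≡ true)) ⊎ (¬ (isEdge ρ H (image σ (im z)) ≡ true) × turan ρ n ℓ (im z) ≡ true) → _
      cases (inj₁ (e , ¬t)) = inj₁ ((σz-inj , subst (λ s → H s ≡ true) (sym (image-im σ z)) (proj₂ (isEdge⇒ ρ H _ e))) ,
        λ c → ¬t (trans (turan-toR ρ ℓ (im z)) (proj₂ (cliqueT⇐ (partite (turanColour ℓ)) z
          (λ i j ne p → c i j (shadow-complete ρ i j ne) (trans (κσ (z i)) (trans p (sym (κσ (z j))))))))))
      cases (inj₂ (¬e , t)) = inj₂ ((λ i j ne p → cliqueT⇒ (partite (turanColour ℓ)) z (z-inj , trans (sym (turan-toR ρ ℓ (im z))) t) i j ne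
          (trans (sym (κσ (z i))) (trans p (κσ (z j))))) ,
        λ te → ¬e (subst (λ s → isEdge ρ H s ≡ true) (image-im σ z) (tuple⇒edge ρ H (λ i → σ (z i)) te)))

turanPart : ∀ {q p} ℓ → 2 ≤ ℓ → .{{_ : NonZero ℓ}} → ∀ r (Q : RGraph q) (F : RGraph p) → ChromaticNumber F (suc ℓ) → GraphTuranStable ℓ (shadowGraph (suc (suc r)) Q) →
  TuranStable (suc (suc r)) ℓ Q (expansion (suc (suc r)) F)
turanPart {q} {p} ℓ 2≤ℓ r Q F chrom stable ε 0<ε = withEdge (anyFun? (edgeT? Q) (edgeT-resp Q))
  where
  ρ = suc (suc r)
  R = shadowGraph ρ Q
  graphStable : GraphStable ℓ R
  graphStable = graphTuran⇒graphStable ℓ R stable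
  col : Colourable R ℓ
  col = stable⇒colourable ℓ 2≤ℓ R graphStable
  unc : ¬ Colorable F ℓ
  unc = proj₂ chrom
  -- The first summand pays for edges of `H` that are not rainbow, by `turanLoss` for the
  -- single-edge r-graph; the second pays for missing ones, by `missingFew`.
  C = 3 * (ρ * ρ) + (2 * ℓ) ^ q * suc (4 * (q * q))
  κ₀ = suc (3 * (q * q)) * (2 * ℓ ^ q)
  withEdge : Dec (∃ λ (z : Fin ρ → Fin q) → EdgeT Q z) → _
  withEdge (no none) = ⊥-elim (turanStable⇒edge ℓ 2≤ℓ R stable (λ u v a → none (proj₁ (shadow⇒ r Q a) , proj₁ (proj₂ (shadow⇒ r Q a)))))
  withEdge (yes (z , ez)) = build (archimedean ε 0<ε)
    where
    build : (∃ λ E → Σ (NonZero E) λ nz → reciprocal E {{nz}} ℚ.≤ ε) → _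
    build (E , E≢0 , inv≤) = step₁ (stable (E * C) {{E₀≢0}})
      where
      E₀ = E * C
      E₀≢0 : NonZero (E * C)
      E₀≢0 = m*n≢0 E C {{E≢0}}
      step₁ : (∃ λ D → NonZero D × ∃ λ N → ∀ n → N ≤ n → (G : Graph n) → KFree ℓ G → (∀ M → IsMax ℓ R n M → D * M ≤ D * injHom R G + M) →
        Σ (Permutation′ n) λ π → E₀ * pairs _ (differ? G (permutedColour ℓ π)) ≤ n * n) → _
      step₁ (D , _ , N₂ , close) = step₂ (graphStable E₁ {{E₁≢0}}) (heavyCore ℓ 2≤ℓ r Q F chrom graphStable E₁ {{E₁≢0}} E₁ E₁)
        where
        -- `E₀` serves the final count; `D * κ₀` makes the graph of heavy bichromatic pairs
        -- near-extremal with deficit `1 / D`, through `meetNearMax`.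
        E₁ = E₀ + D * κ₀
        E₁≢0 : NonZero E₁
        E₁≢0 = ℕ.>-nonZero (≤-trans (ℕ.>-nonZero⁻¹ E₀ {{E₀≢0}}) (m≤m+n E₀ _))
        step₂ : (∃ λ D → NonZero D × ∃ λ N → ∀ n → N ≤ n → (G : Graph n) → KFree ℓ G →
            (∀ M → IsMax ℓ R n M → D * M ≤ D * injHom R G + M) → NearColourable E₁ ℓ G) →
          (∃ λ Δ → NonZero Δ × E₁ ≤ Δ × ∃ λ τ → E₁ ≤ τ × ∃ λ N → HeavyCore ℓ r Q F E₁ Δ τ N) → _
        step₂ (D₁ , _ , N₁ , near) (Δ , Δ≢0 , E₁≤Δ , τ , E₁≤τ , N₃ , structure) = reciprocal Δ {{Δ≢0}} , reciprocal-pos Δ {{Δ≢0}} , N ,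
          λ n N≤n H free extremal → finish n N≤n H (λ M isMax → fromDeficit Δ {{Δ≢0}} (extremal M isMax))
            (structure n (ℕ.>-nonZero (≤-trans (s≤s z≤n) N≤n)) (≤-trans (≤-trans (m≤n+m N₃ N₂) (≤-trans (m≤n+m _ N₁) (≤-trans (m≤m+n _ _) (n≤1+n _)))) N≤n) H free
              (λ M isMax → fromDeficit Δ {{Δ≢0}} (extremal M isMax)))
          where
          N = suc (N₁ + (N₂ + N₃) + (2 * suc (q * q) + (2 * ℓ + E₀)))
          finish : ∀ n → N ≤ n → (H : RGraph n) → (∀ M → IsInjMax ρ n Q (expansion ρ F) M → Δ * M ≤ Δ * inj ρ Q H + M) →
            NearColourable E₁ ℓ (heavy r τ H) → TuranClose ρ ℓ ε H
          finish n N≤n H extremal (φ , few) = conclude (close n (≤-trans (≤-trans (m≤m+n N₂ N₃) (≤-trans (m≤n+m _ N₁) big₀)) N≤n) G (meet-KFree (heavy r τ H) φ)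
              (λ M isMax → decidable-stable (_ ≤? _) λ far → isInjMax-exists r Q F unc λ (Mx , isInjMax) →
                far (meetNearMax {D = D} {D₁ = D₁} Q F H φ unc col (≤-trans (≤-trans (m≤m+n _ _) big₁) N≤n)
                  (near n (≤-trans (≤-trans (m≤m+n N₁ (N₂ + N₃)) big₀) N≤n))
                  (m≤n+m (D * κ₀) E₀) E₁≤τ few isInjMax (weaken E₁≤Δ (extremal Mx isInjMax)) isMax)))
            where
            big₀ : N₁ + (N₂ + N₃) ≤ N
            big₀ = ≤-trans (m≤m+n _ _) (n≤1+n _)
            big₁ : 2 * suc (q * q) + (2 * ℓ + E₀) ≤ N
            big₁ = ≤-trans (m≤n+m _ (N₁ + (N₂ + N₃))) (n≤1+n _)
            instance
              n≢0 : NonZero n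
              n≢0 = ℕ.>-nonZero (≤-trans (s≤s z≤n) N≤n)
            G = meet (heavy r τ H) (partite φ)
            E₀≤E₁ : E₀ ≤ E₁
            E₀≤E₁ = m≤m+n E₀ _
            few₀ : E₀ * mono (heavy r τ H) φ ≤ n * n
            few₀ = ≤-trans (*-monoˡ-≤ _ E₀≤E₁) few
            conclude : (Σ (Permutation′ n) λ π → E₀ * pairs _ (differ? G (permutedColour ℓ π)) ≤ n * n) → TuranClose ρ ℓ ε H
            conclude (π , closeπ) = (π ⟨$⟩ʳ_) , perm-injective π _ _ , toFraction E {{E≢0}} {b = n ^ ρ} inv≤ (decidable-stable (_ ≤? _) λ many →
              isInjMax-exists r Q F unc λ (Mx , isInjMax) → many (*-cancelˡ-≤ C (begin
                C * (E * ν) ≡⟨ re₁ C E ν ⟩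
                E₀ * ν ≤⟨ *-monoʳ-≤ E₀ (turanCount ρ H π) ⟩
                E₀ * (# (funs ρ n) (extra? ρ H κ) + # (funs ρ n) (missing? ρ H κ)) ≡⟨ *-distribˡ-+ E₀ _ _ ⟩
                E₀ * # (funs ρ n) (extra? ρ H κ) + E₀ * # (funs ρ n) (missing? ρ H κ)
                  ≤⟨ +-mono-≤ (turanLoss r (≤-trans E₀≤E₁ E₁≤τ) (complete ρ) H φ κ few₀ closeπ (extra? ρ H κ) (λ { y (ey , ¬c) → edgeT⇒homT ρ H y ey , ¬c }))
                       (missingFew r Q F H φ π unc col z ez (≤-trans (≤-trans (≤-trans (m≤m+n _ E₀) (m≤n+m _ (2 * suc (q * q)))) big₁) N≤n)
                         (≤-trans (≤-trans (≤-trans (m≤n+m E₀ _) (m≤n+m _ (2 * suc (q * q)))) big₁) N≤n) (≤-trans E₀≤E₁ E₁≤τ) few₀ closeπ isInjMax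
                         (weaken (≤-trans E₀≤E₁ E₁≤Δ) (extremal Mx isInjMax))) ⟩
                3 * (ρ * (ρ * n ^ ρ)) + (2 * ℓ) ^ q * suc (4 * (q * q)) * n ^ ρ ≡⟨ re₂ ρ (n ^ ρ) ((2 * ℓ) ^ q * suc (4 * (q * q))) ⟩
                C * n ^ ρ ∎)))
              where
              open ≤-Reasoning
              κ = permutedColour ℓ π
              ν = countSub (λ s → isSize ρ s Bool.∧ (isEdge ρ H (image (π ⟨$⟩ʳ_) s) Bool.xor turan ρ n ℓ s))
              re₁ : ∀ C E x → C * (E * x) ≡ E * C * x
              re₁ = solve-∀
              re₂ : ∀ r x y → 3 * (r * (r * x)) + y * x ≡ (3 * (r * r) + y) * x
              re₂ = solve-∀

theorem8p1 : (ℓ r : ℕ) → 2 ≤ r → r ≤ ℓ →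
    {q : ℕ} (Q : RGraph q) {p : ℕ} (F : RGraph p) → ChromaticNumber F (suc ℓ) →
    (EdgeStable 2 ℓ (shadow r Q) (complete (suc ℓ)) → EdgeStable r ℓ Q (expansion r F))
    × (TuranStable 2 ℓ (shadow r Q) (complete (suc ℓ)) → TuranStable r ℓ Q (expansion r F))
theorem8p1 ℓ (suc (suc r)) 2≤r@(s≤s (s≤s _)) r≤ℓ Q F chrom =
  (λ stable → edgePart ℓ 2≤ℓ r Q F chrom (edgeStable⇒graphStable ℓ (shadow (suc (suc r)) Q) stable)) ,
  (λ stable → turanPart ℓ 2≤ℓ {{ℓ≢0}} r Q F chrom (turanStable⇒graphTuran ℓ {{ℓ≢0}} (shadow (suc (suc r)) Q) stable))
  where
  2≤ℓ : 2 ≤ ℓ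
  2≤ℓ = ≤-trans 2≤r r≤ℓ
  ℓ≢0 : NonZero ℓ
  ℓ≢0 = ℕ.>-nonZero (≤-trans (s≤s z≤n) 2≤ℓ)
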